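{- Let $\boldsymbol\lambda=(\lambda^{(1)},\ldots,\lambda^{(k)})$ be a tuple of partitions and $\mathbf d=(d_1,\ldots,d_k)$ a tuple of positive integers with $d_i\geq \ell(\lambda^{(i)})$ for all $i$, and let $n$ be large enough that $\lambda^{(i)}_1\le n-d_i$ for all $i$. Then \[\mathfrak A_{\boldsymbol\lambda,\mathbf d}=\sum_{w\in{\tt MinPerm}(A_{\boldsymbol\lambda,\mathbf d})}\mathfrak S_w,\] where $\mathfrak S_w$ denotes the Schubert polynomial of Lascoux–Schützenberger.
   Context: An alternating sign matrix (ASM) of size $n$ is an $n\times n$ matrix with entries in $\{ -1,0,1\}$ such that the nonzero entries of each row and column alternate in sign and each row and column sums to $1$; ${\sf ASM}(n)$ is the set of these. For $A=(a_{ij})$ its corner sum function is $r_A(i,j)=\sum_{k\le i}\sum_{l\le j}a_{kl}$. Order: $A\le B$ iff $r_A(i,j)\ge r_B(i,j)$ for all $i,j$. This makes ${\sf ASM}(n)$ a lattice; the join $\vee$ of a set of ASMs is the ASM whose corner sum function is the entrywise minimum of their corner sum functions. A permutation $w\in\mathcal S_n$ is identified with its permutation matrix (a $1$ in each position $(i,w(i))$); on $\mathcal S_n$ the order is Bruhat order. $\ell(w)$ is the number of inversions of $w$. For $A\in{\sf ASM}(n)$, ${\tt deg}(A)=\min\{\ell(w):w\in\mathcal S_n, w\ge A\}$, ${\tt Perm}(A)$ is the set of minimal elements of $\{w\in\mathcal S_n:w\ge A\}$, and ${\tt MinPerm}(A)=\{w\in{\tt Perm}(A):\ell(w)={\tt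 deg}(A)\}$. For a partition $\lambda$ with $\ell(\lambda)\le d$ and $\lambda_1\le n-d$, $[\lambda,d]_g\in\mathcal S_n$ is the permutation $u$ with $u(k)=\lambda_{d-k+1}+k$ for $1\le k\le d$ and $u(d+1)<\cdots<u(n)$ the remaining values (if $\lambda$ is empty, $[\lambda,d]_g$ is the identity). Define $A_{\boldsymbol\lambda,\mathbf d}=\vee\{[\lambda^{(1)},d_1]_g,\ldots,[\lambda^{(k)},d_k]_g\}\in{\sf ASM}(n)$. Prism tableaux: use matrix coordinates $(a,b)$ (row $a$ from the top, column $b$ from the left) in $\mathbb Z_{>0}\times\mathbb Z_{>0}$. Place $\lambda^{(c)}$ as the set of cells $\{(a,b):1\le a\le d_c,\ 1\le b\le \lambda^{(c)}_{d_c-a+1}\}$ (so its longest row is row $d_c$). A prism tableau for $(\boldsymbol\lambda,\mathbf d)$ is a tuple $\mathcal T=(T^{(1)},\ldots,T^{(k)})$ where $T^{(c)}$ ("color $c$") fills the cells of $\lambda^{(c)}$ with integers in $\{1,\ldots,d_c\}$ that weakly decrease along rows from left to right and strictly decrease along columns from bottom to top. An antidiagonal is a set $\{(a,b):a+b=s\}$. The weight is ${\tt wt}(\mathcal T)=\prod_m x_m^{n_m}$ where $n_m$ is the number of antidiagonals containing an entry equal to $m$ (of any color). $\mathcal T$ is minimal if the total degree of ${\tt wt}(\mathcal T)$ is the minimum over all prism tableaux for $(\boldsymbol\lambda,\mathbf d)$. $\mathcal T$ has an unstable triple if, in some antidiagonal, there are an entry $\ell$ of color $c$, another entry $\ell$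 of a color $d\neq c$, and an entry $\ell'$ (of some color $e$) with $\ell<\ell'$, such that replacing that entry $\ell$ of color $c$ by $\ell'$ yields again a prism tableau. ${\tt Prism}(\boldsymbol\lambda,\mathbf d)$ is the set of minimal prism tableaux with no unstable triples, and $\mathfrak A_{\boldsymbol\lambda,\mathbf d}=\sum_{\mathcal T\in{\tt Prism}(\boldsymbol\lambda,\mathbf d)}{\tt wt}(\mathcal T)$. -}

module Defs where

open import Data.Nat using (ℕ; zero; suc; _+_; _*_; _∸_; _≤_; _<_; _≟_; _≤?_; _<ᵇ_; _≡ᵇ_; _⊓_)
open import Data.Integer using (ℤ; +_; -_) renaming (_+_ to _+ℤ_)
open import Data.Bool using (Bool; true; false; _∧_; if_then_else_)
open import Data.Maybe using (Maybe; just; nothing; _>>=_)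
open import Data.List using (List; []; _∷_; _++_; map; filter; length; take; concat; concatMap; upTo; foldr; deduplicate)
open import Data.Nat.ListAction using (sum)
open import Data.List.Relation.Unary.All using (All)
open import Data.List.Relation.Unary.Linked using (Linked)
open import Data.List.Relation.Binary.Pointwise using (Pointwise)
open import Data.List.Relation.Binary.Permutation.Propositional using (_↭_)
open import Data.List.Membership.DecPropositional _≟_ using (_∈?_)
open import Data.Product using (_×_; _,_; Σ; ∃)
open import Relation.Nullary using (¬_; ¬?)
open import Relation.Binary.PropositionalEquality using (_≡_; _≢_)

-- Generic list helpers (all indices are 1-based unless said otherwise)

nth? : {A : Set} → List A → ℕ → Maybe A
nth? []       _       = nothing
nth? (x ∷ xs) zero    = just x
nth? (x ∷ xs) (suc i) = nth? xs i

nthD : {A : Set} → A → List A → ℕ → A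
nthD d []       _       = d
nthD d (x ∷ xs) zero    = x
nthD d (x ∷ xs) (suc i) = nthD d xs i

modifyAt : {A : Set} → ℕ → (A → A) → List A → List A
modifyAt _       f []       = []
modifyAt zero    f (x ∷ xs) = f x ∷ xs
modifyAt (suc i) f (x ∷ xs) = x ∷ modifyAt i f xs

setAt0 : ℕ → ℕ → List ℕ → List ℕ
setAt0 zero    v []       = v ∷ []
setAt0 zero    v (x ∷ xs) = v ∷ xs
setAt0 (suc i) v []       = 0 ∷ setAt0 i v []
setAt0 (suc i) v (x ∷ xs) = x ∷ setAt0 i v xs

range1 : ℕ → List ℕ
range1 n = map suc (upTo n)

indexedFrom : {A : Set} → ℕ → List A → List (ℕ × A)
indexedFrom k []       = []
indexedFrom k (x ∷ xs) = (k , x) ∷ indexedFrom (suc k) xs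

indexed : {A : Set} → List A → List (ℕ × A)
indexed = indexedFrom 1

IsPartition : List ℕ → Set
IsPartition λs = All (λ p → 1 ≤ p) λs × Linked (λ a b → b ≤ a) λs

part : List ℕ → ℕ → ℕ
part λs zero    = 0
part λs (suc i) = nthD 0 λs i

-- Permutations in one-line notation: w = [w(1), ..., w(n)]

IsPerm : ℕ → List ℕ → Set
IsPerm n w = w ↭ range1 n

inv : List ℕ → ℕ
inv []       = 0
inv (x ∷ xs) = length (filter (λ y → suc y ≤? x) xs) + inv xs

-- corner sum function of the permutation matrix: r_w(i,j) = #{k ≤ i : w(k) ≤ j}
corner : List ℕ → ℕ → ℕ → ℕ
corner w i j = length (filter (λ y → y ≤? j) (take i w))

grass : List ℕ → ℕ → ℕ → List ℕ
grass λs d n = first ++ filter (λ x → ¬? (x ∈? first)) (range1 n)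
  where
  first : List ℕ
  first = map (λ k → part λs (d ∸ k + 1) + k) (range1 d)

-- data (λ^(1),d_1), ..., (λ^(k),d_k)
Data : Set
Data = List (List ℕ × ℕ)

-- corner sum function of A_{λ,d} = ∨ {[λ^(c),d_c]_g}: the entrywise minimum
-- of the corner sum functions (the fold starts from min(i,j), which is
-- r_id(i,j) and is ≥ every permutation's corner sum, so it does not
-- affect the minimum for nonempty data)
rA : ℕ → Data → ℕ → ℕ → ℕ
rA n D i j = foldr (λ p r → corner (grass (Data.Product.proj₁ p) (Data.Product.proj₂ p) n) i j ⊓ r) (i ⊓ j) D

GeA : ℕ → Data → List ℕ → Set
GeA n D w = ∀ i j → 1 ≤ i → i ≤ n → 1 ≤ j → j ≤ n → corner w i j ≤ rA n D i j

BruhatLe : ℕ → List ℕ → List ℕ → Set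
BruhatLe n v w = ∀ i j → 1 ≤ i → i ≤ n → 1 ≤ j → j ≤ n → corner w i j ≤ corner v i j

InPermA : ℕ → Data → List ℕ → Set
InPermA n D w = IsPerm n w × GeA n D w
  × (∀ v → IsPerm n v → GeA n D v → BruhatLe n v w → v ≡ w)

IsDegA : ℕ → Data → ℕ → Set
IsDegA n D m = (Σ (List ℕ) λ w → IsPerm n w × GeA n D w × inv w ≡ m)
  × (∀ w → IsPerm n w → GeA n D w → m ≤ inv w)

InMinPermA : ℕ → Data → List ℕ → Set
InMinPermA n D w = InPermA n D w × IsDegA n D (inv w)

-- Polynomials with integer coefficients: finite lists of terms
-- (coefficient, exponent vector), exponent vector position p ↦ x_{p+1}.

Mono : Set
Mono = List ℕ

Poly : Set
Poly = List (ℤ × Mono)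

monoEqᵇ : Mono → Mono → Bool
monoEqᵇ []       []       = true
monoEqᵇ []       (y ∷ ys) = (y ≡ᵇ 0) ∧ monoEqᵇ [] ys
monoEqᵇ (x ∷ xs) []       = (x ≡ᵇ 0) ∧ monoEqᵇ xs []
monoEqᵇ (x ∷ xs) (y ∷ ys) = (x ≡ᵇ y) ∧ monoEqᵇ xs ys

coeff : Poly → Mono → ℤ
coeff p e = foldr (λ t acc → (if monoEqᵇ (Data.Product.proj₂ t) e then Data.Product.proj₁ t else + 0) +ℤ acc) (+ 0) p

_≈P_ : Poly → Poly → Set
p ≈P q = ∀ e → coeff p e ≡ coeff q e

sumP : List Poly → Poly
sumP = concat

-- divided difference ∂_i (i ≥ 1 : acts on x_i, x_{i+1}) on a term c·x^m
ddTerm : ℕ → ℤ × Mono → Poly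
ddTerm i (c , m) =
  if b <ᵇ a then map (λ j → (c , setAt0 i (a ∸ 1 ∸ j) (setAt0 (i ∸ 1) (b + j) m))) (upTo (a ∸ b))
  else if a <ᵇ b then map (λ j → (- c , setAt0 i (b ∸ 1 ∸ j) (setAt0 (i ∸ 1) (a + j) m))) (upTo (b ∸ a))
  else []
  where
  a = nthD 0 m (i ∸ 1)
  b = nthD 0 m i

dd : ℕ → Poly → Poly
dd i p = concatMap (ddTerm i) p

firstAscentFrom : ℕ → List ℕ → Maybe ℕ
firstAscentFrom k []           = nothing
firstAscentFrom k (x ∷ [])     = nothing
firstAscentFrom k (x ∷ y ∷ ys) = if x <ᵇ y then just k else firstAscentFrom (suc k) (y ∷ ys)

swapAt : ℕ → List ℕ → List ℕ
swapAt zero          w            = w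
swapAt (suc zero)    (x ∷ y ∷ ys) = y ∷ x ∷ ys
swapAt (suc zero)    w            = w
swapAt (suc (suc i)) []           = []
swapAt (suc (suc i)) (x ∷ xs)     = x ∷ swapAt (suc i) xs

-- x_1^{n-1} x_2^{n-2} ... x_{n-1}^1  (= 𝔖_{w_0})
deltaP : ℕ → Poly
deltaP n = (+ 1 , map (λ i → n ∸ i) (range1 n)) ∷ []

-- 𝔖_w = ∂_i 𝔖_{w s_i} whenever w(i) < w(i+1); 𝔖_{w_0} = x^δ.
-- The fuel bounds the number of steps (at most n(n-1)/2 < n*n are needed).
schubF : ℕ → ℕ → List ℕ → Poly
schubF n zero    w = deltaP n
schubF n (suc f) w with firstAscentFrom 1 w
... | nothing = deltaP n
... | just i  = dd i (schubF n f (swapAt i w))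

schubert : ℕ → List ℕ → Poly
schubert n w = schubF n (n * n) w

-- Prism tableaux.  A filling of color c is the list of its rows
-- a = 1..d_c (top to bottom), row a being the list of entries in columns
-- b = 1..λ_{d_c-a+1}.  A prism tableau is the list of its colors.

Filling : Set
Filling = List (List ℕ)

PrismTab : Set
PrismTab = List Filling

ent : Filling → ℕ → ℕ → Maybe ℕ
ent F zero    _       = nothing
ent F _       zero    = nothing
ent F (suc a) (suc b) = nth? F a >>= λ row → nth? row b

entC : PrismTab → ℕ → ℕ → ℕ → Maybe ℕ
entC T zero    a b = nothing
entC T (suc c) a b = nth? T c >>= λ F → ent F a b

ValidFilling : List ℕ × ℕ → Filling → Set
ValidFilling (λs , d) F =
    length F ≡ d
  × (∀ a → 1 ≤ a → a ≤ d → length (nthD [] F (a ∸ 1)) ≡ part λs (d ∸ a + 1))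
  × (∀ a b v → ent F a b ≡ just v → 1 ≤ v × v ≤ d)
  × (∀ a b v v′ → ent F a b ≡ just v → ent F a (suc b) ≡ just v′ → v′ ≤ v)
  × (∀ a b v v′ → ent F a b ≡ just v → ent F (suc a) b ≡ just v′ → v < v′)

IsPT : Data → PrismTab → Set
IsPT D T = Pointwise ValidFilling D T

cells : PrismTab → List (ℕ × ℕ × ℕ × ℕ)
cells T = concatMap (λ { (c , F) → concatMap (λ { (a , row) →
            map (λ { (b , v) → (c , a , b , v) }) (indexed row) }) (indexed F) }) (indexed T)

-- exponent vector of wt(T) in x_1..x_n: n_m = #antidiagonals containing an entry m
wtExp : ℕ → PrismTab → Mono
wtExp n T = map (λ m → length (deduplicate _≟_
               (map (λ { (c , a , b , v) → a + b })
                 (filter (λ { (c , a , b , v) → v ≟ m }) (cells T)))))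
             (range1 n)

wtP : ℕ → PrismTab → Poly
wtP n T = (+ 1 , wtExp n T) ∷ []

totalDeg : ℕ → PrismTab → ℕ
totalDeg n T = sum (wtExp n T)

Minimal : ℕ → Data → PrismTab → Set
Minimal n D T = IsPT D T × (∀ T′ → IsPT D T′ → totalDeg n T ≤ totalDeg n T′)

update : PrismTab → ℕ → ℕ → ℕ → ℕ → PrismTab
update T c a b v = modifyAt (c ∸ 1) (modifyAt (a ∸ 1) (modifyAt (b ∸ 1) (λ _ → v))) T

HasUnstable : Data → PrismTab → Set
HasUnstable D T =
  Σ ℕ λ c → Σ ℕ λ a → Σ ℕ λ b →
  Σ ℕ λ d′ → Σ ℕ λ a′ → Σ ℕ λ b′ →
  Σ ℕ λ e → Σ ℕ λ a″ → Σ ℕ λ b″ →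
  Σ ℕ λ l → Σ ℕ λ l′ →
    entC T c a b ≡ just l
  × entC T d′ a′ b′ ≡ just l × c ≢ d′ × a′ + b′ ≡ a + b
  × entC T e a″ b″ ≡ just l′ × a″ + b″ ≡ a + b
  × l < l′
  × IsPT D (update T c a b l′)

InPrism : ℕ → Data → PrismTab → Set
InPrism n D T = Minimal n D T × ¬ HasUnstable D T

{-# OPTIONS --safe #-}
module Submission where

-- Encode a prism tableau T by its support: the set of pairs (m , q) such that m occurs on the
-- antidiagonal a + b = q + 1.  Seen as crossings of a pipe dream P, the support carries the weight
-- of T, and a word P carries a tableau of color (λ , d) exactly when [λ,d]_g is below the Demazure
-- product of P: reading P, one removes a corner of λ whenever a letter allows it.  Hence the supports
-- of tableaux of minimal degree are the reduced pipe dreams of the permutations in MinPerm(A).  The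
-- tableaux carried by P are closed under entrywise maxima, and having no unstable triple means being
-- the greatest one, so each such P is the support of exactly one element of Prism(λ , d).
--
-- It remains that 𝔖_w is the sum of the weights of the reduced pipe dreams of w.  With
-- A_i(x) = (1 + x u_{n-1}) ⋯ (1 + x u_i) over the nilCoxeter algebra, that sum is the coefficient of
-- w in A_1(x_1) ⋯ A_{n-1}(x_{n-1}), and ∂_i acts on this product as right multiplication by u_i
-- because A_i(x) and A_i(y) commute (Fomin–Kirillov).

open import Defs
open import Data.Nat
open import Data.Nat.ListAction using (sum)
open import Data.Nat.Properties
open import Data.Integer as ℤ using (ℤ; +_)
import Data.Integer.Properties as ℤ
open import Data.Integer.Tactic.RingSolver using (solve-∀)
open import Algebra.Properties.CommutativeSemigroup ℤ.+-commutativeSemigroup using () renaming (interchange to ℤ-interchange)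
open import Algebra.Properties.CommutativeSemigroup +-commutativeSemigroup using (x∙yz≈y∙xz)
open import Algebra.Properties.CommutativeSemigroup ⊔-commutativeSemigroup using () renaming (interchange to ⊔-interchange)
open import Data.Bool as Bool using (Bool; true; false; _∧_; if_then_else_)
open import Data.Bool.Properties using (∧-comm; ∧-assoc; T-≡)
open import Data.Maybe as Maybe using (Maybe; just; nothing; maybe′; fromMaybe)
open import Data.Maybe.Properties using (just-injective)
open import Data.Product using (_×_; _,_; proj₁; proj₂; ∃)
open import Data.Product.Properties using (,-injectiveˡ; ,-injectiveʳ) renaming (≡-dec to ×-≡-dec)
open import Data.Sum using (_⊎_; inj₁; inj₂)
open import Data.Empty using (⊥; ⊥-elim)
open import Data.List
  using ( List; []; _∷_; _++_; _∷ʳ_; map; length; filter; take; drop; concat; concatMap; reverse; upTo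
        ; applyUpTo; deduplicate )
open import Data.List.Properties
  using ( ≡-dec; map-applyUpTo; map-++; map-cong-local; filter-++; length-map; length-upTo; length-++; length-take
        ; length-filter; length-applyUpTo; length-drop; take-all; filter-all; filter-none; unfold-reverse; reverse-involutive )
open import Data.List.Membership.Propositional using (_∈_; find; lose)
open import Data.List.Membership.Propositional.Properties
  using ( ∈-++⁺ˡ; ∈-++⁺ʳ; ∈-++⁻; ∈-map⁺; ∈-map⁻; ∈-filter⁺; ∈-filter⁻; ∈-∃++; ∈-concat⁺′; ∈-concat⁻′
        ; ∈-concatMap⁺; ∈-concatMap⁻; ∈-deduplicate⁺; ∈-deduplicate⁻ )
open import Data.List.Membership.Propositional.Properties.WithK using (unique∧set⇒bag)
open import Data.List.Membership.DecPropositional _≟_ using (_∈?_)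
open import Data.List.Membership.DecPropositional (×-≡-dec _≟_ _≟_) using () renaming (_∈?_ to _∈×?_)
open import Data.List.Relation.Binary.BagAndSetEquality using (∼bag⇒↭)
open import Data.List.Relation.Binary.Permutation.Propositional as ↭
  using (_↭_; ↭-refl; ↭-trans; ↭-sym; ↭⇒↭ₛ; prep; swap)
open import Data.List.Relation.Binary.Permutation.Propositional.Properties using (↭-length; filter-↭; map⁺; All-resp-↭)
import Data.List.Relation.Binary.Permutation.Setoid.Properties as PermSetoid
open import Data.List.Relation.Binary.Pointwise using (Pointwise; []; _∷_; Pointwise-≡⇒≡)
open import Data.List.Relation.Binary.Sublist.Propositional as Sublist using (_⊆_; []; _∷_)
open import Data.List.Relation.Binary.Sublist.Propositional.Properties using (All-resp-⊆; Any-resp-⊆; length-mono-≤; to-≋)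
open import Data.List.Relation.Unary.All as All using (All; []; _∷_)
import Data.List.Relation.Unary.All.Properties as All
open import Data.List.Relation.Unary.AllPairs as AllPairs using (AllPairs; []; _∷_)
import Data.List.Relation.Unary.AllPairs.Properties as AllPairs
open import Data.List.Relation.Unary.Any using (Any; here; there; any?)
import Data.List.Relation.Unary.Any.Properties as Any
open import Data.List.Relation.Unary.Linked using (Linked; []; [-]; _∷_)
open import Data.List.Relation.Unary.Linked.Properties using (AllPairs⇒Linked; Linked⇒AllPairs)
open import Data.List.Relation.Unary.Sorted.TotalOrder.Properties using (↗↭↗⇒≋)
open import Data.List.Relation.Unary.Unique.DecPropositional.Properties _≟_ using (deduplicate-!)
open import Data.List.Relation.Unary.Unique.Propositional using (Unique)
import Data.List.Relation.Unary.Unique.Propositional.Properties as Unique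
open import Function using (_∘_; id; Equivalence; mk⇔)
open import Function.Bundles using (_⇔_)
open import Relation.Binary.Definitions using (tri<; tri≈; tri>)
open import Relation.Binary.PropositionalEquality hiding ([_])
open import Relation.Nullary using (¬_; ¬?; Dec; yes; no; does; contradiction)
open import Relation.Nullary.Decidable using (dec-true; dec-false; _×-dec_)

-- A minimal tableau without unstable triples is the greatest one by a count of crossings. If a
-- larger fit exists, some entry l can be raised to a value that the support already has on the same
-- antidiagonal. The support then gains nothing, so by minimality it does not lose the crossing of l
-- either. Within one color a value occurs at most once on an antidiagonal, hence l occurs there in
-- another color, and this is an unstable triple.
--
-- The order on ASMs is reached through functions f with steps 0 or 1. Comparison with [λ,d]_g only
-- concerns row d of the corner sums, and row d of [λ,d]_g is at the same time the shape of λ in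
-- antidiagonal coordinates. Left Demazure multiplication acts inside a row, and its counterpart on
-- f removes a corner of the shape.
--
-- Divided differences are characterized rather than computed: the products of both sides with x_i -
-- x_{i+1} agree, and this factor is not a zero divisor.

-- Descents, the operators max (w, w s_q) and min (w, w s_q), and their corner sums.

<ᵇ-true : ∀ {m n} → m < n → (m <ᵇ n) ≡ true
<ᵇ-true = Equivalence.to T-≡ ∘ <⇒<ᵇ

<ᵇ-false : ∀ {m n} → n ≤ m → (m <ᵇ n) ≡ false
<ᵇ-false {m} {n} n≤m with m <ᵇ n in eq
... | false = refl
... | true  = contradiction (<ᵇ⇒< m n (Equivalence.from T-≡ eq)) (≤⇒≯ n≤m)

<ᵇ-true⁻¹ : ∀ m n → (m <ᵇ n) ≡ true → m < n
<ᵇ-true⁻¹ m n eq = <ᵇ⇒< m n (Equivalence.from T-≡ eq)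

<ᵇ-false⁻¹ : ∀ m n → (m <ᵇ n) ≡ false → n ≤ m
<ᵇ-false⁻¹ m n eq with m <? n
... | yes m<n = contradiction (trans (sym (<ᵇ-true m<n)) eq) λ ()
... | no  m≮n = ≮⇒≥ m≮n

-- Positions out of range, including 0, count as ascents. There `swapAt` is the identity, so `up`
-- and `dn` do nothing and `nil` vanishes.
desc : ℕ → List ℕ → Bool
desc (suc zero)    (x ∷ y ∷ ys) = y <ᵇ x
desc (suc (suc q)) (x ∷ xs)     = desc (suc q) xs
desc _             _            = false

up : ℕ → List ℕ → List ℕ
up q w = if desc q w then w else swapAt q w

dn : ℕ → List ℕ → List ℕ
dn q w = if desc q w then swapAt q w else w

up-∷ : ∀ q x xs → up (suc (suc q)) (x ∷ xs) ≡ x ∷ up (suc q) xs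
up-∷ q x xs with desc (suc q) xs
... | true  = refl
... | false = refl

dn-∷ : ∀ q x xs → dn (suc (suc q)) (x ∷ xs) ≡ x ∷ dn (suc q) xs
dn-∷ q x xs with desc (suc q) xs
... | true  = refl
... | false = refl

swapAt-↭ : ∀ q w → swapAt q w ↭ w
swapAt-↭ zero          w            = ↭-refl
swapAt-↭ (suc zero)    []           = ↭-refl
swapAt-↭ (suc zero)    (x ∷ [])     = ↭-refl
swapAt-↭ (suc zero)    (x ∷ y ∷ ys) = swap y x ↭-refl
swapAt-↭ (suc (suc q)) []           = ↭-refl
swapAt-↭ (suc (suc q)) (x ∷ xs)     = prep x (swapAt-↭ (suc q) xs)

swapAt-involutive : ∀ q w → swapAt q (swapAt q w) ≡ w
swapAt-involutive zero          w            = refl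
swapAt-involutive (suc zero)    []           = refl
swapAt-involutive (suc zero)    (x ∷ [])     = refl
swapAt-involutive (suc zero)    (x ∷ y ∷ ys) = refl
swapAt-involutive (suc (suc q)) []           = refl
swapAt-involutive (suc (suc q)) (x ∷ xs)     = cong (x ∷_) (swapAt-involutive (suc q) xs)

up-↭ : ∀ q w → up q w ↭ w
up-↭ q w with desc q w
... | true  = ↭-refl
... | false = swapAt-↭ q w

dn-↭ : ∀ q w → dn q w ↭ w
dn-↭ q w with desc q w
... | true  = swapAt-↭ q w
... | false = ↭-refl

desc-swapAt : ∀ q w → desc q w ≡ true → desc q (swapAt q w) ≡ false
desc-swapAt (suc zero)    (x ∷ y ∷ ys) d = <ᵇ-false (<⇒≤ (<ᵇ-true⁻¹ y x d))
desc-swapAt (suc (suc q)) (x ∷ xs)     d = desc-swapAt (suc q) xs d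

asc-swapAt : ∀ q w → Unique w → 1 ≤ q → q < length w → desc q w ≡ false → desc q (swapAt q w) ≡ true
asc-swapAt (suc zero) (x ∷ []) _ _ (s≤s ()) _
asc-swapAt (suc zero) (x ∷ y ∷ ys) ((x≢y ∷ _) ∷ _) _ _ d = <ᵇ-true (≤∧≢⇒< (<ᵇ-false⁻¹ y x d) x≢y)
asc-swapAt (suc (suc q)) (x ∷ xs) (_ ∷ u) _ (s≤s q<) d = asc-swapAt (suc q) xs u (s≤s z≤n) q< d

bit : ℕ → ℕ → ℕ
bit x j = if does (x ≤? j) then 1 else 0

bit-≤ : ∀ {x j} → x ≤ j → bit x j ≡ 1
bit-≤ {x} {j} x≤j rewrite dec-true (x ≤? j) x≤j = refl

bit-> : ∀ {x j} → j < x → bit x j ≡ 0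
bit-> {x} {j} j<x rewrite dec-false (x ≤? j) (<⇒≱ j<x) = refl

bit≤1 : ∀ x j → bit x j ≤ 1
bit≤1 x j with does (x ≤? j)
... | true  = ≤-refl
... | false = z≤n

cnt : List ℕ → ℕ → ℕ
cnt w j = length (filter (λ y → y ≤? j) w)

cnt-∷ : ∀ x w j → cnt (x ∷ w) j ≡ bit x j + cnt w j
cnt-∷ x w j with does (x ≤? j)
... | true  = refl
... | false = refl

cnt-++ : ∀ xs ys j → cnt (xs ++ ys) j ≡ cnt xs j + cnt ys j
cnt-++ []       ys j = refl
cnt-++ (x ∷ xs) ys j rewrite cnt-∷ x (xs ++ ys) j | cnt-∷ x xs j | cnt-++ xs ys j =
  sym (+-assoc (bit x j) (cnt xs j) (cnt ys j))

cnt-↭ : ∀ {xs ys} j → xs ↭ ys → cnt xs j ≡ cnt ys j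
cnt-↭ j p = ↭-length (filter-↭ (λ y → y ≤? j) p)

corner-∷ : ∀ x w i j → corner (x ∷ w) (suc i) j ≡ bit x j + corner w i j
corner-∷ x w i j = cnt-∷ x (take i w) j

Rank : Set
Rank = ℕ → ℕ → ℕ

-- The effect of the Demazure operator w ↦ max (w, w s_q) on corner sums,
-- as an operator on arbitrary functions.
demRow : ℕ → Rank → Rank
demRow q r i j = if does (i ≟ q) then r (q ∸ 1) j ⊔ (r (suc q) j ∸ 1) else r i j

≡⇒if : ∀ {A : Set} {i q : ℕ} {a b : A} → i ≡ q → (if does (i ≟ q) then a else b) ≡ a
≡⇒if {i = i} {q} p rewrite dec-true (i ≟ q) p = refl

≢⇒if : ∀ {A : Set} {i q : ℕ} {a b : A} → i ≢ q → (if does (i ≟ q) then a else b) ≡ b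
≢⇒if {i = i} {q} p rewrite dec-false (i ≟ q) p = refl

bit-up : ∀ x y j c → y ≤ x → bit x j + c ≡ c ⊔ ((bit x j + (bit y j + c)) ∸ 1)
bit-up x y j c y≤x with x ≤? j
... | yes x≤j rewrite bit-≤ x≤j | bit-≤ (≤-trans y≤x x≤j) = sym (m≤n⇒m⊔n≡n (n≤1+n c))
... | no  x≰j rewrite bit-> (≰⇒> x≰j) =
  sym (m≥n⇒m⊔n≡m (≤-trans (∸-monoˡ-≤ 1 (+-monoˡ-≤ c (bit≤1 y j))) ≤-refl))

+-bit-⊔ : ∀ x j a b → bit x j + (a ⊔ (b ∸ 1)) ≡ (bit x j + a) ⊔ ((bit x j + b) ∸ 1)
+-bit-⊔ x j a b with does (x ≤? j)
... | false = refl
... | true with b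
...   | zero  = cong suc (trans (⊔-identityʳ a) refl) 
...   | suc b = refl

-- Only row q changes. Placing the larger of the two values first gives the least count compatible
-- with the neighbouring rows, which is the larger of the lower bounds r(q-1) and r(q+1) - 1.
corner-up : ∀ q w → 1 ≤ q → q < length w → ∀ i j → corner (up q w) i j ≡ demRow q (corner w) i j
corner-up (suc zero) (x ∷ []) _ (s≤s ()) i j
corner-up (suc zero) (x ∷ y ∷ ys) _ _ i j with y <ᵇ x in eq
... | true  = lem i
  where
  lem : ∀ i → corner (x ∷ y ∷ ys) i j ≡ demRow 1 (corner (x ∷ y ∷ ys)) i j
  lem 0 = refl
  lem 1 rewrite corner-∷ x (y ∷ ys) 0 j | corner-∷ x (y ∷ ys) 1 j | corner-∷ y ys 0 j =
    bit-up x y j 0 (<⇒≤ (<ᵇ-true⁻¹ y x eq))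
  lem (suc (suc i)) = refl
... | false = lem i
  where
  lem : ∀ i → corner (y ∷ x ∷ ys) i j ≡ demRow 1 (corner (x ∷ y ∷ ys)) i j
  lem 0 = refl
  lem 1 rewrite corner-∷ y (x ∷ ys) 0 j | corner-∷ x (y ∷ ys) 1 j | corner-∷ y ys 0 j =
    trans (bit-up y x j 0 (<ᵇ-false⁻¹ y x eq))
      (cong (_∸ 1) (x∙yz≈y∙xz (bit y j) (bit x j) 0))
  lem (suc (suc i)) = cnt-↭ j (swap y x ↭-refl)
corner-up (suc (suc q)) (x ∷ xs) _ (s≤s q<) i j = trans (cong (λ v → corner v i j) (up-∷ q x xs)) (lem i)
  where
  lem : ∀ i → corner (x ∷ up (suc q) xs) i j ≡ demRow (suc (suc q)) (corner (x ∷ xs)) i j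
  lem zero = refl
  lem (suc i) rewrite corner-∷ x (up (suc q) xs) i j | corner-up (suc q) xs (s≤s z≤n) q< i j
                    | corner-∷ x xs i j | corner-∷ x xs (suc (suc q)) j | corner-∷ x xs q j with i ≟ suc q
  ... | yes refl rewrite dec-true (q ≟ q) refl = +-bit-⊔ x j (corner xs q j) (corner xs (suc (suc q)) j)
  ... | no i≢q rewrite dec-false (i ≟ suc q) i≢q = refl

bit-dn : ∀ x y j c → y ≤ x → bit y j + c ≡ (suc c) ⊓ (bit x j + (bit y j + c))
bit-dn x y j c y≤x with y ≤? j
... | yes y≤j rewrite bit-≤ y≤j = sym (m≤n⇒m⊓n≡m (m≤n+m (suc c) (bit x j)))
... | no  y≰j rewrite bit-> (≰⇒> y≰j) | bit-> (<-≤-trans (≰⇒> y≰j) y≤x) = sym (m≥n⇒m⊓n≡n (n≤1+n c))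

-- Dually, the smaller value placed first gives the greatest possible count, the smaller of the
-- upper bounds r(q-1) + 1 and r(q+1). Being monotone in r, this makes `dn q` monotone for Bruhat
-- order.
corner-dn : ∀ q w → 1 ≤ q → q < length w → ∀ j →
  corner (dn q w) q j ≡ suc (corner w (q ∸ 1) j) ⊓ corner w (suc q) j
corner-dn (suc zero) (x ∷ []) _ (s≤s ()) j
corner-dn (suc zero) (x ∷ y ∷ ys) _ _ j with y <ᵇ x in eq
... | true  rewrite corner-∷ y (x ∷ ys) 0 j | corner-∷ x (y ∷ ys) 1 j | corner-∷ y ys 0 j =
    bit-dn x y j 0 (<⇒≤ (<ᵇ-true⁻¹ y x eq))
... | false rewrite corner-∷ x (y ∷ ys) 0 j | corner-∷ x (y ∷ ys) 1 j | corner-∷ y ys 0 j =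
    trans (bit-dn y x j 0 (<ᵇ-false⁻¹ y x eq)) (cong (1 ⊓_) (x∙yz≈y∙xz (bit y j) (bit x j) 0))
corner-dn (suc (suc q)) (x ∷ xs) _ (s≤s q<) j = trans (cong (λ v → corner v (2 + q) j) (dn-∷ q x xs)) lem
  where
  lem : corner (x ∷ dn (suc q) xs) (2 + q) j ≡ suc (corner (x ∷ xs) (suc q) j) ⊓ corner (x ∷ xs) (3 + q) j
  lem rewrite corner-∷ x (dn (suc q) xs) (suc q) j | corner-dn (suc q) xs (s≤s z≤n) q< j
            | corner-∷ x xs q j | corner-∷ x xs (suc (suc q)) j with does (x ≤? j)
  ... | true  = refl
  ... | false = refl

corner-dn-≢ : ∀ q w i j → i ≢ q → corner (dn q w) i j ≡ corner w i j
corner-dn-≢ q w i j i≢q with desc q w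
... | false = refl
... | true  = lem q w i i≢q
  where
  lem : ∀ q w i → i ≢ q → corner (swapAt q w) i j ≡ corner w i j
  lem zero          w            i             _   = refl
  lem (suc zero)    []           i             _   = refl
  lem (suc zero)    (x ∷ [])     i             _   = refl
  lem (suc zero)    (x ∷ y ∷ ys) zero          _   = refl
  lem (suc zero)    (x ∷ y ∷ ys) (suc zero)    1≢1 = contradiction refl 1≢1
  lem (suc zero)    (x ∷ y ∷ ys) (suc (suc i)) _   = cnt-↭ j (swap y x ↭-refl)
  lem (suc (suc q)) []           i             _   = refl
  lem (suc (suc q)) (x ∷ xs)     zero          _   = refl
  lem (suc (suc q)) (x ∷ xs)     (suc i)       i≢q
    rewrite corner-∷ x (swapAt (suc q) xs) i j | corner-∷ x xs i j | lem (suc q) xs i (i≢q ∘ cong suc) = refl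

inv-desc : ∀ q w → desc q w ≡ true → inv w ≡ suc (inv (swapAt q w))
inv-desc (suc zero) (x ∷ y ∷ ys) d rewrite <ᵇ-false {x} {y} (<⇒≤ (<ᵇ-true⁻¹ y x d)) | d =
  cong suc (x∙yz≈y∙xz a b c)
  where
  a = length (filter (λ z → suc z ≤? x) ys)
  b = length (filter (λ z → suc z ≤? y) ys)
  c = inv ys
inv-desc (suc (suc q)) (x ∷ xs) d = trans
  (cong₂ _+_ (sym (↭-length (filter-↭ (λ z → suc z ≤? x) (swapAt-↭ (suc q) xs)))) (inv-desc (suc q) xs d))
  (+-suc _ _)

inv-up : ∀ q w → Unique w → 1 ≤ q → q < length w → desc q w ≡ false → inv (swapAt q w) ≡ suc (inv w)
inv-up q w u 1≤q q< d = trans (inv-desc q (swapAt q w) (asc-swapAt q w u 1≤q q< d))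
  (cong (suc ∘ inv) (swapAt-involutive q w))

-- Families of polynomials and the nilCoxeter action

-- Division of a monomial by a variable. Missing entries of an exponent vector stand for zeros, here
-- and in `sw`.
dec : ℕ → Mono → Maybe Mono
dec m       []          = nothing
dec zero    (zero ∷ e)  = nothing
dec zero    (suc a ∷ e) = just (a ∷ e)
dec (suc m) (a ∷ e)     = Maybe.map (a ∷_) (dec m e)

sw : ℕ → Mono → Mono
sw i       []          = []
sw zero    (a ∷ [])    = 0 ∷ a ∷ []
sw zero    (a ∷ b ∷ e) = b ∷ a ∷ e
sw (suc i) (a ∷ e)     = a ∷ sw i e

-- A family of polynomials indexed by one-line notations, given by its coefficients.
Family : Set
Family = List ℕ → Mono → ℤ

infix 4 _≗₂_
_≗₂_ : Family → Family → Set
f ≗₂ g = ∀ w e → f w e ≡ g w e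

infixl 6 _⊕_
_⊕_ : Family → Family → Family
(f ⊕ g) w e = f w e ℤ.+ g w e

mulC : ℕ → (Mono → ℤ) → Mono → ℤ
mulC m g e = maybe′ g (+ 0) (dec m e)

mul : ℕ → Family → Family
mul m f w = mulC m (f w)

-- Right multiplication by the nilCoxeter generator u_q.
nil : ℕ → Family → Family
nil q f w e = if desc q w then f (swapAt q w) e else + 0

swF : ℕ → Family → Family
swF i f w e = f w (sw i e)

-- Multiplication by x_{m+1} u_q: variables are numbered from 0, letters from 1.
mulNil : ℕ → ℕ → Family → Family
mulNil m q f = mul m (nil q f)

letter : ℕ → ℕ → Family → Family
letter m q f = f ⊕ mulNil m q f

mulC-cong : ∀ m {g h} → (∀ e → g e ≡ h e) → ∀ e → mulC m g e ≡ mulC m h e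
mulC-cong m p e with dec m e
... | just e′ = p e′
... | nothing = refl

mul-cong : ∀ m {f g} → f ≗₂ g → mul m f ≗₂ mul m g
mul-cong m p w = mulC-cong m (p w)

nil-cong : ∀ q {f g} → f ≗₂ g → nil q f ≗₂ nil q g
nil-cong q p w e with desc q w
... | true  = p (swapAt q w) e
... | false = refl

mulNil-cong : ∀ m q {f g} → f ≗₂ g → mulNil m q f ≗₂ mulNil m q g
mulNil-cong m q p = mul-cong m (nil-cong q p)

letter-cong : ∀ m q {f g} → f ≗₂ g → letter m q f ≗₂ letter m q g
letter-cong m q p w e = cong₂ ℤ._+_ (p w e) (mulNil-cong m q p w e)

mulC-+ : ∀ m g h e → mulC m (λ e → g e ℤ.+ h e) e ≡ mulC m g e ℤ.+ mulC m h e
mulC-+ m g h e with dec m e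
... | just _  = refl
... | nothing = refl

mul-⊕ : ∀ m f g → mul m (f ⊕ g) ≗₂ mul m f ⊕ mul m g
mul-⊕ m f g w = mulC-+ m (f w) (g w)

nil-⊕ : ∀ q f g → nil q (f ⊕ g) ≗₂ nil q f ⊕ nil q g
nil-⊕ q f g w e with desc q w
... | true  = refl
... | false = refl

mulNil-⊕ : ∀ m q f g → mulNil m q (f ⊕ g) ≗₂ mulNil m q f ⊕ mulNil m q g
mulNil-⊕ m q f g w e = trans (mul-cong m (nil-⊕ q f g) w e) (mul-⊕ m (nil q f) (nil q g) w e)

dec-comm : ∀ m m′ e → (dec m e Maybe.>>= dec m′) ≡ (dec m′ e Maybe.>>= dec m)
dec-comm m m′ [] = refl
dec-comm zero zero (a ∷ e) = refl
dec-comm zero (suc m′) (zero ∷ e) with dec m′ e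
... | just _  = refl
... | nothing = refl
dec-comm zero (suc m′) (suc a ∷ e) with dec m′ e
... | just _  = refl
... | nothing = refl
dec-comm (suc m) zero (zero ∷ e) with dec m e
... | just _  = refl
... | nothing = refl
dec-comm (suc m) zero (suc a ∷ e) with dec m e
... | just _  = refl
... | nothing = refl
dec-comm (suc m) (suc m′) (a ∷ e) with dec-comm m m′ e
... | ih with dec m e | dec m′ e
...   | just _  | just _  = cong (Maybe.map (a ∷_)) ih
...   | just _  | nothing = cong (Maybe.map (a ∷_)) ih
...   | nothing | just _  = cong (Maybe.map (a ∷_)) ih
...   | nothing | nothing = refl

mul-mul : ∀ m m′ f w e → mul m (mul m′ f) w e ≡ maybe′ (f w) (+ 0) (dec m e Maybe.>>= dec m′)
mul-mul m m′ f w e with dec m e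
... | just _  = refl
... | nothing = refl

mul-comm : ∀ m m′ f → mul m (mul m′ f) ≗₂ mul m′ (mul m f)
mul-comm m m′ f w e = trans (mul-mul m m′ f w e)
  (trans (cong (maybe′ (f w) (+ 0)) (dec-comm m m′ e)) (sym (mul-mul m′ m f w e)))

nil-mul : ∀ m q f → nil q (mul m f) ≗₂ mul m (nil q f)
nil-mul m q f w e with desc q w | dec m e
... | true  | just _  = refl
... | true  | nothing = refl
... | false | just _  = refl
... | false | nothing = refl

nil-nil : ∀ q f w e → nil q (nil q f) w e ≡ + 0
nil-nil q f w e with desc q w in eq
... | false = refl
... | true rewrite desc-swapAt q w eq = refl

nil-comm : ∀ p q f → 1 ≤ p → suc p < q → nil p (nil q f) ≗₂ nil q (nil p f)
nil-comm (suc zero) (suc (suc (suc q))) f _ _ [] e = refl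
nil-comm (suc zero) (suc (suc (suc q))) f _ _ (x ∷ []) e = refl
nil-comm (suc zero) (suc (suc (suc q))) f _ _ (x ∷ y ∷ ys) e with y <ᵇ x | desc (suc q) ys
... | true  | true  = refl
... | true  | false = refl
... | false | true  = refl
... | false | false = refl
nil-comm (suc zero) (suc (suc zero)) f _ (s≤s (s≤s ())) w e
nil-comm (suc (suc p)) (suc (suc q)) f _ p<q [] e = refl
nil-comm (suc (suc p)) (suc (suc q)) f _ (s≤s p<q) (x ∷ xs) e =
  -- Letters greater than 1 fix the head, so the family restricted to lists with head `x` satisfies
  -- the claim for letters lowered by one.
  nil-comm (suc p) (suc q) (f ∘ (x ∷_)) (s≤s z≤n) p<q xs e
nil-comm (suc p) (suc zero) f _ (s≤s ()) w e

-- Only the relative order of three adjacent values matters: unless they strictly decrease, both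
-- sides are zero. The two absurd cases contradict transitivity.
nil-braid : ∀ q f → 1 ≤ q → nil q (nil (suc q) (nil q f)) ≗₂ nil (suc q) (nil q (nil (suc q) f))
nil-braid (suc zero) f _ [] e = refl
nil-braid (suc zero) f _ (x ∷ []) e = refl
nil-braid (suc zero) f _ (x ∷ y ∷ []) e with y <ᵇ x
... | true  = refl
... | false = refl
nil-braid (suc zero) f _ (x ∷ y ∷ z ∷ zs) e with y <ᵇ x in p | z <ᵇ x in q | z <ᵇ y in r
... | true  | true  | true  = refl
... | true  | true  | false = refl
... | true  | false | true  = contradiction (<-trans (<ᵇ-true⁻¹ z y r) (<ᵇ-true⁻¹ y x p)) (≤⇒≯ (<ᵇ-false⁻¹ z x q))
... | true  | false | false = refl
... | false | true  | true  = refl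
... | false | true  | false = contradiction (<ᵇ-true⁻¹ z x q) (≤⇒≯ (≤-trans (<ᵇ-false⁻¹ y x p) (<ᵇ-false⁻¹ z y r)))
... | false | false | true  = refl
... | false | false | false = refl
nil-braid (suc (suc q)) f _ [] e = refl
nil-braid (suc (suc q)) f _ (x ∷ xs) e = nil-braid (suc q) (f ∘ (x ∷_)) (s≤s z≤n) xs e

mulNil-mulNil : ∀ m q m′ q′ f → mulNil m q (mulNil m′ q′ f) ≗₂ mul m (mul m′ (nil q (nil q′ f)))
mulNil-mulNil m q m′ q′ f = mul-cong m (nil-mul m′ q (nil q′ f))

mulNil-nil : ∀ m m′ q f w e → mulNil m q (mulNil m′ q f) w e ≡ + 0
mulNil-nil m m′ q f w e = trans (mulNil-mulNil m q m′ q f w e) (lem e)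
  where
  lem : ∀ e → mul m (mul m′ (nil q (nil q f))) w e ≡ + 0
  lem e with dec m e
  ... | nothing = refl
  ... | just e′ with dec m′ e′
  ...   | nothing = refl
  ...   | just e″ = nil-nil q f w e″

mulNil-exchange : ∀ m q m′ q′ f → mulNil m q (mulNil m′ q′ f) ≗₂ mulNil m′ q (mulNil m q′ f)
mulNil-exchange m q m′ q′ f w e = trans (mulNil-mulNil m q m′ q′ f w e)
  (trans (mul-comm m m′ (nil q (nil q′ f)) w e) (sym (mulNil-mulNil m′ q m q′ f w e)))

mulNil³ : ∀ m₁ q₁ m₂ q₂ m₃ q₃ f →
  mulNil m₁ q₁ (mulNil m₂ q₂ (mulNil m₃ q₃ f)) ≗₂ mul m₁ (mul m₂ (mul m₃ (nil q₁ (nil q₂ (nil q₃ f)))))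
mulNil³ m₁ q₁ m₂ q₂ m₃ q₃ f w e = trans
  (mulNil-cong m₁ q₁ (mulNil-mulNil m₂ q₂ m₃ q₃ f) w e)
  (mul-cong m₁ (λ w e → trans (nil-mul m₂ q₁ (mul m₃ (nil q₂ (nil q₃ f))) w e)
     (mul-cong m₂ (nil-mul m₃ q₁ (nil q₂ (nil q₃ f))) w e)) w e)

-- Both sides carry the monomial x y². The variables are distributed over the letters as
-- `yangBaxter` needs it, to turn `yb (xa (yb h))` into `ya (yb (xa h))`.
mulNil-braid : ∀ x y q f → 1 ≤ q →
  mulNil y q (mulNil y (suc q) (mulNil x q f)) ≗₂ mulNil y (suc q) (mulNil x q (mulNil y (suc q) f))
mulNil-braid x y q f 1≤q w e = trans (mulNil³ y q y (suc q) x q f w e)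
  (trans (mul-cong y (mul-comm y x (nil q (nil (suc q) (nil q f)))) w e)
  (trans (mul-cong y (mul-cong x (mul-cong y (nil-braid q f 1≤q))) w e)
  (sym (mulNil³ y (suc q) x q y (suc q) f w e))))

mulNil-comm : ∀ m m′ p q f → 1 ≤ p → suc p < q → mulNil m p (mulNil m′ q f) ≗₂ mulNil m′ q (mulNil m p f)
mulNil-comm m m′ p q f 1≤p p<q w e = trans (mulNil-mulNil m p m′ q f w e)
  (trans (mul-comm m m′ (nil p (nil q f)) w e)
  (trans (mul-cong m′ (mul-cong m (nil-comm p q f 1≤p p<q)) w e)
  (sym (mulNil-mulNil m′ q m p f w e))))

letter-comm : ∀ m m′ p q f → 1 ≤ p → suc p < q → letter m p (letter m′ q f) ≗₂ letter m′ q (letter m p f)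
letter-comm m m′ p q f 1≤p p<q w e
  rewrite mulNil-⊕ m p f (mulNil m′ q f) w e | mulNil-⊕ m′ q f (mulNil m p f) w e
        | mulNil-comm m m′ p q f 1≤p p<q w e = ℤ-interchange (f w e) (mulNil m′ q f w e) (mulNil m p f w e) _

-- Yang–Baxter: with a = u_q and b = u_{q+1},
-- (1 + ya)(1 + yb)(1 + xa)(1 + yb)⁻¹ = 1 + (x + y) a + xy (ba - ab).
yangBaxter : ∀ x y q h B → 1 ≤ q → letter y (suc q) h ≗₂ B → ∀ w e →
  letter y q (letter y (suc q) (letter x q h)) w e ≡
  B w e ℤ.+ mulNil x q B w e ℤ.+ mulNil y q B w e ℤ.+ mulNil y (suc q) (mulNil x q B) w e
    ℤ.- mulNil x q (mulNil y (suc q) B) w e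
yangBaxter x y q h B 1≤q hB w e = trans lhs (arith (B w e) (xa B w e) (ya B w e) (xa h w e) (yb (xa h) w e)
    (ya (yb (xa h)) w e) (yb (xa B) w e) (xa (yb B) w e) e₁ e₂)
  where
  xa ya yb : Family → Family
  xa = mulNil x q
  ya = mulNil y q
  yb = mulNil y (suc q)
  -- Because u_{q+1} squares to zero. Together with `hB` this says h = B - yb B, which is the
  -- inverse of 1 + y u_{q+1} applied to B.
  ybB : yb B ≗₂ yb h
  ybB w e = trans (mulNil-cong y (suc q) (λ w e → sym (hB w e)) w e)
    (trans (mulNil-⊕ y (suc q) h (yb h) w e)
    (trans (cong (λ z → yb h w e ℤ.+ z) (mulNil-nil y y (suc q) h w e)) (ℤ.+-identityʳ _)))
  xaB : xa B ≗₂ xa h ⊕ xa (yb B)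
  xaB w e = trans (mulNil-cong x q (λ w e → sym (hB w e)) w e)
    (trans (mulNil-⊕ x q h (yb h) w e)
      (cong (λ z → xa h w e ℤ.+ z) (mulNil-cong x q (λ w e → sym (ybB w e)) w e)))
  e₁ : xa B w e ≡ xa h w e ℤ.+ xa (yb B) w e
  e₁ = xaB w e
  e₂ : yb (xa B) w e ≡ yb (xa h) w e ℤ.+ ya (yb (xa h)) w e
  e₂ = trans (mulNil-cong y (suc q) xaB w e) (trans (mulNil-⊕ y (suc q) (xa h) (xa (yb B)) w e)
    (cong (λ z → yb (xa h) w e ℤ.+ z)
      (trans (mulNil-cong y (suc q) (mulNil-cong x q ybB) w e) (sym (mulNil-braid x y q h 1≤q w e)))))
  inner : letter y (suc q) (letter x q h) ≗₂ B ⊕ (xa h ⊕ yb (xa h))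
  inner w e rewrite mulNil-⊕ y (suc q) h (xa h) w e | sym (hB w e) = ℤ-interchange (h w e) _ _ _
  lhs : letter y q (letter y (suc q) (letter x q h)) w e ≡
    (B w e ℤ.+ (xa h w e ℤ.+ yb (xa h) w e)) ℤ.+ (ya B w e ℤ.+ (+ 0 ℤ.+ ya (yb (xa h)) w e))
  lhs = trans (letter-cong y q inner w e) (cong (λ z → (B ⊕ (xa h ⊕ yb (xa h))) w e ℤ.+ z)
    (trans (mulNil-⊕ y q B (xa h ⊕ yb (xa h)) w e)
    (cong (λ z → ya B w e ℤ.+ z) (trans (mulNil-⊕ y q (xa h) (yb (xa h)) w e)
      (cong (ℤ._+ ya (yb (xa h)) w e) (mulNil-nil y x q h w e))))))
  arith : ∀ b xaB′ yaB xah ybxah yaybxah ybxaB xaybB →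
    xaB′ ≡ xah ℤ.+ xaybB → ybxaB ≡ ybxah ℤ.+ yaybxah →
    (b ℤ.+ (xah ℤ.+ ybxah)) ℤ.+ (yaB ℤ.+ (+ 0 ℤ.+ yaybxah)) ≡
    b ℤ.+ xaB′ ℤ.+ yaB ℤ.+ ybxaB ℤ.- xaybB
  arith b _ yaB xah ybxah yaybxah _ xaybB refl refl = r b yaB xah ybxah yaybxah xaybB
    where
    r : ∀ b yaB xah ybxah yaybxah xaybB →
      (b ℤ.+ (xah ℤ.+ ybxah)) ℤ.+ (yaB ℤ.+ (+ 0 ℤ.+ yaybxah)) ≡
      b ℤ.+ (xah ℤ.+ xaybB) ℤ.+ yaB ℤ.+ (ybxah ℤ.+ yaybxah) ℤ.- xaybB
    r = solve-∀

-- Exchanging adjacent variables, and the symmetry of A_k(x) A_k(y).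

dec-sw-low : ∀ i e → dec i (sw i e) ≡ Maybe.map (sw i) (dec (suc i) e)
dec-sw-low zero [] = refl
dec-sw-low zero (a ∷ []) = refl
dec-sw-low zero (a ∷ zero ∷ e) = refl
dec-sw-low zero (a ∷ suc b ∷ e) = refl
dec-sw-low (suc i) [] = refl
dec-sw-low (suc i) (a ∷ e) rewrite dec-sw-low i e with dec (suc i) e
... | just _  = refl
... | nothing = refl

dec-sw-high : ∀ i e → dec (suc i) (sw i e) ≡ Maybe.map (sw i) (dec i e)
dec-sw-high zero [] = refl
dec-sw-high zero (zero ∷ []) = refl
dec-sw-high zero (suc a ∷ []) = refl
dec-sw-high zero (zero ∷ b ∷ e) = refl
dec-sw-high zero (suc a ∷ b ∷ e) = refl
dec-sw-high (suc i) [] = refl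
dec-sw-high (suc i) (a ∷ e) rewrite dec-sw-high i e with dec i e
... | just _  = refl
... | nothing = refl

dec-sw-≢ : ∀ m i e → m ≢ i → m ≢ suc i → dec m (sw i e) ≡ Maybe.map (sw i) (dec m e)
dec-sw-≢ m zero [] _ _ = refl
dec-sw-≢ zero zero (a ∷ e) 0≢0 _ = contradiction refl 0≢0
dec-sw-≢ (suc zero) zero (a ∷ e) _ 1≢1 = contradiction refl 1≢1
dec-sw-≢ (suc (suc m)) zero (a ∷ []) _ _ = refl
dec-sw-≢ (suc (suc m)) zero (a ∷ b ∷ e) _ _ with dec m e
... | just _  = refl
... | nothing = refl
dec-sw-≢ m (suc i) [] _ _ = refl
dec-sw-≢ zero (suc i) (zero ∷ e) _ _ = refl
dec-sw-≢ zero (suc i) (suc a ∷ e) _ _ = refl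
dec-sw-≢ (suc m) (suc i) (a ∷ e) m≢i m≢1+i
  rewrite dec-sw-≢ m i e (m≢i ∘ cong suc) (m≢1+i ∘ cong suc) with dec m e
... | just _  = refl
... | nothing = refl

-- With the effect of `sw i` on `dec m` as a hypothesis, the cases m = i, m = i + 1 and all other m
-- are treated at once.
swF-mul : ∀ {m m′ i} → (∀ e → dec m (sw i e) ≡ Maybe.map (sw i) (dec m′ e)) →
  ∀ f → swF i (mul m f) ≗₂ mul m′ (swF i f)
swF-mul {m} {m′} d f w e rewrite d e with dec m′ e
... | just _  = refl
... | nothing = refl

swF-letter : ∀ {m m′ i} → (∀ e → dec m (sw i e) ≡ Maybe.map (sw i) (dec m′ e)) →
  ∀ q f → swF i (letter m q f) ≗₂ letter m′ q (swF i f)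
swF-letter {i = i} d q f w e = cong (λ z → f w (sw i e) ℤ.+ z) (swF-mul d (nil q f) w e)

-- A_k(x_{m+1}) = (1 + x_{m+1} u_{k+c-1}) ⋯ (1 + x_{m+1} u_k), acting on the right.
asc : ℕ → ℕ → ℕ → Family → Family
asc m k zero    f = f
asc m k (suc c) f = letter m k (asc m (suc k) c f)

asc-cong : ∀ m k c {f g} → f ≗₂ g → asc m k c f ≗₂ asc m k c g
asc-cong m k zero    p = p
asc-cong m k (suc c) p = letter-cong m k (asc-cong m (suc k) c p)

swF-asc : ∀ {m m′ i} → (∀ e → dec m (sw i e) ≡ Maybe.map (sw i) (dec m′ e)) →
  ∀ k c f → swF i (asc m k c f) ≗₂ asc m′ k c (swF i f)
swF-asc d k zero    f w e = refl
swF-asc {m} {m′} {i} d k (suc c) f w e =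
  trans (swF-letter d k (asc m (suc k) c f) w e) (letter-cong m′ k (swF-asc d (suc k) c f) w e)

asc-letter : ∀ m k c m′ q f → 1 ≤ q → suc q < k → asc m k c (letter m′ q f) ≗₂ letter m′ q (asc m k c f)
asc-letter m k zero    m′ q f 1≤q q<k w e = refl
asc-letter m k (suc c) m′ q f 1≤q q<k w e = trans
  (letter-cong m k (asc-letter m (suc k) c m′ q f 1≤q (m<n⇒m<1+n q<k)) w e)
  (sym (letter-comm m′ m q k (asc m (suc k) c f) 1≤q q<k w e))

letter-sym : ∀ x y q f → letter y q (letter x q f) ≗₂ letter x q (letter y q f)
letter-sym x y q f w e
  rewrite mulNil-⊕ y q f (mulNil x q f) w e | mulNil-⊕ x q f (mulNil y q f) w e
        | mulNil-nil x y q f w e | mulNil-nil y x q f w e = ℤ-interchange (f w e) (mulNil x q f w e) (mulNil y q f w e) (+ 0)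

-- The letter (x , k) commutes with every letter of `asc y (suc k) (suc c)` except the outermost
-- one, which `yangBaxter` handles. The result is an expression symmetric in x and y, applied to B =
-- A_{k+1}(y) A_{k+1}(x) f, which is symmetric by hypothesis.
asc-sym-step : ∀ x y k c f → 1 ≤ k →
  asc y (suc k) (suc c) (asc x (suc k) (suc c) f) ≗₂ asc x (suc k) (suc c) (asc y (suc k) (suc c) f) →
  asc y k (2 + c) (asc x k (2 + c) f) ≗₂ asc x k (2 + c) (asc y k (2 + c) f)
asc-sym-step x y k c f 1≤k B-sym w e = trans (normal x y w e) (trans (swapped w e) (sym (normal y x w e)))
  where
  A : ℕ → Family → Family
  A x = asc x (suc k) (suc c)
  B : ℕ → ℕ → Family
  B x y = A y (A x f)
  normal : ∀ x y w e → asc y k (2 + c) (asc x k (2 + c) f) w e ≡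
    B x y w e ℤ.+ mulNil x k (B x y) w e ℤ.+ mulNil y k (B x y) w e
      ℤ.+ mulNil y (suc k) (mulNil x k (B x y)) w e ℤ.- mulNil x k (mulNil y (suc k) (B x y)) w e
  normal x y w e = trans
    (letter-cong y k (letter-cong y (suc k) (asc-letter y (2 + k) c x k (A x f) 1≤k ≤-refl)) w e)
    (yangBaxter x y k (asc y (2 + k) c (A x f)) (B x y) 1≤k (λ _ _ → refl) w e)
  swapped : ∀ w e →
    B x y w e ℤ.+ mulNil x k (B x y) w e ℤ.+ mulNil y k (B x y) w e
      ℤ.+ mulNil y (suc k) (mulNil x k (B x y)) w e ℤ.- mulNil x k (mulNil y (suc k) (B x y)) w e ≡
    B y x w e ℤ.+ mulNil y k (B y x) w e ℤ.+ mulNil x k (B y x) w e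
      ℤ.+ mulNil x (suc k) (mulNil y k (B y x)) w e ℤ.- mulNil y k (mulNil x (suc k) (B y x)) w e
  swapped w e
    rewrite B-sym w e | mulNil-cong x k B-sym w e | mulNil-cong y k B-sym w e
          | mulNil-cong y (suc k) (mulNil-cong x k B-sym) w e | mulNil-exchange y (suc k) x k (B y x) w e
          | mulNil-cong x k (mulNil-cong y (suc k) B-sym) w e | mulNil-exchange x k y (suc k) (B y x) w e
    = r (B y x w e) (mulNil x k (B y x) w e) (mulNil y k (B y x) w e)
        (mulNil x (suc k) (mulNil y k (B y x)) w e) (mulNil y k (mulNil x (suc k) (B y x)) w e)
    where
    r : ∀ a b c d e → a ℤ.+ b ℤ.+ c ℤ.+ d ℤ.- e ≡ a ℤ.+ c ℤ.+ b ℤ.+ d ℤ.- e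
    r = solve-∀

asc-sym : ∀ x y k c f → 1 ≤ k → asc y k c (asc x k c f) ≗₂ asc x k c (asc y k c f)
asc-sym x y k zero          f 1≤k w e = refl
asc-sym x y k (suc zero)    f 1≤k w e = letter-sym x y k f w e
asc-sym x y k (suc (suc c)) f 1≤k w e =
  asc-sym-step x y k c f 1≤k (asc-sym x y (suc k) (suc c) f (s≤s z≤n)) w e

-- (f - s_i f) = (x_i - x_{i+1}) f u_i, without subtraction and with i shifted by one.
DividesBy : ℕ → Family → Set
DividesBy i f = f ⊕ mulNil (suc i) (suc i) f ≗₂ swF i f ⊕ mulNil i (suc i) f

-- The new factor commutes with u_{i+1}, as its letter is at least i + 3, and with the exchange of
-- variables, as it involves neither of them. It can therefore be applied to both sides of the
-- relation.
dividesBy-letter : ∀ i m p f → m ≢ i → m ≢ suc i → 2 + i < p → DividesBy i f → DividesBy i (letter m p f)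
dividesBy-letter i m p f m≢i m≢1+i q<p φ w e = begin
  (f w e ℤ.+ M f w e) ℤ.+ Y (f ⊕ M f) w e
    ≡⟨ cong (λ z → (f w e ℤ.+ M f w e) ℤ.+ z) (mulNil-⊕ (suc i) (suc i) f (M f) w e) ⟩
  (f w e ℤ.+ M f w e) ℤ.+ (Y f w e ℤ.+ Y (M f) w e)
    ≡⟨ cong (λ z → (f w e ℤ.+ M f w e) ℤ.+ (Y f w e ℤ.+ z)) (mulNil-comm (suc i) m (suc i) p f (s≤s z≤n) q<p w e) ⟩
  (f w e ℤ.+ M f w e) ℤ.+ (Y f w e ℤ.+ M (Y f) w e)
    ≡⟨ ℤ-interchange (f w e) _ _ _ ⟩
  (f w e ℤ.+ Y f w e) ℤ.+ (M f w e ℤ.+ M (Y f) w e)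
    ≡⟨ cong₂ ℤ._+_ (φ w e) (trans (sym (mulNil-⊕ m p f (Y f) w e)) (trans (mulNil-cong m p φ w e) (mulNil-⊕ m p (swF i f) (X f) w e))) ⟩
  (swF i f w e ℤ.+ X f w e) ℤ.+ (M (swF i f) w e ℤ.+ M (X f) w e)
    ≡⟨ ℤ-interchange (swF i f w e) _ _ _ ⟩
  (swF i f w e ℤ.+ M (swF i f) w e) ℤ.+ (X f w e ℤ.+ M (X f) w e)
    ≡⟨ cong₂ ℤ._+_ (sym (swF-letter (λ e → dec-sw-≢ m i e m≢i m≢1+i) p f w e))
        (trans (cong (λ z → X f w e ℤ.+ z) (sym (mulNil-comm i m (suc i) p f (s≤s z≤n) q<p w e)))
          (sym (mulNil-⊕ i (suc i) f (M f) w e))) ⟩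
  swF i (letter m p f) w e ℤ.+ X (letter m p f) w e ∎
  where
  open ≡-Reasoning
  M X Y : Family → Family
  M = mulNil m p
  X = mulNil i (suc i)
  Y = mulNil (suc i) (suc i)

dividesBy-asc : ∀ i m k c f → m ≢ i → m ≢ suc i → 2 + i < k → DividesBy i f → DividesBy i (asc m k c f)
dividesBy-asc i m k zero    f _ _ _ φ = φ
dividesBy-asc i m k (suc c) f m≢i m≢1+i i<k φ = dividesBy-letter i m k (asc m (suc k) c f) m≢i m≢1+i i<k
  (dividesBy-asc i m (suc k) c f m≢i m≢1+i (m<n⇒m<1+n i<k) φ)

-- f₁ := A_i(x_i) A_{i+1}(x_{i+1}) satisfies f₁ (1 + x_{i+1} u_i) = A_i(x_i) A_i(x_{i+1}), which is symmetric.
dividesBy-base : ∀ i c g → swF i g ≗₂ g →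
  DividesBy i (asc (suc i) (2 + i) c (asc i (suc i) (suc c) g))
dividesBy-base i c g gs w e = begin
  B w e
    ≡⟨ B-inv w e ⟨
  swF i B w e
    ≡⟨⟩
  f₁ w (sw i e) ℤ.+ mul (suc i) N w (sw i e)
    ≡⟨ cong (λ z → f₁ w (sw i e) ℤ.+ z) (swF-mul (dec-sw-high i) N w e) ⟩
  f₁ w (sw i e) ℤ.+ mul i (swF i N) w e
    ≡⟨ cong (λ z → f₁ w (sw i e) ℤ.+ z) (mul-cong i N-inv w e) ⟩
  f₁ w (sw i e) ℤ.+ mul i N w e ∎
  where
  open ≡-Reasoning
  f₁ B N : Family
  f₁ = asc (suc i) (2 + i) c (asc i (suc i) (suc c) g)
  B = asc (suc i) (suc i) (suc c) (asc i (suc i) (suc c) g)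
  N = nil (suc i) f₁
  B-inv : swF i B ≗₂ B
  B-inv w e = trans (swF-asc (dec-sw-high i) (suc i) (suc c) (asc i (suc i) (suc c) g) w e)
    (trans (asc-cong i (suc i) (suc c) (λ w e → trans (swF-asc (dec-sw-low i) (suc i) (suc c) g w e)
             (asc-cong (suc i) (suc i) (suc c) gs w e)) w e)
      (asc-sym (suc i) i (suc i) (suc c) g (s≤s z≤n) w e))
  -- Since u_{i+1} squares to zero, f₁ u_{i+1} equals B u_{i+1}, and so inherits the symmetry of B.
  N≗nilB : nil (suc i) B ≗₂ N
  N≗nilB w e = trans (nil-⊕ (suc i) f₁ (mul (suc i) N) w e)
    (trans (cong (λ z → N w e ℤ.+ z) (trans (nil-mul (suc i) (suc i) N w e) (lem (dec (suc i) e)))) (ℤ.+-identityʳ _))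
    where
    lem : ∀ me → maybe′ (nil (suc i) N w) (+ 0) me ≡ + 0
    lem (just e′) = nil-nil (suc i) f₁ w e′
    lem nothing   = refl
  N-inv : swF i N ≗₂ N
  N-inv w e = trans (sym (N≗nilB w (sw i e))) (trans (nil-cong (suc i) B-inv w e) (N≗nilB w e))

-- (m , q) is a crossing in row m of a pipe dream that contributes the letter s_q.
Word : Set
Word = List (ℕ × ℕ)

rowFrom : ℕ → ℕ → ℕ → Word
rowFrom m k zero    = []
rowFrom m k (suc c) = (m , k) ∷ rowFrom m (suc k) c

-- The staircase word is read backwards: each row from left to right, from row m up to row 1.
rows : ℕ → ℕ → Word
rows n zero    = []
rows n (suc m) = rowFrom (suc m) (suc m) (n ∸ suc m) ++ rows n m

-- The unit of the nilCoxeter algebra with polynomial coefficients: the constant 1 at the identity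
-- permutation.
idFamily : ℕ → Family
idFamily n w e = if does (≡-dec _≟_ w (range1 n)) then coeff ((+ 1 , []) ∷ []) e else + 0

pipeSum : ℕ → Word → Family
pipeSum n []            = idFamily n
pipeSum n ((m , q) ∷ P) = letter (m ∸ 1) q (pipeSum n P)

pipeSum-rowFrom : ∀ n m k c P →
  pipeSum n (rowFrom (suc m) k c ++ P) ≡ asc m k c (pipeSum n P)
pipeSum-rowFrom n m k zero    P = refl
pipeSum-rowFrom n m k (suc c) P = cong (letter m k) (pipeSum-rowFrom n m (suc k) c P)

isOne-sw : ∀ i e → monoEqᵇ [] (sw i e) ≡ monoEqᵇ [] e
isOne-sw i       []          = refl
isOne-sw zero    (a ∷ [])    = refl
isOne-sw zero    (a ∷ b ∷ e) = trans (sym (∧-assoc (b ≡ᵇ 0) (a ≡ᵇ 0) _))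
  (trans (cong (_∧ monoEqᵇ [] e) (∧-comm (b ≡ᵇ 0) (a ≡ᵇ 0))) (∧-assoc (a ≡ᵇ 0) (b ≡ᵇ 0) _))
isOne-sw (suc i) (a ∷ e)     = cong ((a ≡ᵇ 0) ∧_) (isOne-sw i e)

idFamily-inv : ∀ n i → swF i (idFamily n) ≗₂ idFamily n
idFamily-inv n i w e rewrite isOne-sw i e = refl

-- Rows 1 to m involve only the variables numbered below m, which `sw i` leaves alone.
pipeSum-inv : ∀ n i m → m ≤ i → swF i (pipeSum n (rows n m)) ≗₂ pipeSum n (rows n m)
pipeSum-inv n i zero    m≤i = idFamily-inv n i
pipeSum-inv n i (suc m) m<i rewrite pipeSum-rowFrom n m (suc m) (n ∸ suc m) (rows n m) = λ w e → trans
  (swF-asc (λ e → dec-sw-≢ m i e (<⇒≢ m<i) (<⇒≢ (m<n⇒m<1+n m<i))) (suc m) (n ∸ suc m) (pipeSum n (rows n m)) w e)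
  (asc-cong m (suc m) (n ∸ suc m) (pipeSum-inv n i m (<⇒≤ m<i)) w e)

-- The relation starts with the two rows whose variables are exchanged and persists through the t
-- rows added after them, whose letters are all far from u_{i+1}.
pipeSum-dividesBy : ∀ n i t → suc i < n → DividesBy i (pipeSum n (rows n (t + (2 + i))))
pipeSum-dividesBy n i zero i<n
  rewrite pipeSum-rowFrom n (suc i) (2 + i) (n ∸ (2 + i)) (rows n (suc i))
        | pipeSum-rowFrom n i (suc i) (n ∸ suc i) (rows n i)
        -- Row i + 1 is one crossing longer than row i + 2, which is the form that `dividesBy-base`
        -- expects.
        | +-∸-assoc 1 {n} {2 + i} i<n
  = dividesBy-base i (n ∸ (2 + i)) (pipeSum n (rows n i)) (pipeSum-inv n i i ≤-refl)
pipeSum-dividesBy n i (suc t) i<n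
  rewrite pipeSum-rowFrom n (t + (2 + i)) (suc (t + (2 + i))) (n ∸ suc (t + (2 + i))) (rows n (t + (2 + i)))
  = dividesBy-asc i (t + (2 + i)) (suc (t + (2 + i))) (n ∸ suc (t + (2 + i))) (pipeSum n (rows n (t + (2 + i))))
      (>⇒≢ (<-≤-trans (n<1+n i) (≤-trans (n≤1+n _) (m≤n+m _ t)))) (>⇒≢ (m≤n+m _ t))
      (s≤s (m≤n+m _ t)) (pipeSum-dividesBy n i t i<n)

-- Divided differences

ev : Mono → ℕ → ℕ
ev = nthD 0

infix 4 _~_
-- Equality of monomials: exponent vectors may differ in trailing zeros.
_~_ : Mono → Mono → Set
m ~ e = ∀ k → ev m k ≡ ev e k

bool-iff : ∀ {a b} → (a ≡ true → b ≡ true) → (b ≡ true → a ≡ true) → a ≡ b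
bool-iff {true}  {b}     f g = sym (f refl)
bool-iff {false} {true}  f g = g refl
bool-iff {false} {false} f g = refl

≡ᵇ-true⁻¹ : ∀ a b → (a ≡ᵇ b) ≡ true → a ≡ b
≡ᵇ-true⁻¹ a b p = ≡ᵇ⇒≡ a b (Equivalence.from T-≡ p)

≡ᵇ-true : ∀ a b → a ≡ b → (a ≡ᵇ b) ≡ true
≡ᵇ-true a b p = Equivalence.to T-≡ (≡⇒≡ᵇ a b p)

∧-true⁻¹ : ∀ {a b} → a ∧ b ≡ true → a ≡ true × b ≡ true
∧-true⁻¹ {true} {true} _ = refl , refl

monoEq⇒~ : ∀ m e → monoEqᵇ m e ≡ true → m ~ e
monoEq⇒~ []       []       _ k       = refl
monoEq⇒~ []       (y ∷ ys) p zero    = sym (≡ᵇ-true⁻¹ y 0 (proj₁ (∧-true⁻¹ p)))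
monoEq⇒~ []       (y ∷ ys) p (suc k) = monoEq⇒~ [] ys (proj₂ (∧-true⁻¹ {y ≡ᵇ 0} p)) k
monoEq⇒~ (x ∷ xs) []       p zero    = ≡ᵇ-true⁻¹ x 0 (proj₁ (∧-true⁻¹ p))
monoEq⇒~ (x ∷ xs) []       p (suc k) = monoEq⇒~ xs [] (proj₂ (∧-true⁻¹ {x ≡ᵇ 0} p)) k
monoEq⇒~ (x ∷ xs) (y ∷ ys) p zero    = ≡ᵇ-true⁻¹ x y (proj₁ (∧-true⁻¹ p))
monoEq⇒~ (x ∷ xs) (y ∷ ys) p (suc k) = monoEq⇒~ xs ys (proj₂ (∧-true⁻¹ {x ≡ᵇ y} p)) k

~⇒monoEq : ∀ m e → m ~ e → monoEqᵇ m e ≡ true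
~⇒monoEq []       []       p = refl
~⇒monoEq []       (y ∷ ys) p = cong₂ _∧_ (≡ᵇ-true y 0 (sym (p 0))) (~⇒monoEq [] ys (p ∘ suc))
~⇒monoEq (x ∷ xs) []       p = cong₂ _∧_ (≡ᵇ-true x 0 (p 0)) (~⇒monoEq xs [] (p ∘ suc))
~⇒monoEq (x ∷ xs) (y ∷ ys) p = cong₂ _∧_ (≡ᵇ-true x y (p 0)) (~⇒monoEq xs ys (p ∘ suc))

term : ℤ → Mono → Mono → ℤ
term c m e = if monoEqᵇ m e then c else + 0

coeff-++ : ∀ p q e → coeff (p ++ q) e ≡ coeff p e ℤ.+ coeff q e
coeff-++ []      q e = sym (ℤ.+-identityˡ _)
coeff-++ ((c , m) ∷ p) q e = trans (cong (ℤ._+_ (term c m e)) (coeff-++ p q e))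
  (sym (ℤ.+-assoc (term c m e) (coeff p e) (coeff q e)))

coeff-resp : ∀ p {e e′} → e ~ e′ → coeff p e ≡ coeff p e′
coeff-resp []            e~e′ = refl
coeff-resp ((c , m) ∷ p) {e} {e′} e~e′ = cong₂ ℤ._+_
  (cong (λ b → if b then c else + 0) (bool-iff
    (λ q → ~⇒monoEq m e′ (λ k → trans (monoEq⇒~ m e q k) (e~e′ k)))
    (λ q → ~⇒monoEq m e (λ k → trans (monoEq⇒~ m e′ q k) (sym (e~e′ k))))))
  (coeff-resp p e~e′)

ev-setAt0 : ∀ k v m → ev (setAt0 k v m) k ≡ v
ev-setAt0 zero    v []      = refl
ev-setAt0 zero    v (x ∷ m) = refl
ev-setAt0 (suc k) v []      = ev-setAt0 k v []
ev-setAt0 (suc k) v (x ∷ m) = ev-setAt0 k v m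

ev-setAt0-≢ : ∀ k v m j → j ≢ k → ev (setAt0 k v m) j ≡ ev m j
ev-setAt0-≢ zero    v []      zero    0≢0 = contradiction refl 0≢0
ev-setAt0-≢ zero    v []      (suc j) _   = refl
ev-setAt0-≢ zero    v (x ∷ m) zero    0≢0 = contradiction refl 0≢0
ev-setAt0-≢ zero    v (x ∷ m) (suc j) _   = refl
ev-setAt0-≢ (suc k) v []      zero    _   = refl
ev-setAt0-≢ (suc k) v []      (suc j) j≢k = ev-setAt0-≢ k v [] j (j≢k ∘ cong suc)
ev-setAt0-≢ (suc k) v (x ∷ m) zero    _   = refl
ev-setAt0-≢ (suc k) v (x ∷ m) (suc j) j≢k = ev-setAt0-≢ k v m j (j≢k ∘ cong suc)

dec-just : ∀ k e {e′} → dec k e ≡ just e′ → ev e k ≡ suc (ev e′ k) × (∀ j → j ≢ k → ev e j ≡ ev e′ j)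
dec-just zero    (suc a ∷ e) refl = refl , λ { zero 0≢0 → contradiction refl 0≢0 ; (suc j) _ → refl }
dec-just (suc k) (a ∷ e) p with dec k e in eq
dec-just (suc k) (a ∷ e) refl | just e′ = proj₁ (dec-just k e eq) ,
  λ { zero _ → refl ; (suc j) j≢k → proj₂ (dec-just k e eq) j (j≢k ∘ cong suc) }

dec-nothing : ∀ k e → dec k e ≡ nothing → ev e k ≡ 0
dec-nothing k       []         _ = refl
dec-nothing zero    (zero ∷ e) _ = refl
dec-nothing (suc k) (a ∷ e)    p with dec k e in eq
dec-nothing (suc k) (a ∷ e) () | just _
... | nothing = dec-nothing k e eq

ev-sw : ∀ i e → ev (sw i e) i ≡ ev e (suc i) × ev (sw i e) (suc i) ≡ ev e i
      × (∀ j → j ≢ i → j ≢ suc i → ev (sw i e) j ≡ ev e j)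
ev-sw i       []          = refl , refl , λ _ _ _ → refl
ev-sw zero    (a ∷ [])    = refl , refl , λ
  { zero 0≢0 _ → contradiction refl 0≢0 ; (suc zero) _ 1≢1 → contradiction refl 1≢1 ; (suc (suc j)) _ _ → refl }
ev-sw zero    (a ∷ b ∷ e) = refl , refl , λ
  { zero 0≢0 _ → contradiction refl 0≢0 ; (suc zero) _ 1≢1 → contradiction refl 1≢1 ; (suc (suc j)) _ _ → refl }
ev-sw (suc i) (a ∷ e)     with ev-sw i e
... | p , q , r = p , q , λ { zero _ _ → refl ; (suc j) j≢i j≢1+i → r j (j≢i ∘ cong suc) (j≢1+i ∘ cong suc) }

mulC-- : ∀ m g h e → mulC m (λ e → g e ℤ.- h e) e ≡ mulC m g e ℤ.- mulC m h e
mulC-- m g h e with dec m e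
... | just _  = refl
... | nothing = refl

sumUpTo : (ℕ → ℤ) → ℕ → ℤ
sumUpTo θ zero    = + 0
sumUpTo θ (suc K) = θ 0 ℤ.+ sumUpTo (θ ∘ suc) K

sumUpTo-cong : ∀ {θ θ′} K → (∀ j → j < K → θ j ≡ θ′ j) → sumUpTo θ K ≡ sumUpTo θ′ K
sumUpTo-cong zero    p = refl
sumUpTo-cong (suc K) p = cong₂ ℤ._+_ (p 0 (s≤s z≤n)) (sumUpTo-cong K (λ j j< → p (suc j) (s≤s j<)))

telescope : ∀ θ K → sumUpTo (θ ∘ suc) K ℤ.+ θ 0 ≡ sumUpTo θ K ℤ.+ θ K
telescope θ zero    = refl
telescope θ (suc K) = trans (r (θ 1) (sumUpTo (θ ∘ suc ∘ suc) K) (θ 0))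
  (trans (cong (ℤ._+_ (θ 0)) (telescope (θ ∘ suc) K)) (sym (ℤ.+-assoc (θ 0) (sumUpTo (θ ∘ suc) K) (θ (suc K)))))
  where
  r : ∀ a b c → (a ℤ.+ b) ℤ.+ c ≡ c ℤ.+ (b ℤ.+ a)
  r = solve-∀

module _ (k : ℕ) (m : Mono) where

  bimono : ℕ → ℕ → Mono
  bimono α β = setAt0 (suc k) β (setAt0 k α m)

  Fits : ℕ → ℕ → Mono → Set
  Fits α β e = α ≡ ev e k × β ≡ ev e (suc k) × (∀ j → j ≢ k → j ≢ suc k → ev m j ≡ ev e j)

  fits⇒ : ∀ α β e → Fits α β e → bimono α β ~ e
  fits⇒ α β e (p , q , r) j with j ≟ k | j ≟ suc k
  ... | yes refl | _ = trans (ev-setAt0-≢ (suc k) β (setAt0 k α m) k (<⇒≢ ≤-refl)) (trans (ev-setAt0 k α m) p)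
  ... | no _ | yes refl = trans (ev-setAt0 (suc k) β (setAt0 k α m)) q
  ... | no j≢k | no j≢1+k = trans (ev-setAt0-≢ (suc k) β (setAt0 k α m) j j≢1+k) (trans (ev-setAt0-≢ k α m j j≢k) (r j j≢k j≢1+k))

  ⇒fits : ∀ α β e → bimono α β ~ e → Fits α β e
  ⇒fits α β e p =
      trans (sym (trans (ev-setAt0-≢ (suc k) β (setAt0 k α m) k (<⇒≢ ≤-refl)) (ev-setAt0 k α m))) (p k)
    , trans (sym (ev-setAt0 (suc k) β (setAt0 k α m))) (p (suc k))
    , λ j j≢k j≢1+k → trans (sym (trans (ev-setAt0-≢ (suc k) β (setAt0 k α m) j j≢1+k) (ev-setAt0-≢ k α m j j≢k))) (p j)

  module _ (c : ℤ) where

    τ : ℕ → ℕ → Mono → ℤ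
    τ α β e = if monoEqᵇ (bimono α β) e then c else + 0

    τ-≡ : ∀ α β e m′ e′ → (Fits α β e → m′ ~ e′) → (m′ ~ e′ → Fits α β e) →
      τ α β e ≡ (if monoEqᵇ m′ e′ then c else + 0)
    τ-≡ α β e m′ e′ f g = cong (λ b → if b then c else + 0) (bool-iff
      (λ p → ~⇒monoEq m′ e′ (f (⇒fits α β e (monoEq⇒~ (bimono α β) e p))))
      (λ p → ~⇒monoEq (bimono α β) e (fits⇒ α β e (g (monoEq⇒~ m′ e′ p)))))

    τ-∅ : ∀ α β e → ¬ Fits α β e → τ α β e ≡ + 0
    τ-∅ α β e ¬f with monoEqᵇ (bimono α β) e in eq
    ... | true  = contradiction (⇒fits α β e (monoEq⇒~ (bimono α β) e eq)) ¬f
    ... | false = refl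

    mulC-τ-low : ∀ α β e → mulC k (τ α β) e ≡ τ (suc α) β e
    mulC-τ-low α β e with dec k e in eq
    ... | nothing = sym (τ-∅ (suc α) β e (λ (p , _) → case-⊥ (trans p (dec-nothing k e eq))))
      where
      case-⊥ : ∀ {A : Set} → suc α ≡ 0 → A
      case-⊥ ()
    ... | just e′ with dec-just k e eq
    ...   | d₁ , d₂ = sym (τ-≡ (suc α) β e (bimono α β) e′
      (λ (p , q , r) → fits⇒ α β e′ (suc-injective (trans p d₁) , trans q (d₂ (suc k) (>⇒≢ ≤-refl))
                                     , λ j n₁ n₂ → trans (r j n₁ n₂) (d₂ j n₁)))
      (λ s → let (p , q , r) = ⇒fits α β e′ s in
        trans (cong suc p) (sym d₁) , trans q (sym (d₂ (suc k) (>⇒≢ ≤-refl)))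
          , λ j n₁ n₂ → trans (r j n₁ n₂) (sym (d₂ j n₁))))

    mulC-τ-high : ∀ α β e → mulC (suc k) (τ α β) e ≡ τ α (suc β) e
    mulC-τ-high α β e with dec (suc k) e in eq
    ... | nothing = sym (τ-∅ α (suc β) e (λ (_ , p , _) → case-⊥ (trans p (dec-nothing (suc k) e eq))))
      where
      case-⊥ : ∀ {A : Set} → suc β ≡ 0 → A
      case-⊥ ()
    ... | just e′ with dec-just (suc k) e eq
    ...   | d₁ , d₂ = sym (τ-≡ α (suc β) e (bimono α β) e′
      (λ (q , p , r) → fits⇒ α β e′ (trans q (d₂ k (<⇒≢ ≤-refl)) , suc-injective (trans p d₁)
                                     , λ j n₁ n₂ → trans (r j n₁ n₂) (d₂ j n₂)))
      (λ s → let (q , p , r) = ⇒fits α β e′ s in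
        trans q (sym (d₂ k (<⇒≢ ≤-refl))) , trans (cong suc p) (sym d₁)
          , λ j n₁ n₂ → trans (r j n₁ n₂) (sym (d₂ j n₂))))

    τ-self : ∀ e → τ (ev m k) (ev m (suc k)) e ≡ (if monoEqᵇ m e then c else + 0)
    τ-self e = τ-≡ (ev m k) (ev m (suc k)) e m e
      (λ (p , q , r) j → lem p q r j (j ≟ k) (j ≟ suc k))
      (λ s → s k , s (suc k) , λ j _ _ → s j)
      where
      lem : ev m k ≡ ev e k → ev m (suc k) ≡ ev e (suc k) → (∀ j → j ≢ k → j ≢ suc k → ev m j ≡ ev e j) →
        ∀ j → Dec (j ≡ k) → Dec (j ≡ suc k) → ev m j ≡ ev e j
      lem p q r j (yes refl) _          = p
      lem p q r j (no _)     (yes refl) = q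
      lem p q r j (no n₁)    (no n₂)    = r j n₁ n₂

    τ-sw : ∀ e → τ (ev m (suc k)) (ev m k) e ≡ (if monoEqᵇ m (sw k e) then c else + 0)
    τ-sw e with ev-sw k e
    ... | s₁ , s₂ , s₃ = τ-≡ (ev m (suc k)) (ev m k) e m (sw k e)
      (λ (p , q , r) j → lem p q r j (j ≟ k) (j ≟ suc k))
      (λ s → trans (s (suc k)) s₂ , trans (s k) s₁ , λ j n₁ n₂ → trans (s j) (s₃ j n₁ n₂))
      where
      lem : ev m (suc k) ≡ ev e k → ev m k ≡ ev e (suc k) → (∀ j → j ≢ k → j ≢ suc k → ev m j ≡ ev e j) →
        ∀ j → Dec (j ≡ k) → Dec (j ≡ suc k) → ev m j ≡ ev (sw k e) j
      lem p q r j (yes refl) _          = trans q (sym s₁)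
      lem p q r j (no _)     (yes refl) = trans p (sym s₂)
      lem p q r j (no n₁)    (no n₂)    = trans (r j n₁ n₂) (sym (s₃ j n₁ n₂))

    strip : ℕ → ℕ → Poly
    strip α β = map (λ j → (c , bimono (α + j) (β ∸ 1 ∸ j))) (upTo (β ∸ α))

    -- A telescoping sum. Multiplying the j-th term by variable k gives `θ (suc j)`, multiplying it
    -- by variable k + 1 gives `θ j`, and only the two ends remain.
    strip-relation : ∀ α β → α ≤ β → ∀ e →
      mulC k (coeff (strip α β)) e ℤ.+ τ α β e ≡ mulC (suc k) (coeff (strip α β)) e ℤ.+ τ β α e
    strip-relation α β α≤β e = begin
      mulC k (coeff (strip α β)) e ℤ.+ τ α β e
        ≡⟨ cong₂ ℤ._+_ (trans (expand k) (sumUpTo-cong (β ∸ α) low)) (cong (λ z → τ z β e) (sym (+-identityʳ α))) ⟩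
      sumUpTo (θ ∘ suc) (β ∸ α) ℤ.+ θ 0
        ≡⟨ telescope θ (β ∸ α) ⟩
      sumUpTo θ (β ∸ α) ℤ.+ θ (β ∸ α)
        ≡⟨ cong₂ ℤ._+_ (sym (trans (expand (suc k)) (sumUpTo-cong (β ∸ α) high)))
             (cong₂ (λ z z′ → τ z z′ e) (m+[n∸m]≡n α≤β) (m∸[m∸n]≡n α≤β)) ⟩
      mulC (suc k) (coeff (strip α β)) e ℤ.+ τ β α e ∎
      where
      open ≡-Reasoning
      θ : ℕ → ℤ
      θ j = τ (α + j) (β ∸ j) e
      f : ℕ → ℤ × Mono
      f j = (c , bimono (α + j) (β ∸ 1 ∸ j))
      expand-apply : ∀ x (g : ℕ → ℕ) K → mulC x (coeff (map f (applyUpTo g K))) e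
        ≡ sumUpTo (λ j → mulC x (τ (α + g j) (β ∸ 1 ∸ g j)) e) K
      expand-apply x g zero with dec x e
      ... | just _  = refl
      ... | nothing = refl
      expand-apply x g (suc K) = trans (mulC-+ x _ (coeff (map f (applyUpTo (g ∘ suc) K))) e)
        (cong (ℤ._+_ (mulC x (τ (α + g 0) (β ∸ 1 ∸ g 0)) e)) (expand-apply x (g ∘ suc) K))
      expand : ∀ x → mulC x (coeff (strip α β)) e ≡ sumUpTo (λ j → mulC x (τ (α + j) (β ∸ 1 ∸ j)) e) (β ∸ α)
      expand x = expand-apply x id (β ∸ α)
      low : ∀ j → j < β ∸ α → mulC k (τ (α + j) (β ∸ 1 ∸ j)) e ≡ θ (suc j)
      low j _ = trans (mulC-τ-low (α + j) (β ∸ 1 ∸ j) e)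
        (cong₂ (λ z z′ → τ z z′ e) (sym (+-suc α j)) (∸-+-assoc β 1 j))
      high : ∀ j → j < β ∸ α → mulC (suc k) (τ (α + j) (β ∸ 1 ∸ j)) e ≡ θ j
      high j j< = trans (mulC-τ-high (α + j) (β ∸ 1 ∸ j) e)
        (cong (λ z → τ (α + j) z e) (trans (cong suc (∸-+-assoc β 1 j)) (sym (+-∸-assoc 1 (≤-trans j< (m∸n≤m β α))))))

τ-neg : ∀ k m c α β e → τ k m (ℤ.- c) α β e ≡ ℤ.- τ k m c α β e
τ-neg k m c α β e with monoEqᵇ (bimono k m α β) e
... | true  = refl
... | false = refl

mulC-[] : ∀ x e → mulC x (coeff []) e ≡ + 0
mulC-[] x e with dec x e
... | just _  = refl
... | nothing = refl

-- This is (x - y) ∂f = f - s f for a single term f and the variables x, y numbered k, k + 1, with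
-- all signs moved across. The three cases compare the exponents of x and y.
ddTerm-relation : ∀ k c m e →
  mulC k (coeff (ddTerm (suc k) (c , m))) e ℤ.+ term c m (sw k e) ≡
  mulC (suc k) (coeff (ddTerm (suc k) (c , m))) e ℤ.+ term c m e
ddTerm-relation k c m e with ev m (suc k) <ᵇ ev m k in eq₁
... | true  = subst₂ (λ z z′ → mulC k (coeff s) e ℤ.+ z ≡ mulC (suc k) (coeff s) e ℤ.+ z′)
    (τ-sw k m c e) (τ-self k m c e)
    (strip-relation k m c (ev m (suc k)) (ev m k) (<⇒≤ (<ᵇ-true⁻¹ (ev m (suc k)) (ev m k) eq₁)) e)
  where
  s : Poly
  s = strip k m c (ev m (suc k)) (ev m k)
... | false with ev m k <ᵇ ev m (suc k) in eq₂
...   | true  = subst₂ (λ z z′ → mulC k (coeff s) e ℤ.+ z ≡ mulC (suc k) (coeff s) e ℤ.+ z′)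
    (τ-sw k m c e) (τ-self k m c e)
    -- The strip now carries the coefficient -c and runs between the exponents in the opposite
    -- order. Moving the negated ends across the equation restores the form of the first case.
    (r (mulC k (coeff s) e) (mulC (suc k) (coeff s) e) t t′
      (subst₂ (λ z z′ → mulC k (coeff s) e ℤ.+ z ≡ mulC (suc k) (coeff s) e ℤ.+ z′)
        (τ-neg k m c (ev m k) (ev m (suc k)) e) (τ-neg k m c (ev m (suc k)) (ev m k) e)
        (strip-relation k m (ℤ.- c) (ev m k) (ev m (suc k)) (<⇒≤ (<ᵇ-true⁻¹ (ev m k) (ev m (suc k)) eq₂)) e)))
  where
  s : Poly
  s = strip k m (ℤ.- c) (ev m k) (ev m (suc k))
  t t′ : ℤ
  t = τ k m c (ev m k) (ev m (suc k)) e
  t′ = τ k m c (ev m (suc k)) (ev m k) e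
  r : ∀ x y a b → x ℤ.+ (ℤ.- a) ≡ y ℤ.+ (ℤ.- b) → x ℤ.+ b ≡ y ℤ.+ a
  r x y a b p = trans (r₁ x a b) (trans (cong (λ z → z ℤ.+ (a ℤ.+ b)) p) (r₂ y a b))
    where
    r₁ : ∀ x a b → x ℤ.+ b ≡ (x ℤ.+ (ℤ.- a)) ℤ.+ (a ℤ.+ b)
    r₁ = solve-∀
    r₂ : ∀ y a b → (y ℤ.+ (ℤ.- b)) ℤ.+ (a ℤ.+ b) ≡ y ℤ.+ a
    r₂ = solve-∀
...   | false = cong₂ ℤ._+_ (trans (mulC-[] k e) (sym (mulC-[] (suc k) e)))
  (trans (sym (τ-sw k m c e)) (trans (cong₂ (λ α β → τ k m c α β e) ab (sym ab)) (τ-self k m c e)))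
  where
  ab : ev m (suc k) ≡ ev m k
  ab = ≤-antisym (<ᵇ-false⁻¹ (ev m k) (ev m (suc k)) eq₂) (<ᵇ-false⁻¹ (ev m (suc k)) (ev m k) eq₁)

dd-relation : ∀ k p e →
  mulC k (coeff (dd (suc k) p)) e ℤ.+ coeff p (sw k e) ≡ mulC (suc k) (coeff (dd (suc k) p)) e ℤ.+ coeff p e
dd-relation k [] e = cong (ℤ._+ (+ 0)) (trans (mulC-[] k e) (sym (mulC-[] (suc k) e)))
dd-relation k ((c , m) ∷ p) e = begin
  mulC k (coeff (D₁ ++ D₂)) e ℤ.+ (term c m (sw k e) ℤ.+ coeff p (sw k e))
    ≡⟨ cong (ℤ._+ (term c m (sw k e) ℤ.+ coeff p (sw k e))) (split k) ⟩
  (mulC k (coeff D₁) e ℤ.+ mulC k (coeff D₂) e) ℤ.+ (term c m (sw k e) ℤ.+ coeff p (sw k e))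
    ≡⟨ ℤ-interchange (mulC k (coeff D₁) e) (mulC k (coeff D₂) e) (term c m (sw k e)) (coeff p (sw k e)) ⟩
  (mulC k (coeff D₁) e ℤ.+ term c m (sw k e)) ℤ.+ (mulC k (coeff D₂) e ℤ.+ coeff p (sw k e))
    ≡⟨ cong₂ ℤ._+_ (ddTerm-relation k c m e) (dd-relation k p e) ⟩
  (mulC (suc k) (coeff D₁) e ℤ.+ term c m e) ℤ.+ (mulC (suc k) (coeff D₂) e ℤ.+ coeff p e)
    ≡⟨ ℤ-interchange (mulC (suc k) (coeff D₁) e) (mulC (suc k) (coeff D₂) e) (term c m e) (coeff p e) ⟨
  (mulC (suc k) (coeff D₁) e ℤ.+ mulC (suc k) (coeff D₂) e) ℤ.+ (term c m e ℤ.+ coeff p e)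
    ≡⟨ cong (ℤ._+ (term c m e ℤ.+ coeff p e)) (split (suc k)) ⟨
  mulC (suc k) (coeff (D₁ ++ D₂)) e ℤ.+ (term c m e ℤ.+ coeff p e) ∎
  where
  open ≡-Reasoning
  D₁ D₂ : Poly
  D₁ = ddTerm (suc k) (c , m)
  D₂ = dd (suc k) p
  split : ∀ x → mulC x (coeff (D₁ ++ D₂)) e ≡ mulC x (coeff D₁) e ℤ.+ mulC x (coeff D₂) e
  split x = trans (mulC-cong x (coeff-++ D₁ D₂) e) (mulC-+ x (coeff D₁) (coeff D₂) e)

-- The difference of two variables is not a zero divisor. With x, y the variables k, k + 1, the
-- coefficient of h at e is that of y h at e y, hence that of x h at e y. This is zero if x does not
-- divide e, and otherwise the coefficient of h at e y / x, so induction on the exponent of x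
-- applies.
difference-regular : ∀ k h → (∀ {e e′} → e ~ e′ → h e ≡ h e′) → (∀ e → mulC k h e ≡ mulC (suc k) h e) →
  ∀ e → h e ≡ + 0
difference-regular k h resp p e = go (ev e k) e refl
  where
  go : ∀ α e → ev e k ≡ α → h e ≡ + 0
  go α e ek with dec (suc k) (setAt0 (suc k) (suc (ev e (suc k))) e) in eq
  ... | nothing = contradiction (trans (sym (ev-setAt0 (suc k) (suc (ev e (suc k))) e)) (dec-nothing (suc k) e⁺′ eq)) λ ()
    where
    e⁺′ : Mono
    e⁺′ = setAt0 (suc k) (suc (ev e (suc k))) e
  ... | just e″ = trans (resp e~e″) (trans (sym (cong (maybe′ h (+ 0)) eq)) (trans (sym (p e⁺)) (low α ek)))
    where
    e⁺ : Mono
    e⁺ = setAt0 (suc k) (suc (ev e (suc k))) e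
    e⁺k : ev e⁺ k ≡ ev e k
    e⁺k = ev-setAt0-≢ (suc k) (suc (ev e (suc k))) e k (<⇒≢ ≤-refl)
    e~e″ : e ~ e″
    e~e″ j with j ≟ suc k
    ... | yes refl = suc-injective (trans (sym (ev-setAt0 (suc k) (suc (ev e (suc k))) e)) (proj₁ (dec-just (suc k) e⁺ eq)))
    ... | no j≢ = trans (sym (ev-setAt0-≢ (suc k) (suc (ev e (suc k))) e j j≢)) (proj₂ (dec-just (suc k) e⁺ eq) j j≢)
    low : ∀ α → ev e k ≡ α → mulC k h e⁺ ≡ + 0
    low zero ek with dec k e⁺ in eq′
    ... | nothing = refl
    ... | just e‴ = contradiction (trans (sym (proj₁ (dec-just k e⁺ eq′))) (trans e⁺k ek)) λ ()
    low (suc α) ek with dec k e⁺ in eq′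
    ... | nothing = refl
    ... | just e‴ = go α e‴ (suc-injective (trans (sym (proj₁ (dec-just k e⁺ eq′))) (trans e⁺k ek)))

-- By `dd-relation` and `div`, both ∂p and g become p - s p when multiplied by the difference of the
-- two variables, so `difference-regular` identifies them.
dd-unique : ∀ k F w p g → DividesBy k F → (∀ e → coeff p e ≡ F w e) →
  (∀ e → coeff g e ≡ nil (suc k) F w e) → ∀ e → coeff (dd (suc k) p) e ≡ coeff g e
dd-unique k F w p g div pF gF e = ℤ.i-j≡0⇒i≡j _ _ (difference-regular k h
  (λ e~e′ → cong₂ ℤ._-_ (coeff-resp (dd (suc k) p) e~e′) (coeff-resp g e~e′)) eq e)
  where
  h : Mono → ℤ
  h e = coeff (dd (suc k) p) e ℤ.- coeff g e
  D : Mono → ℤ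
  D = coeff (dd (suc k) p)
  arith : ∀ dx dy gx gy a b → dx ℤ.+ b ≡ dy ℤ.+ a → a ℤ.+ gy ≡ b ℤ.+ gx → dx ℤ.- gx ≡ dy ℤ.- gy
  arith dx dy gx gy a b p q = trans (r₁ dx gx a b gy) (trans (cong₂ (λ s t → s ℤ.+ t ℤ.- (gx ℤ.+ gy ℤ.+ a ℤ.+ b)) p q) (r₂ dy gx gy a b))
    where
    r₁ : ∀ dx gx a b gy → dx ℤ.- gx ≡ (dx ℤ.+ b) ℤ.+ (a ℤ.+ gy) ℤ.- (gx ℤ.+ gy ℤ.+ a ℤ.+ b)
    r₁ = solve-∀
    r₂ : ∀ dy gx gy a b → (dy ℤ.+ a) ℤ.+ (b ℤ.+ gx) ℤ.- (gx ℤ.+ gy ℤ.+ a ℤ.+ b) ≡ dy ℤ.- gy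
    r₂ = solve-∀
  eq : ∀ e → mulC k h e ≡ mulC (suc k) h e
  eq e = trans (mulC-- k D (coeff g) e) (trans
    (arith (mulC k D e) (mulC (suc k) D e) (mulC k (coeff g) e) (mulC (suc k) (coeff g) e) (coeff p e) (coeff p (sw k e))
      (dd-relation k p e)
      (trans (cong₂ ℤ._+_ (pF e) (mulC-cong (suc k) gF e))
        (trans (div w e) (cong₂ ℤ._+_ (sym (pF (sw k e))) (sym (mulC-cong k gF e))))))
    (sym (mulC-- (suc k) D (coeff g) e)))

unique-set⇒↭ : ∀ {A : Set} {xs ys : List A} → Unique xs → Unique ys →
  (∀ {z} → z ∈ xs → z ∈ ys) → (∀ {z} → z ∈ ys → z ∈ xs) → xs ↭ ys
unique-set⇒↭ u v f g = ∼bag⇒↭ (unique∧set⇒bag u v (mk⇔ f g))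

coeff-↭ : ∀ {p q : Poly} e → p ↭ q → coeff p e ≡ coeff q e
coeff-↭ e ↭.refl = refl
coeff-↭ e (prep (c , m) p) = cong (ℤ._+_ (term c m e)) (coeff-↭ e p)
coeff-↭ e (swap {xs} (c , m) (c′ , m′) p) = trans (sym (ℤ.+-assoc (term c m e) (term c′ m′ e) (coeff xs e)))
  (trans (cong₂ ℤ._+_ (ℤ.+-comm (term c m e) (term c′ m′ e)) (coeff-↭ e p)) (ℤ.+-assoc (term c′ m′ e) (term c m e) _))
coeff-↭ e (↭.trans p q) = trans (coeff-↭ e p) (coeff-↭ e q)

-- Pipe dreams

subs : ∀ {A : Set} → List A → List (List A)
subs []       = [] ∷ []
subs (x ∷ xs) = subs xs ++ map (x ∷_) (subs xs)

subs⇒⊆ : ∀ {A : Set} {xs P : List A} → P ∈ subs xs → P ⊆ xs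
subs⇒⊆ {xs = []}     (here refl) = []
subs⇒⊆ {xs = x ∷ xs} P∈ with ∈-++⁻ (subs xs) P∈
... | inj₁ P∈′ = x Sublist.∷ʳ subs⇒⊆ P∈′
... | inj₂ P∈′ with ∈-map⁻ (x ∷_) P∈′
...   | _ , P∈″ , refl = refl ∷ subs⇒⊆ P∈″

AllPairs-resp-⊆ : ∀ {A : Set} {R : A → A → Set} {xs ys : List A} → xs ⊆ ys → AllPairs R ys → AllPairs R xs
AllPairs-resp-⊆ []                []       = []
AllPairs-resp-⊆ (_ Sublist.∷ʳ p) (_ ∷ rs) = AllPairs-resp-⊆ p rs
AllPairs-resp-⊆ (refl ∷ p)        (r ∷ rs) = All-resp-⊆ p r ∷ AllPairs-resp-⊆ p rs

filter∈subs : ∀ {A : Set} {R : A → Set} (R? : ∀ x → Dec (R x)) xs → filter R? xs ∈ subs xs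
filter∈subs R? [] = here refl
filter∈subs R? (x ∷ xs) with does (R? x)
... | true  = ∈-++⁺ʳ (subs xs) (∈-map⁺ (x ∷_) (filter∈subs R? xs))
... | false = ∈-++⁺ˡ (filter∈subs R? xs)

subs-unique : ∀ {A : Set} {xs : List A} → Unique xs → Unique (subs xs)
subs-unique [] = [] ∷ []
subs-unique {xs = x ∷ xs} (x∉ ∷ u) = Unique.++⁺ (subs-unique u)
  (Unique.map⁺ (λ { refl → refl }) (subs-unique u)) disjoint
  where
  disjoint : ∀ {P} → P ∈ subs xs × P ∈ map (x ∷_) (subs xs) → _
  disjoint (P∈ , P∈′) with ∈-map⁻ (x ∷_) P∈′
  ... | P′ , _ , refl = All.lookup x∉ (Any-resp-⊆ (subs⇒⊆ P∈) (here refl)) refl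

rowCount : ℕ → Word → ℕ
rowCount m P = length (filter (λ x → proj₁ x ≟ m) P)

weight : ℕ → Word → Mono
weight n P = map (λ m → rowCount m P) (range1 n)

ev-applyUpTo : ∀ f n k → k < n → ev (applyUpTo f n) k ≡ f k
ev-applyUpTo f (suc n) zero    _        = refl
ev-applyUpTo f (suc n) (suc k) (s≤s k<) = ev-applyUpTo (f ∘ suc) n k k<

ev-applyUpTo-≥ : ∀ f n k → n ≤ k → ev (applyUpTo f n) k ≡ 0
ev-applyUpTo-≥ f zero    k       _        = refl
ev-applyUpTo-≥ f (suc n) (suc k) (s≤s k≥) = ev-applyUpTo-≥ (f ∘ suc) n k k≥

map-range1 : ∀ {A : Set} (f : ℕ → A) n → map f (range1 n) ≡ applyUpTo (f ∘ suc) n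
map-range1 f n = trans (cong (map f) (map-applyUpTo id suc n)) (map-applyUpTo suc f n)

ev-range1 : ∀ f n k → k < n → ev (map f (range1 n)) k ≡ f (suc k)
ev-range1 f n k k< = trans (cong (λ m → ev m k) (map-range1 f n)) (ev-applyUpTo (f ∘ suc) n k k<)

ev-range1-≥ : ∀ f n k → n ≤ k → ev (map f (range1 n)) k ≡ 0
ev-range1-≥ f n k k≥ = trans (cong (λ m → ev m k) (map-range1 f n)) (ev-applyUpTo-≥ (f ∘ suc) n k k≥)

map-range1-~ : ∀ {f g} n → (∀ m → 1 ≤ m → m ≤ n → f m ≡ g m) → map f (range1 n) ~ map g (range1 n)
map-range1-~ {f} {g} n p k with k <? n
... | yes k< = trans (ev-range1 f n k k<) (trans (p (suc k) (s≤s z≤n) k<) (sym (ev-range1 g n k k<)))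
... | no  k≮ = trans (ev-range1-≥ f n k (≮⇒≥ k≮)) (sym (ev-range1-≥ g n k (≮⇒≥ k≮)))

rowCount-≡ : ∀ m q P → rowCount m ((m , q) ∷ P) ≡ suc (rowCount m P)
rowCount-≡ m q P rewrite dec-true (m ≟ m) refl = refl

rowCount-≢ : ∀ m m′ q P → m ≢ m′ → rowCount m′ ((m , q) ∷ P) ≡ rowCount m′ P
rowCount-≢ m m′ q P m≢m′ rewrite dec-false (m ≟ m′) m≢m′ = refl

mulC-term-weight : ∀ n m q P e → suc m ≤ n →
  mulC m (term (+ 1) (weight n P)) e ≡ term (+ 1) (weight n ((suc m , q) ∷ P)) e
mulC-term-weight n m q P e m<n with dec m e in eq
... | just e′ = cong (λ b → if b then + 1 else + 0) (bool-iff
    (λ p → ~⇒monoEq W⁺ e (λ k → fwd (monoEq⇒~ W e′ p) k (k ≟ m)))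
    (λ p → ~⇒monoEq W e′ (λ k → bwd (monoEq⇒~ W⁺ e p) k (k ≟ m))))
  where
  W W⁺ : Mono
  W = weight n P
  W⁺ = weight n ((suc m , q) ∷ P)
  W⁺m : ev W⁺ m ≡ suc (ev W m)
  W⁺m = trans (ev-range1 _ n m m<n) (trans (rowCount-≡ (suc m) q P) (cong suc (sym (ev-range1 _ n m m<n))))
  W⁺≢ : ∀ k → k ≢ m → ev W⁺ k ≡ ev W k
  W⁺≢ k k≢m with k <? n
  ... | yes k< = trans (ev-range1 _ n k k<) (trans (rowCount-≢ (suc m) (suc k) q P (k≢m ∘ sym ∘ suc-injective)) (sym (ev-range1 _ n k k<)))
  ... | no  k≮ = trans (ev-range1-≥ _ n k (≮⇒≥ k≮)) (sym (ev-range1-≥ _ n k (≮⇒≥ k≮)))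
  fwd : W ~ e′ → ∀ k → Dec (k ≡ m) → ev W⁺ k ≡ ev e k
  fwd p k (yes refl) = trans W⁺m (trans (cong suc (p m)) (sym (proj₁ (dec-just m e eq))))
  fwd p k (no k≢m) = trans (W⁺≢ k k≢m) (trans (p k) (sym (proj₂ (dec-just m e eq) k k≢m)))
  bwd : W⁺ ~ e → ∀ k → Dec (k ≡ m) → ev W k ≡ ev e′ k
  bwd p k (yes refl) = suc-injective (trans (sym W⁺m) (trans (p m) (proj₁ (dec-just m e eq))))
  bwd p k (no k≢m) = trans (sym (W⁺≢ k k≢m)) (trans (p k) (proj₂ (dec-just m e eq) k k≢m))
... | nothing with monoEqᵇ (weight n ((suc m , q) ∷ P)) e in eq′
...   | false = refl
...   | true  = contradiction (trans (sym (trans (ev-range1 _ n m m<n) (rowCount-≡ (suc m) q P)))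
                  (trans (monoEq⇒~ (weight n ((suc m , q) ∷ P)) e eq′ m) (dec-nothing m e eq))) λ ()

-- Words are stored backwards: the head of P is the last letter of the reduced word.
red : ℕ → Word → List ℕ → Bool
red n []            w = does (≡-dec _≟_ w (range1 n))
red n ((m , q) ∷ P) w = desc q w ∧ red n P (swapAt q w)

reduced : ℕ → Word → List ℕ → List (Word)
reduced n Q w = filter (λ P → red n P w Bool.≟ true) (subs Q)

monomial : ℕ → Word → ℤ × Mono
monomial n P = (+ 1 , weight n P)

Cross : ℕ → ℕ × ℕ → Set
Cross n (m , q) = 1 ≤ m × m ≤ q × q < n

-- Expanding the product of the factors 1 + x u chooses a subword. The two halves of `subs`
-- correspond to the two summands of `letter`, and a word contributes unless its product of
-- generators u vanishes, that is, when it is reduced.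
pipeSum-coeff : ∀ n Q → All (Cross n) Q → ∀ w e →
  coeff (map (monomial n) (reduced n Q w)) e ≡ pipeSum n Q w e
pipeSum-coeff n [] _ w e with does (≡-dec _≟_ w (range1 n))
... | false = refl
... | true  = cong (λ b → (if b then + 1 else + 0) ℤ.+ + 0)
  (bool-iff (λ p → ~⇒monoEq [] e (λ k → trans (sym (w~ k)) (monoEq⇒~ (weight n []) e p k)))
            (λ p → ~⇒monoEq (weight n []) e (λ k → trans (w~ k) (monoEq⇒~ [] e p k))))
  where
  w~ : weight n [] ~ []
  w~ k with k <? n
  ... | yes k< = ev-range1 _ n k k<
  ... | no  k≮ = ev-range1-≥ _ n k (≮⇒≥ k≮)
pipeSum-coeff n ((suc m , q) ∷ Q) ((_ , m≤q , q<n) ∷ c) w e = begin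
  coeff (map t (filter B (subs Q ++ map (x ∷_) (subs Q)))) e
    ≡⟨ cong (λ z → coeff (map t z) e) (filter-++ B (subs Q) (map (x ∷_) (subs Q))) ⟩
  coeff (map t (filter B (subs Q) ++ filter B (map (x ∷_) (subs Q)))) e
    ≡⟨ cong (λ z → coeff z e) (map-++ t (filter B (subs Q)) _) ⟩
  coeff (map t (filter B (subs Q)) ++ map t (filter B (map (x ∷_) (subs Q)))) e
    ≡⟨ coeff-++ (map t (filter B (subs Q))) _ e ⟩
  coeff (map t (filter B (subs Q))) e ℤ.+ coeff (map t (filter B (map (x ∷_) (subs Q)))) e
    ≡⟨ cong₂ ℤ._+_ (pipeSum-coeff n Q c w e) second ⟩
  pipeSum n Q w e ℤ.+ mulNil m q (pipeSum n Q) w e ∎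
  where
  open ≡-Reasoning
  t : Word → ℤ × Mono
  t = monomial n
  x : ℕ × ℕ
  x = (suc m , q)
  B : ∀ P → Dec (red n P w ≡ true)
  B P = red n P w Bool.≟ true
  B′ : ∀ P → Dec (red n P (swapAt q w) ≡ true)
  B′ P = red n P (swapAt q w) Bool.≟ true
  none : desc q w ≡ false → ∀ L → coeff (map t (filter B (map (x ∷_) L))) e ≡ + 0
  none d []      = refl
  none d (P ∷ L) rewrite d = none d L
  some : desc q w ≡ true → ∀ L → coeff (map t (filter B (map (x ∷_) L))) e ≡ mulC m (coeff (map t (filter B′ L))) e
  some d [] = sym (mulC-[] m e)
  some d (P ∷ L) rewrite d with red n P (swapAt q w)
  ... | false = some d L
  ... | true  = trans (cong₂ ℤ._+_ (sym (mulC-term-weight n m q P e (≤-trans m≤q (<⇒≤ q<n)))) (some d L))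
    (sym (mulC-+ m (term (+ 1) (weight n P)) (coeff (map t (filter B′ L))) e))
  second : coeff (map t (filter B (map (x ∷_) (subs Q)))) e ≡ mulNil m q (pipeSum n Q) w e
  second with desc q w in d
  ... | false = trans (none d (subs Q)) (sym (lem (dec m e)))
    where
    lem : ∀ me → maybe′ (λ _ → + 0) (+ 0) me ≡ + 0
    lem (just _) = refl
    lem nothing  = refl
  ... | true  = trans (some d (subs Q)) (mulC-cong m (pipeSum-coeff n Q c (swapAt q w)) e)

-- Permutations, Demazure products and reduced words.

range1-sorted : ∀ n → AllPairs _≤_ (range1 n)
range1-sorted n = AllPairs.map⁺ (AllPairs.applyUpTo⁺₁ id n (λ i<j _ → s≤s (<⇒≤ i<j)))

range1-unique : ∀ n → Unique (range1 n)
range1-unique n = Unique.map⁺ suc-injective (Unique.upTo⁺ n)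

length-range1 : ∀ n → length (range1 n) ≡ n
length-range1 n = trans (length-map suc (upTo n)) (length-upTo n)

perm-unique : ∀ {n w} → IsPerm n w → Unique w
perm-unique {n} p = PermSetoid.Unique-resp-↭ (setoid ℕ) (↭⇒↭ₛ (↭-sym p)) (range1-unique n)

perm-length : ∀ {n w} → IsPerm n w → length w ≡ n
perm-length {n} p = trans (↭-length p) (length-range1 n)

sorted-perm : ∀ {n w} → IsPerm n w → AllPairs _≤_ w → w ≡ range1 n
sorted-perm {n} p s = Pointwise-≡⇒≡
  (↗↭↗⇒≋ ≤-totalOrder (AllPairs⇒Linked s) (AllPairs⇒Linked (range1-sorted n)) (↭⇒↭ₛ p))

inv-sorted : ∀ {w} → AllPairs _≤_ w → inv w ≡ 0
inv-sorted []               = refl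
inv-sorted {x ∷ w} (x≤ ∷ s) = cong₂ _+_ (cong length (filter-none (λ y → suc y ≤? x) (All.map ≤⇒≯ x≤))) (inv-sorted s)

inv-range1 : ∀ n → inv (range1 n) ≡ 0
inv-range1 n = inv-sorted (range1-sorted n)

dem : ℕ → Word → List ℕ
dem n []            = range1 n
dem n ((m , q) ∷ P) = up q (dem n P)

dem-perm : ∀ n P → IsPerm n (dem n P)
dem-perm n []            = ↭-refl
dem-perm n ((m , q) ∷ P) = ↭-trans (up-↭ q (dem n P)) (dem-perm n P)

asc⇒up : ∀ q w → desc q w ≡ false → up q w ≡ swapAt q w
asc⇒up q w d rewrite d = refl

desc⇒dn : ∀ q w → desc q w ≡ true → dn q w ≡ swapAt q w
desc⇒dn q w d rewrite d = refl

asc⇒dn : ∀ q w → desc q w ≡ false → dn q w ≡ w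
asc⇒dn q w d rewrite d = refl

red-id : ∀ n w → red n [] w ≡ true → w ≡ range1 n
red-id n w r with ≡-dec _≟_ w (range1 n)
... | yes p = p

red⇒dem : ∀ n P w → red n P w ≡ true → dem n P ≡ w
red⇒dem n []            w r = sym (red-id n w r)
red⇒dem n ((m , q) ∷ P) w r with ∧-true⁻¹ {desc q w} r
... | d , r′ rewrite red⇒dem n P (swapAt q w) r′ =
  trans (asc⇒up q (swapAt q w) (desc-swapAt q w d)) (swapAt-involutive q w)

red⇒length : ∀ n P w → red n P w ≡ true → length P ≡ inv w
red⇒length n []            w r rewrite red-id n w r = sym (inv-range1 n)
red⇒length n ((m , q) ∷ P) w r with ∧-true⁻¹ {desc q w} r
... | d , r′ = trans (cong suc (red⇒length n P (swapAt q w) r′)) (sym (inv-desc q w d))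

<length : ∀ {n m q} w → IsPerm n w → Cross n (m , q) → q < length w
<length w p (_ , _ , q<n) = subst (_ <_) (sym (perm-length p)) q<n

1≤cross : ∀ {n m q} → Cross n (m , q) → 1 ≤ q
1≤cross (1≤m , m≤q , _) = ≤-trans 1≤m m≤q

inv-dem : ∀ n P → All (Cross n) P → inv (dem n P) ≤ length P
inv-dem n []            []       = ≤-reflexive (inv-range1 n)
inv-dem n ((m , q) ∷ P) (c ∷ cs) with desc q (dem n P) in d
... | true  = m≤n⇒m≤1+n (inv-dem n P cs)
... | false = ≤-trans (≤-reflexive (inv-up q (dem n P) (perm-unique (dem-perm n P)) (1≤cross c)
    (<length (dem n P) (dem-perm n P) c) d)) (s≤s (inv-dem n P cs))

-- Each letter raises `inv` of the Demazure product by at most one, so the length bound forces every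
-- letter to raise it.
dem⇒red : ∀ n P → All (Cross n) P → length P ≤ inv (dem n P) → red n P (dem n P) ≡ true
dem⇒red n [] [] _ rewrite dec-true (≡-dec _≟_ (range1 n) (range1 n)) refl = refl
dem⇒red n ((m , q) ∷ P) (c ∷ cs) l with desc q (dem n P) in d
... | true  = contradiction (inv-dem n P cs) (<⇒≱ l)
... | false = cong₂ _∧_ (asc-swapAt q (dem n P) u (1≤cross c) q< d)
    (trans (cong (red n P) (swapAt-involutive q (dem n P)))
      (dem⇒red n P cs (≤-pred (≤-trans l (≤-reflexive (inv-up q (dem n P) u (1≤cross c) q< d))))))
  where
  u : Unique (dem n P)
  u = perm-unique (dem-perm n P)
  q< : q < length (dem n P)
  q< = <length (dem n P) (dem-perm n P) c

-- Every permutation has a reduced word inside the staircase.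

sortAlong : Word → List ℕ → List ℕ
sortAlong []            w = w
sortAlong ((m , q) ∷ P) w = sortAlong P (dn q w)

sortAlong-++ : ∀ P P′ w → sortAlong (P ++ P′) w ≡ sortAlong P′ (sortAlong P w)
sortAlong-++ []            P′ w = refl
sortAlong-++ ((m , q) ∷ P) P′ w = sortAlong-++ P P′ (dn q w)

sortAlong-↭ : ∀ P w → sortAlong P w ↭ w
sortAlong-↭ []            w = ↭-refl
sortAlong-↭ ((m , q) ∷ P) w = ↭-trans (sortAlong-↭ P (dn q w)) (dn-↭ q w)

drop-dn : ∀ m k w → drop m (dn (suc (m + k)) w) ≡ dn (suc k) (drop m w)
drop-dn zero    k       w        = refl
drop-dn (suc m) zero    []       = refl
drop-dn (suc m) (suc k) []       = refl
drop-dn (suc m) k       (x ∷ xs) = trans (cong (drop (suc m)) (dn-∷ (m + k) x xs)) (drop-dn m k xs)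

drop-sortAlong : ∀ r m k c w → drop m (sortAlong (rowFrom r (suc (m + k)) c) w) ≡ sortAlong (rowFrom r (suc k) c) (drop m w)
drop-sortAlong r m k zero    w = refl
drop-sortAlong r m k (suc c) w = trans
  (cong (λ z → drop m (sortAlong (rowFrom r (suc z) c) (dn (suc (m + k)) w))) (sym (+-suc m k)))
  (trans (drop-sortAlong r m (suc k) c (dn (suc (m + k)) w)) (cong (sortAlong (rowFrom r (2 + k) c)) (drop-dn m k w)))

sortAlong-∷ : ∀ r k c x xs → sortAlong (rowFrom r (2 + k) c) (x ∷ xs) ≡ x ∷ sortAlong (rowFrom r (suc k) c) xs
sortAlong-∷ r k zero    x xs = refl
sortAlong-∷ r k (suc c) x xs = trans (cong (sortAlong (rowFrom r (3 + k) c)) (dn-∷ k x xs))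
  (sortAlong-∷ r (suc k) c x (dn (suc k) xs))

insert-sorted : ∀ r x xs → AllPairs _≤_ xs → AllPairs _≤_ (sortAlong (rowFrom r 1 (length xs)) (x ∷ xs))
insert-sorted r x []       []      = [] ∷ []
insert-sorted r x (y ∷ ys) (y≤ ∷ s) with y <ᵇ x in d
... | true  rewrite sortAlong-∷ r 0 (length ys) y (x ∷ ys) =
  All-resp-↭ (↭-sym (sortAlong-↭ (rowFrom r 1 (length ys)) (x ∷ ys))) (<⇒≤ (<ᵇ-true⁻¹ y x d) ∷ y≤) ∷ insert-sorted r x ys s
-- If `x` is in place already, the pass goes on with `y` as the entry to be inserted.
... | false rewrite sortAlong-∷ r 0 (length ys) x (y ∷ ys) =
  All-resp-↭ (↭-sym (sortAlong-↭ (rowFrom r 1 (length ys)) (y ∷ ys))) (x≤y ∷ All.map (≤-trans x≤y) y≤) ∷ insert-sorted r y ys s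
  where
  x≤y : x ≤ y
  x≤y = <ᵇ-false⁻¹ y x d

drop-length-∷ : ∀ m (w : List ℕ) → m < length w → ∃ λ x → drop m w ≡ x ∷ drop (suc m) w
drop-length-∷ zero    (x ∷ w) _       = x , refl
drop-length-∷ (suc m) (x ∷ w) (s≤s l) = drop-length-∷ m w l

-- Insertion sort: row m + 1 of the staircase carries the entry in position m + 1 into the sorted
-- tail behind it.
rows-sort : ∀ n m w → m ≤ n → length w ≡ n → AllPairs _≤_ (drop m w) → AllPairs _≤_ (sortAlong (rows n m) w)
rows-sort n zero    w _   _ s = s
rows-sort n (suc m) w m<n l s rewrite sortAlong-++ (rowFrom (suc m) (suc m) (n ∸ suc m)) (rows n m) w =
  rows-sort n m w′ (<⇒≤ m<n) (trans (↭-length (sortAlong-↭ (rowFrom (suc m) (suc m) (n ∸ suc m)) w)) l) sorted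
  where
  w′ : List ℕ
  w′ = sortAlong (rowFrom (suc m) (suc m) (n ∸ suc m)) w
  sorted : AllPairs _≤_ (drop m w′)
  sorted with drop-length-∷ m w (subst (m <_) (sym l) m<n)
  ... | x , eq = subst (AllPairs _≤_) (sym (trans
      (trans (cong (λ z → drop m (sortAlong (rowFrom (suc m) (suc z) (n ∸ suc m)) w)) (sym (+-identityʳ m)))
        (drop-sortAlong (suc m) m 0 (n ∸ suc m) w))
      (cong₂ (λ c v → sortAlong (rowFrom (suc m) 1 c) v)
        (sym (trans (length-drop (suc m) w) (cong (_∸ suc m) l))) eq)))
    (insert-sorted (suc m) x (drop (suc m) w) s)

-- The letters at which `sortAlong` actually swaps form the reduced word.
red-greedy : ∀ n Q w → sortAlong Q w ≡ range1 n → ∃ λ P → P ∈ subs Q × red n P w ≡ true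
red-greedy n []            w p = [] , here refl , dec-true (≡-dec _≟_ w (range1 n)) p
red-greedy n ((m , q) ∷ Q) w p with desc q w in d
... | true  = let (P , P∈ , r) = red-greedy n Q (swapAt q w) p in
  (m , q) ∷ P , ∈-++⁺ʳ (subs Q) (∈-map⁺ _ P∈) , cong₂ _∧_ d r
... | false = let (P , P∈ , r) = red-greedy n Q w p in P , ∈-++⁺ˡ P∈ , r

staircase : ℕ → Word
staircase n = rows n n

red-exists : ∀ n w → IsPerm n w → ∃ λ P → P ∈ subs (staircase n) × red n P w ≡ true
red-exists n w p = red-greedy n (staircase n) w (sorted-perm (↭-trans (sortAlong-↭ (staircase n) w) p)
  (rows-sort n n w ≤-refl (perm-length p) (subst (λ l → AllPairs _≤_ (drop l w)) (perm-length p) (lem w))))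
  where
  lem : ∀ w → AllPairs _≤_ (drop (length w) w)
  lem []      = []
  lem (x ∷ w) = lem w

-- Position in the staircase word read backwards: lower rows first, and left to right in a row.
data _≻_ : ℕ × ℕ → ℕ × ℕ → Set where
  byRow : ∀ {m q m′ q′} → m′ < m → (m , q) ≻ (m′ , q′)
  byCol : ∀ {m q q′} → q < q′ → (m , q) ≻ (m , q′)

rowFrom-row : ∀ m k c → All (λ x → proj₁ x ≡ m × k ≤ proj₂ x × proj₂ x < k + c) (rowFrom m k c)
rowFrom-row m k zero    = []
rowFrom-row m k (suc c) = (refl , ≤-refl , m<m+n k (s≤s z≤n)) ∷
  All.map (λ {x} (p , q , r) → p , <⇒≤ q , subst (proj₂ x <_) (sym (+-suc k c)) r) (rowFrom-row m (suc k) c)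

rowFrom-ordered : ∀ m k c → AllPairs _≻_ (rowFrom m k c)
rowFrom-ordered m k zero    = []
rowFrom-ordered m k (suc c) = All.map (λ { (refl , k< , _) → byCol k< }) (rowFrom-row m (suc k) c) ∷ rowFrom-ordered m (suc k) c

rows-row : ∀ n m → All (λ x → proj₁ x ≤ m) (rows n m)
rows-row n zero    = []
rows-row n (suc m) = All.++⁺ (All.map (λ { (refl , _) → ≤-refl }) (rowFrom-row (suc m) (suc m) (n ∸ suc m)))
  (All.map m≤n⇒m≤1+n (rows-row n m))

rows-ordered : ∀ n m → AllPairs _≻_ (rows n m)
rows-ordered n zero    = []
rows-ordered n (suc m) = AllPairs.++⁺ (rowFrom-ordered (suc m) (suc m) (n ∸ suc m)) (rows-ordered n m)
  (All.map (λ { (refl , _) → All.map (λ ≤m → byRow (s≤s ≤m)) (rows-row n m) }) (rowFrom-row (suc m) (suc m) (n ∸ suc m)))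

≻⇒≢ : ∀ {x y} → x ≻ y → x ≢ y
≻⇒≢ (byRow m′<m) refl = <-irrefl refl m′<m
≻⇒≢ (byCol q<q′) refl = <-irrefl refl q<q′

staircase-unique : ∀ n → Unique (staircase n)
staircase-unique n = AllPairs.map ≻⇒≢ (rows-ordered n n)

rows-cross : ∀ n m → m ≤ n → All (Cross n) (rows n m)
rows-cross n zero    _   = []
rows-cross n (suc m) m<n = All.++⁺
  (All.map (λ { {x} (refl , k≤ , <k) → s≤s z≤n , k≤ , subst (proj₂ x <_) (m+[n∸m]≡n m<n) <k }) (rowFrom-row (suc m) (suc m) (n ∸ suc m)))
  (rows-cross n m (<⇒≤ m<n))

staircase-cross : ∀ n → All (Cross n) (staircase n)
staircase-cross n = rows-cross n n ≤-refl

rowFrom-∈ : ∀ m k c q → k ≤ q → q < k + c → (m , q) ∈ rowFrom m k c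
rowFrom-∈ m k zero    q k≤q q<k rewrite +-identityʳ k = contradiction k≤q (<⇒≱ q<k)
rowFrom-∈ m k (suc c) q k≤q q<k with k ≟ q
... | yes refl = here refl
... | no  k≢q    = there (rowFrom-∈ m (suc k) c q (≤∧≢⇒< k≤q k≢q) (subst (q <_) (+-suc k c) q<k))

rows-∈ : ∀ n m r q → r ≤ m → m ≤ n → Cross n (r , q) → (r , q) ∈ rows n m
rows-∈ n zero    zero q _   _   (() , _)
rows-∈ n (suc m) r    q r≤m m<n c@(1≤r , r≤q , q<n) with r ≟ suc m
... | yes refl = ∈-++⁺ˡ (rowFrom-∈ (suc m) (suc m) (n ∸ suc m) q r≤q (subst (q <_) (sym (m+[n∸m]≡n m<n)) q<n))
... | no r≢      = ∈-++⁺ʳ (rowFrom (suc m) (suc m) (n ∸ suc m)) (rows-∈ n m r q (≤-pred (≤∧≢⇒< r≤m r≢)) (<⇒≤ m<n) c)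

staircase-∈ : ∀ n r q → Cross n (r , q) → (r , q) ∈ staircase n
staircase-∈ n r q c@(_ , r≤q , q<n) = rows-∈ n n r q (≤-trans r≤q (<⇒≤ q<n)) ≤-refl c

rowCount-++ : ∀ r P P′ → rowCount r (P ++ P′) ≡ rowCount r P + rowCount r P′
rowCount-++ r P P′ = trans (cong length (filter-++ _ P P′)) (length-++ (filter _ P))

rowCount-none : ∀ r P → All (λ x → proj₁ x ≢ r) P → rowCount r P ≡ 0
rowCount-none r []            []        = refl
rowCount-none r ((m , q) ∷ P) (m≢r ∷ a) = trans (rowCount-≢ m r q P m≢r) (rowCount-none r P a)

rowCount-rowFrom : ∀ r k c → rowCount r (rowFrom r k c) ≡ c
rowCount-rowFrom r k zero    = refl
rowCount-rowFrom r k (suc c) = trans (rowCount-≡ r k _) (cong suc (rowCount-rowFrom r (suc k) c))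

rowCount-rows : ∀ n m r → 1 ≤ r → r ≤ m → rowCount r (rows n m) ≡ n ∸ r
rowCount-rows n zero    zero () _
rowCount-rows n (suc m) r 1≤r r≤m with r ≟ suc m
... | yes refl = trans (rowCount-++ (suc m) (rowFrom (suc m) (suc m) (n ∸ suc m)) (rows n m))
  (trans (cong₂ _+_ (rowCount-rowFrom (suc m) (suc m) (n ∸ suc m))
    (rowCount-none (suc m) (rows n m) (All.map (λ ≤m → <⇒≢ (s≤s ≤m)) (rows-row n m)))) (+-identityʳ _))
... | no r≢ = trans (rowCount-++ r (rowFrom (suc m) (suc m) (n ∸ suc m)) (rows n m))
  (cong₂ _+_ (rowCount-none r _ (All.map (λ { (refl , _) → r≢ ∘ sym }) (rowFrom-row (suc m) (suc m) (n ∸ suc m))))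
    (rowCount-rows n m r 1≤r (≤-pred (≤∧≢⇒< r≤m r≢))))

-- Schubert polynomials as sums over reduced pipe dreams.

pipeDreams : ℕ → List ℕ → List Word
pipeDreams n = reduced n (staircase n)

pipeDreams-unique : ∀ n w → Unique (pipeDreams n w)
pipeDreams-unique n w = Unique.filter⁺ _ (subs-unique (staircase-unique n))

∈-pipeDreams⁺ : ∀ n {P} w → P ∈ subs (staircase n) → red n P w ≡ true → P ∈ pipeDreams n w
∈-pipeDreams⁺ n w P∈ r = ∈-filter⁺ _ P∈ r

∈-pipeDreams⁻ : ∀ n {P} w → P ∈ pipeDreams n w → P ∈ subs (staircase n) × red n P w ≡ true
∈-pipeDreams⁻ n w P∈ = ∈-filter⁻ _ P∈

pipePoly : ℕ → List ℕ → Poly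
pipePoly n w = map (monomial n) (pipeDreams n w)

-- A reduced pipe dream of w has `inv w` crossings and so must be the whole staircase; `red-exists`
-- shows that it is one. This serves both ends of the recursion, no ascent and no fuel.
deltaP-pipePoly : ∀ n w → IsPerm n w → length (staircase n) ≤ inv w → deltaP n ≈P pipePoly n w
deltaP-pipePoly n w p l e = trans
  (cong (ℤ._+ (+ 0)) (cong (λ b → if b then + 1 else + 0) (bool-iff
    (λ q → ~⇒monoEq W e (λ k → trans (sym (d~ k)) (monoEq⇒~ δ e q k)))
    (λ q → ~⇒monoEq δ e (λ k → trans (d~ k) (monoEq⇒~ W e q k))))))
  (coeff-↭ e (map⁺ (monomial n) (unique-set⇒↭ ([] ∷ []) (pipeDreams-unique n w)
     (λ { (here refl) → full∈ }) (λ P∈ → here (onlyFull P∈)))))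
  where
  W δ : Mono
  W = weight n (staircase n)
  δ = map (λ i → n ∸ i) (range1 n)
  d~ : δ ~ W
  d~ = map-range1-~ n (λ m 1≤m m≤n → sym (rowCount-rows n n m 1≤m m≤n))
  onlyFull : ∀ {P} → P ∈ pipeDreams n w → P ≡ staircase n
  onlyFull {P} P∈ with ∈-pipeDreams⁻ n w P∈
  ... | P∈′ , r = Pointwise-≡⇒≡ (to-≋ (≤-antisym (length-mono-≤ P⊆) (≤-trans l (≤-reflexive (sym (red⇒length n P w r))))) P⊆)
    where
    P⊆ : P ⊆ staircase n
    P⊆ = subs⇒⊆ P∈′
  full∈ : staircase n ∈ pipeDreams n w
  full∈ with red-exists n w p
  ... | P , P∈ , r = subst (_∈ pipeDreams n w) (onlyFull (∈-pipeDreams⁺ n w P∈ r)) (∈-pipeDreams⁺ n w P∈ r)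

triangle : ℕ → ℕ
triangle zero    = 0
triangle (suc n) = n + triangle n

length-rowFrom : ∀ m k c → length (rowFrom m k c) ≡ c
length-rowFrom m k zero    = refl
length-rowFrom m k (suc c) = cong suc (length-rowFrom m (suc k) c)

length-rows : ∀ n m → m ≤ n → length (rows n m) + triangle (n ∸ m) ≡ triangle n
length-rows n zero    _   = refl
length-rows n (suc m) m<n = trans (cong (_+ triangle (n ∸ suc m)) (trans (length-++ (rowFrom (suc m) (suc m) (n ∸ suc m)))
    (trans (cong (_+ length (rows n m)) (length-rowFrom (suc m) (suc m) (n ∸ suc m))) (+-comm _ (length (rows n m))))))
  (trans (+-assoc (length (rows n m)) (n ∸ suc m) _)
  (trans (cong (λ z → length (rows n m) + triangle z) (sym (+-∸-assoc 1 m<n))) (length-rows n m (<⇒≤ m<n))))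

length-staircase : ∀ n → length (staircase n) ≡ triangle n
length-staircase n = trans (sym (+-identityʳ _)) (trans (cong (λ z → length (staircase n) + triangle z) (sym (n∸n≡0 n))) (length-rows n n ≤-refl))

triangle≤square : ∀ n → triangle n ≤ n * n
triangle≤square zero    = z≤n
triangle≤square (suc n) = +-mono-≤ (n≤1+n n) (≤-trans (triangle≤square n) (*-monoʳ-≤ n (n≤1+n n)))

inv-decreasing : ∀ {w} → AllPairs _>_ w → inv w ≡ triangle (length w)
inv-decreasing []               = refl
inv-decreasing {x ∷ w} (x> ∷ s) = cong₂ _+_ (cong length (filter-all (λ y → suc y ≤? x) x>)) (inv-decreasing s)

noAscent⇒decreasing : ∀ k w → Unique w → firstAscentFrom k w ≡ nothing → Linked _>_ w
noAscent⇒decreasing k []           u _ = []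
noAscent⇒decreasing k (x ∷ [])     u _ = [-]
noAscent⇒decreasing k (x ∷ y ∷ ys) ((x≢y ∷ _) ∷ u) p with x <ᵇ y in d
noAscent⇒decreasing k (x ∷ y ∷ ys) ((x≢y ∷ _) ∷ u) () | true
... | false = ≤∧≢⇒< (<ᵇ-false⁻¹ x y d) (x≢y ∘ sym) ∷ noAscent⇒decreasing (suc k) (y ∷ ys) u p

firstAscent-spec : ∀ k w {i} → firstAscentFrom (suc k) w ≡ just i →
  ∃ λ j → i ≡ suc (k + j) × suc j < length w × desc (suc j) w ≡ false
firstAscent-spec k (x ∷ y ∷ ys) {i} p = go (x <ᵇ y) refl p (λ q → firstAscent-spec (suc k) (y ∷ ys) q)
  where
  go : ∀ b → (x <ᵇ y) ≡ b → (if b then just (suc k) else firstAscentFrom (2 + k) (y ∷ ys)) ≡ just i →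
    (firstAscentFrom (2 + k) (y ∷ ys) ≡ just i →
      ∃ λ j → i ≡ suc (suc k + j) × suc j < length (y ∷ ys) × desc (suc j) (y ∷ ys) ≡ false) →
    ∃ λ j → i ≡ suc (k + j) × suc j < length (x ∷ y ∷ ys) × desc (suc j) (x ∷ y ∷ ys) ≡ false
  go true  d refl _ = 0 , cong suc (sym (+-identityʳ k)) , s≤s (s≤s z≤n) , <ᵇ-false (<⇒≤ (<ᵇ-true⁻¹ x y d))
  go false d p ih = let (j , eq , j< , a) = ih p in suc j , trans eq (cong suc (sym (+-suc k j))) , s≤s j< , a

-- Swapping at an ascent trades one unit of fuel for one inversion, so the bound persists, and
-- without fuel it says that w has the maximal number of inversions.
schubF-pipePoly : ∀ n f w → IsPerm n w → length (staircase n) ≤ f + inv w → schubF n f w ≈P pipePoly n w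
schubF-pipePoly n zero    w p l = deltaP-pipePoly n w p l
schubF-pipePoly n (suc f) w p l with firstAscentFrom 1 w in eq
... | nothing = deltaP-pipePoly n w p (≤-reflexive (trans (length-staircase n)
  (trans (cong triangle (sym (perm-length p)))
    (sym (inv-decreasing (Linked⇒AllPairs (λ a b → <-trans b a) (noAscent⇒decreasing 1 w (perm-unique p) eq)))))))
... | just i with firstAscent-spec 0 w eq
...   | k , refl , k< , a = dd-unique k (pipeSum n (staircase n)) (swapAt (suc k) w)
    (schubF n f (swapAt (suc k) w)) (pipePoly n w) divides
    (λ e → trans (schubF-pipePoly n f (swapAt (suc k) w) p′ l′ e) (pipeSum-coeff n (staircase n) (staircase-cross n) (swapAt (suc k) w) e))
    (λ e → trans (pipeSum-coeff n (staircase n) (staircase-cross n) w e) (sym (nil-eq e)))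
  where
  p′ : IsPerm n (swapAt (suc k) w)
  p′ = ↭-trans (swapAt-↭ (suc k) w) p
  k<n : suc k < n
  k<n = subst (suc k <_) (perm-length p) k<
  l′ : length (staircase n) ≤ f + inv (swapAt (suc k) w)
  l′ = ≤-trans l (≤-reflexive (trans (sym (+-suc f (inv w)))
    (cong (λ z → f + z) (sym (inv-up (suc k) w (perm-unique p) (s≤s z≤n) k< a)))))
  divides : DividesBy k (pipeSum n (staircase n))
  divides = subst (λ z → DividesBy k (pipeSum n (rows n z))) (m∸n+n≡m k<n) (pipeSum-dividesBy n k (n ∸ (2 + k)) k<n)
  -- `dd-unique` is used at w s, where the coefficient of F u is the coefficient of F at w.
  nil-eq : ∀ e → nil (suc k) (pipeSum n (staircase n)) (swapAt (suc k) w) e ≡ pipeSum n (staircase n) w e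
  nil-eq e rewrite asc-swapAt (suc k) w (perm-unique p) (s≤s z≤n) k< a =
    cong (λ v → pipeSum n (staircase n) v e) (swapAt-involutive (suc k) w)

schubert-pipePoly : ∀ n w → IsPerm n w → schubert n w ≈P pipePoly n w
schubert-pipePoly n w p = schubF-pipePoly n (n * n) w p
  (≤-trans (≤-reflexive (length-staircase n)) (≤-trans (triangle≤square n) (m≤m+n _ _)))

-- Corner sums of Demazure products, computed from either end of the word.

-- The analogue of demRow for left multiplication: it acts on the columns of corner sums.
demCol : ℕ → Rank → Rank
demCol q r i j = if does (j ≟ q) then r i (q ∸ 1) ⊔ (r i (suc q) ∸ 1) else r i j

minRank : Rank
minRank i j = i ⊓ j

-- `rankR` follows `dem` and multiplies on the right, which mixes the rows of the corner sums. A
-- color with parameter d only sees row d, and left multiplication acts inside each row; `rankL`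
-- therefore builds the product from the other end.
rankR rankL : Word → Rank
rankR []            = minRank
rankR ((m , q) ∷ P) = demRow q (rankR P)
rankL []            = minRank
rankL ((m , q) ∷ W) = demCol q (rankL W)

infix 4 _≗ᵣ_
_≗ᵣ_ : Rank → Rank → Set
r ≗ᵣ s = ∀ i j → r i j ≡ s i j

demRow-cong : ∀ q {r s} → r ≗ᵣ s → demRow q r ≗ᵣ demRow q s
demRow-cong q p i j with does (i ≟ q)
... | true  = cong₂ _⊔_ (p (q ∸ 1) j) (cong (_∸ 1) (p (suc q) j))
... | false = p i j

demCol-cong : ∀ q {r s} → r ≗ᵣ s → demCol q r ≗ᵣ demCol q s
demCol-cong q p i j with does (j ≟ q)
... | true  = cong₂ _⊔_ (p i (q ∸ 1)) (cong (_∸ 1) (p i (suc q)))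
... | false = p i j

demCol-demRow : ∀ p q r → demCol p (demRow q r) ≗ᵣ demRow q (demCol p r)
demCol-demRow p q r i j with does (j ≟ p) | does (i ≟ q)
... | true  | true  rewrite ∸-distribʳ-⊔ 1 (r (q ∸ 1) (suc p)) (r (suc q) (suc p) ∸ 1)
                          | ∸-distribʳ-⊔ 1 (r (suc q) (p ∸ 1)) (r (suc q) (suc p) ∸ 1) =
  ⊔-interchange (r (q ∸ 1) (p ∸ 1)) _ _ _
... | true  | false = refl
... | false | true  = refl
... | false | false = refl

demRow-min-≢ : ∀ q j → 1 ≤ q → j ≢ q → demRow q minRank q j ≡ q ⊓ j
demRow-min-≢ (suc q) j _ j≢q rewrite dec-true (q ≟ q) refl with <-cmp j (suc q)
... | tri< (s≤s j≤q) _ _ rewrite m≥n⇒m⊓n≡n j≤q | m≥n⇒m⊓n≡n (m≤n⇒m≤1+n j≤q) | m≥n⇒m⊓n≡n (m≤n⇒m≤1+n (m≤n⇒m≤1+n j≤q)) = m≥n⇒m⊔n≡m (m∸n≤m j 1)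
... | tri≈ _ j≡q _ = contradiction j≡q j≢q
... | tri> _ _ q<j rewrite m≤n⇒m⊓n≡m (<⇒≤ q<j) | m≤n⇒m⊓n≡m q<j | m≤n⇒m⊓n≡m (<⇒≤ (<⇒≤ q<j)) = m≤n⇒m⊔n≡n (n≤1+n q)

demRow-min-sym : ∀ q i j → 1 ≤ q → demRow q minRank i j ≡ demRow q minRank j i
demRow-min-sym q i j 1≤q with i ≟ q | j ≟ q
... | yes refl | yes refl = refl
... | yes refl | no j≢q = trans (demRow-min-≢ q j 1≤q j≢q) (trans (⊓-comm q j) (sym (≢⇒if j≢q)))
... | no i≢q | yes refl = trans (≢⇒if i≢q) (trans (⊓-comm i q) (sym (demRow-min-≢ q i 1≤q i≢q)))
... | no i≢q | no j≢q = trans (≢⇒if i≢q) (trans (⊓-comm i j) (sym (≢⇒if j≢q)))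

-- Left and right multiplication by s_q agree on the identity. With `demCol-demRow` this lets a
-- letter pass from one end of a word to the other.
demCol-min : ∀ q → 1 ≤ q → demCol q minRank ≗ᵣ demRow q minRank
demCol-min q 1≤q i j = trans flip (demRow-min-sym q j i 1≤q)
  where
  flip : demCol q minRank i j ≡ demRow q minRank j i
  flip with does (j ≟ q)
  ... | true  = cong₂ _⊔_ (⊓-comm i (q ∸ 1)) (cong (_∸ 1) (⊓-comm i (suc q)))
  ... | false = ⊓-comm i j

rankR-∷ʳ : ∀ P m q → 1 ≤ q → demCol q (rankR P) ≗ᵣ rankR (P ∷ʳ (m , q))
rankR-∷ʳ []              m q 1≤q = demCol-min q 1≤q
rankR-∷ʳ ((m′ , q′) ∷ P) m q 1≤q i j =
  trans (demCol-demRow q q′ (rankR P) i j) (demRow-cong q′ (rankR-∷ʳ P m q 1≤q) i j)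

rankL≗rankR : ∀ W → All (λ x → 1 ≤ proj₂ x) W → rankL W ≗ᵣ rankR (reverse W)
rankL≗rankR []            _          i j = refl
rankL≗rankR ((m , q) ∷ W) (1≤q ∷ as) i j = trans (demCol-cong q (rankL≗rankR W as) i j)
  (trans (rankR-∷ʳ (reverse W) m q 1≤q i j) (cong (λ P → rankR P i j) (sym (unfold-reverse (m , q) W))))

corner-range1 : ∀ n i j → i ≤ n → corner (range1 n) i j ≡ i ⊓ j
corner-range1 n i j i≤n = trans (cong (λ w → corner w i j) (map-applyUpTo id suc n)) (go 0 n i suc (λ _ → refl) i≤n)
  where
  go : ∀ s n i (f : ℕ → ℕ) → (∀ k → f k ≡ suc (s + k)) → i ≤ n → corner (applyUpTo f n) i j ≡ i ⊓ (j ∸ s)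
  go s n       zero    f p _         = refl
  go s (suc n) (suc i) f p (s≤s i≤n) = trans (corner-∷ (f 0) (applyUpTo (f ∘ suc) n) i j)
    (trans (cong (λ z → bit (f 0) j + z) (go (suc s) n i (f ∘ suc) (λ k → trans (p (suc k)) (cong suc (+-suc s k))) i≤n))
      (fin (s <? j)))
    where
    f0 : f 0 ≡ suc s
    f0 = trans (p 0) (cong suc (+-identityʳ s))
    fin : Dec (s < j) → bit (f 0) j + (i ⊓ (j ∸ suc s)) ≡ suc i ⊓ (j ∸ s)
    fin (yes s<j) rewrite f0 | bit-≤ s<j = cong (suc i ⊓_) (sym (+-∸-assoc 1 {j} {suc s} s<j))
    fin (no  s≮j) rewrite f0 | bit-> (s≤s (≮⇒≥ s≮j)) | m≤n⇒m∸n≡0 (≮⇒≥ s≮j)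
      | m≤n⇒m∸n≡0 (m≤n⇒m≤1+n (≮⇒≥ s≮j)) = ⊓-zeroʳ i

corner-dem : ∀ n P → All (Cross n) P → ∀ i j → i ≤ n → corner (dem n P) i j ≡ rankR P i j
corner-dem n []            _        i j i≤n = corner-range1 n i j i≤n
corner-dem n ((m , q) ∷ P) (c ∷ cs) i j i≤n = trans
  (corner-up q (dem n P) (1≤cross c) (<length (dem n P) (dem-perm n P) c) i j) rows-eq
  where
  rows-eq : demRow q (corner (dem n P)) i j ≡ demRow q (rankR P) i j
  rows-eq with does (i ≟ q)
  ... | true  = cong₂ _⊔_ (corner-dem n P cs (q ∸ 1) j (≤-trans (m∸n≤m q 1) (<⇒≤ (proj₂ (proj₂ c)))))
                          (cong (_∸ 1) (corner-dem n P cs (suc q) j (proj₂ (proj₂ c))))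
  ... | false = corner-dem n P cs i j i≤n

record Steps (f : ℕ → ℕ) : Set where
  field
    mono≤ : ∀ j → f j ≤ f (suc j)
    step≤ : ∀ j → f (suc j) ≤ suc (f j)
open Steps

steps-pred : ∀ {f} → Steps f → ∀ q → f (q ∸ 1) ≤ f q
steps-pred s zero    = ≤-refl
steps-pred s (suc q) = mono≤ s q

steps-min : ∀ d → Steps (d ⊓_)
steps-min d .mono≤ j = ⊓-monoʳ-≤ d (n≤1+n j)
steps-min d .step≤ j = ⊓-mono-≤ (n≤1+n d) ≤-refl

-- The action of `demCol q` on a single row; its counterpart on shapes is `remove`.
raise : ℕ → (ℕ → ℕ) → ℕ → ℕ
raise q f j = if does (j ≟ q) then f (q ∸ 1) ⊔ (f (suc q) ∸ 1) else f j

-- Removing the corner on the antidiagonal of s_q from the shape {(a , q) | f q < a}, if there is one.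
remove : ℕ → (ℕ → ℕ) → ℕ → ℕ
remove q f j = if does (j ≟ q) then suc (f (q ∸ 1)) ⊓ f (suc q) else f j

if-cases : ∀ {A : Set} (C : A → Set) (i q : ℕ) {a b : A} → (i ≡ q → C a) → (i ≢ q → C b) → C (if does (i ≟ q) then a else b)
if-cases C i q y n with i ≟ q
... | yes p = subst C (sym (≡⇒if p)) (y p)
... | no ¬p = subst C (sym (≢⇒if ¬p)) (n ¬p)

steps-raise : ∀ q f → 1 ≤ q → Steps f → Steps (raise q f)
steps-raise (suc p) f _ s = record
  { mono≤ = λ j → if-cases (_≤ raise (suc p) f (suc j)) j (suc p)
      (λ { refl → ≤-trans (⊔-lub (≤-trans (mono≤ s p) (mono≤ s (suc p))) (m∸n≤m (f (2 + p)) 1))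
             (≤-reflexive (sym (≢⇒if (1+n≢n {suc p})))) })
      (λ j≢ → if-cases (f j ≤_) (suc j) (suc p) (λ { refl → m≤m⊔n (f p) _ }) (λ _ → mono≤ s j))
  ; step≤ = λ j → if-cases (_≤ suc (raise (suc p) f j)) (suc j) (suc p)
      (λ { refl → ⊔-lub (≤-trans (n≤1+n (f p)) (≤-reflexive (cong suc (sym (≢⇒if (<⇒≢ (n<1+n p)))))))
             (≤-trans (∸-monoˡ-≤ 1 (≤-trans (step≤ s (suc p)) (s≤s (step≤ s p)))) (≤-reflexive (cong suc (sym (≢⇒if (<⇒≢ (n<1+n p))))))) })
      (λ _ → if-cases (λ z → f (suc j) ≤ suc z) j (suc p)
        (λ { refl → ≤-trans (lem (f (2 + p))) (s≤s (m≤n⊔m (f p) _)) }) (λ _ → step≤ s j)) }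
  where
  lem : ∀ a → a ≤ suc (a ∸ 1)
  lem zero    = z≤n
  lem (suc a) = ≤-refl

steps-remove : ∀ q f → 1 ≤ q → Steps f → Steps (remove q f)
steps-remove (suc p) f _ s = record
  { mono≤ = λ j → if-cases (_≤ remove (suc p) f (suc j)) j (suc p)
      (λ { refl → ≤-trans (m⊓n≤n (suc (f p)) (f (2 + p))) (≤-reflexive (sym (≢⇒if (1+n≢n {suc p})))) })
      (λ j≢ → if-cases (f j ≤_) (suc j) (suc p)
        (λ { refl → ⊓-glb (n≤1+n (f p)) (≤-trans (mono≤ s p) (mono≤ s (suc p))) }) (λ _ → mono≤ s j))
  ; step≤ = λ j → if-cases (_≤ suc (remove (suc p) f j)) (suc j) (suc p)
      (λ { refl → ≤-trans (m⊓n≤m (suc (f p)) _) (≤-reflexive (cong suc (sym (≢⇒if (<⇒≢ (n<1+n p)))))) })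
      (λ _ → if-cases (λ z → f (suc j) ≤ suc z) j (suc p)
        (λ { refl → ≤-trans (step≤ s (suc p)) (s≤s (⊓-glb (step≤ s p) (mono≤ s (suc p)))) }) (λ _ → step≤ s j)) }

f≤remove : ∀ q f → 1 ≤ q → Steps f → ∀ j → f j ≤ remove q f j
f≤remove (suc p) f _ s j = if-cases (f j ≤_) j (suc p)
  (λ { refl → ⊓-glb (step≤ s p) (mono≤ s (suc p)) }) (λ _ → ≤-refl)

rankL-steps : ∀ d W → All (λ x → 1 ≤ proj₂ x) W → Steps (rankL W d)
rankL-steps d []            _          = steps-min d
rankL-steps d ((m , q) ∷ W) (1≤q ∷ as) = steps-raise q (rankL W d) 1≤q (rankL-steps d W as)

rankL-≤ : ∀ d W j → rankL W d j ≤ d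
rankL-≤ d []            j = m⊓n≤m d j
rankL-≤ d ((m , q) ∷ W) j = if-cases (_≤ d) j q
  (λ _ → ⊔-lub (rankL-≤ d W (q ∸ 1)) (≤-trans (m∸n≤m _ 1) (rankL-≤ d W (suc q)))) (λ _ → rankL-≤ d W j)

-- Tableaux carried by a word

-- Cells are written (a , q), where q indexes the antidiagonal: column q + 1 - a of row a.
Cell : ℕ → (ℕ → ℕ) → ℕ → ℕ → Set
Cell d f a q = f q < a × a ≤ d × a ≤ q

-- In antidiagonal coordinates the right neighbour of (a , q) is (a , q + 1) and the cell below it
-- is (a + 1 , q + 1), so `weak` and `strict` are the row and column conditions on a tableau.
record IsFit (d : ℕ) (f : ℕ → ℕ) (W : Word) (t : ℕ → ℕ → ℕ) : Set where
  field
    cross  : ∀ a q → Cell d f a q → (t a q , q) ∈ W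
    weak   : ∀ a q → Cell d f a q → Cell d f a (suc q) → t a (suc q) ≤ t a q
    strict : ∀ a q → Cell d f a q → Cell d f (suc a) (suc q) → t a q < t (suc a) (suc q)
open IsFit

MaxFit : ℕ → (ℕ → ℕ) → Word → Set
MaxFit d f W = ∃ λ t → IsFit d f W t × (∀ t′ → IsFit d f W t′ → ∀ a q → Cell d f a q → t′ a q ≤ t a q)

infix 4 _≺_
_≺_ : ℕ × ℕ → ℕ × ℕ → Set
x ≺ y = y ≻ x

≺-row : ∀ {m q m′ q′} → (m , q) ≺ (m′ , q′) → m ≤ m′
≺-row (byRow m<m′) = <⇒≤ m<m′
≺-row (byCol _)    = ≤-refl

≺-col : ∀ {m q m′ q′} → (m , q) ≺ (m′ , q′) → q ≤ q′ → m < m′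
≺-col (byRow m<m′) _    = m<m′
≺-col (byCol q′<q) q≤q′ = contradiction q′<q (≤⇒≯ q≤q′)

fit-weaken : ∀ {d f W W′ t} → (∀ {z} → z ∈ W → z ∈ W′) → IsFit d f W t → IsFit d f W′ t
fit-weaken W⊆W′ fit = record { cross = λ a q c → W⊆W′ (cross fit a q c) ; weak = weak fit ; strict = strict fit }

module _ (d : ℕ) (f : ℕ → ℕ) (s : Steps f) (m q : ℕ) (1≤q : 1 ≤ q) where

  f⁻ : ℕ → ℕ
  f⁻ = remove q f

  cell⁻⇒cell : ∀ {a q′} → Cell d f⁻ a q′ → Cell d f a q′
  cell⁻⇒cell {q′ = q′} (f< , a≤d , a≤q) = ≤-<-trans (f≤remove q f 1≤q s q′) f< , a≤d , a≤q

  f⁻q : f⁻ q ≡ suc (f (q ∸ 1)) ⊓ f (suc q)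
  f⁻q = ≡⇒if {i = q} refl

  f⁻q≤low : f⁻ q ≤ suc (f (q ∸ 1))
  f⁻q≤low = ≤-trans (≤-reflexive f⁻q) (m⊓n≤m _ (f (suc q)))

  f⁻q≤high : f⁻ q ≤ f (suc q)
  f⁻q≤high = ≤-trans (≤-reflexive f⁻q) (m⊓n≤n (suc (f (q ∸ 1))) (f (suc q)))

  Removed : ℕ → ℕ → Set
  Removed a q′ = q′ ≡ q × a ≡ suc (f q) × a ≤ f⁻ q

  cell-view : ∀ {a q′} → Cell d f a q′ → Removed a q′ ⊎ Cell d f⁻ a q′
  cell-view {a} {q′} c@(f< , a≤d , a≤q) with q′ ≟ q
  ... | no q′≢q = inj₂ (subst (_< a) (sym (≢⇒if q′≢q)) f< , a≤d , a≤q)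
  ... | yes refl with a ≤? f⁻ q
  ...   | yes a≤ = inj₁ (refl , ≤-antisym (≤-trans (≤-trans a≤ f⁻q≤low) (s≤s (steps-pred s q))) f< , a≤)
  ...   | no  a≰ = inj₂ (≰⇒> a≰ , a≤d , a≤q)

  extend : (ℕ → ℕ → ℕ) → ℕ → ℕ → ℕ
  extend t a q′ = if does (q′ ≟ q) then (if does (a ≤? f⁻ q) then m else t a q′) else t a q′

  extend-removed : ∀ t {a q′} → Removed a q′ → extend t a q′ ≡ m
  extend-removed t {a} (refl , _ , a≤) = trans (≡⇒if {i = q} refl)
    (cong (λ b → if b then m else t a q) (dec-true (a ≤? f⁻ q) a≤))

  extend-cell⁻ : ∀ t {a q′} → Cell d f⁻ a q′ → extend t a q′ ≡ t a q′
  extend-cell⁻ t {a} {q′} (f< , _) with q′ ≟ q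
  ... | no q′≢q = ≢⇒if q′≢q
  ... | yes refl = trans (≡⇒if {i = q} refl) (cong (λ b → if b then m else t a q) (dec-false (a ≤? f⁻ q) (<⇒≱ f<)))

  module _ (W : Word) (x≺W : All ((m , q) ≺_) W) where

    fit-extend : ∀ {t} → IsFit d f⁻ W t → IsFit d f ((m , q) ∷ W) (extend t)
    fit-extend {t} fit = record { cross = cross′ ; weak = weak′ ; strict = strict′ }
      where
      cross′ : ∀ a q′ → Cell d f a q′ → (extend t a q′ , q′) ∈ (m , q) ∷ W
      cross′ a q′ c with cell-view c
      ... | inj₁ r@(refl , _) = here (cong (_, q) (extend-removed t r))
      ... | inj₂ c⁻ = there (subst (λ z → (z , q′) ∈ W) (sym (extend-cell⁻ t c⁻)) (cross fit a q′ c⁻))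
      weak′ : ∀ a q′ → Cell d f a q′ → Cell d f a (suc q′) → extend t a (suc q′) ≤ extend t a q′
      weak′ a q′ c c′ with cell-view c | cell-view c′
      -- The removed cell is a corner: `f⁻q≤high` excludes a cell to its right, and `f⁻q≤low`, in
      -- `strict′`, a cell above it.
      ... | inj₁ (refl , _ , a≤) | _ = contradiction (≤-trans a≤ f⁻q≤high) (<⇒≱ (proj₁ c′))
      ... | inj₂ c⁻ | inj₁ r = subst₂ _≤_ (sym (extend-removed t r)) (sym (extend-cell⁻ t c⁻))
              (≺-row (All.lookup x≺W (cross fit a q′ c⁻)))
      ... | inj₂ c⁻ | inj₂ c⁻′ = subst₂ _≤_ (sym (extend-cell⁻ t c⁻′)) (sym (extend-cell⁻ t c⁻)) (weak fit a q′ c⁻ c⁻′)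
      strict′ : ∀ a q′ → Cell d f a q′ → Cell d f (suc a) (suc q′) → extend t a q′ < extend t (suc a) (suc q′)
      strict′ a q′ c c′ with cell-view c | cell-view c′
      ... | _ | inj₁ (refl , _ , a≤) = contradiction (≤-pred (≤-trans a≤ f⁻q≤low)) (<⇒≱ (proj₁ c))
      ... | inj₁ r@(refl , _) | inj₂ c⁻′ = subst₂ _<_ (sym (extend-removed t r)) (sym (extend-cell⁻ t c⁻′))
              (≺-col (All.lookup x≺W (cross fit (suc a) (suc q′) c⁻′)) (n≤1+n q))
      ... | inj₂ c⁻ | inj₂ c⁻′ = subst₂ _<_ (sym (extend-cell⁻ t c⁻)) (sym (extend-cell⁻ t c⁻′)) (strict fit a q′ c⁻ c⁻′)

    ∈-row : ∀ {v q′} → (v , q′) ∈ (m , q) ∷ W → m ≤ v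
    ∈-row (here refl) = ≤-refl
    ∈-row (there v∈)    = ≺-row (All.lookup x≺W v∈)

    -- The first letter of the word can only be used by a corner of the shape.
    fit-remove : ∀ {t} → IsFit d f ((m , q) ∷ W) t → IsFit d f⁻ W t
    fit-remove {t} fit = record
      { cross  = λ a q′ c → cross′ a q′ c (cross fit a q′ (cell⁻⇒cell c))
      ; weak   = λ a q′ c c′ → weak fit a q′ (cell⁻⇒cell c) (cell⁻⇒cell c′)
      ; strict = λ a q′ c c′ → strict fit a q′ (cell⁻⇒cell c) (cell⁻⇒cell c′)
      }
      where
      -- A cell above one with value m would hold a value less than m, but m is the least row in the
      -- word.
      low : ∀ a q → Cell d f a q → t a q ≡ m → a ≤ suc (f (q ∸ 1))
      low zero    q       c                   _ = z≤n
      low (suc a) (suc q) (f< , a≤d , s≤s a≤q) e with suc a ≤? suc (f q)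
      ... | yes a≤ = a≤
      ... | no  a≰ = contradiction (∈-row (cross fit a q c)) (<⇒≱ (subst (t a q <_) e (strict fit a q c (f< , a≤d , s≤s a≤q))))
        where
        c : Cell d f a q
        c = ≤-pred (≰⇒> a≰) , <⇒≤ a≤d , a≤q
      -- A cell to the right would hold a value at most m on antidiagonal q + 1, but every letter
      -- there comes later in the word and has a larger row.
      high : ∀ a → Cell d f a q → t a q ≡ m → a ≤ f (suc q)
      high a c@(_ , a≤d , a≤q) e with a ≤? f (suc q)
      ... | yes a≤ = a≤
      ... | no  a≰ = contradiction (subst (t a (suc q) ≤_) e (weak fit a q c c′)) (<⇒≱ (later (cross fit a (suc q) c′)))
        where
        c′ : Cell d f a (suc q)
        c′ = ≰⇒> a≰ , a≤d , m≤n⇒m≤1+n a≤q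
        later : ∀ {v} → (v , suc q) ∈ (m , q) ∷ W → m < v
        later (there v∈) = ≺-col (All.lookup x≺W v∈) (n≤1+n q)
      cross′ : ∀ a q′ → Cell d f⁻ a q′ → (t a q′ , q′) ∈ (m , q) ∷ W → (t a q′ , q′) ∈ W
      cross′ a q′ c (there v∈) = v∈
      cross′ a q′ c (here e) with ,-injectiveˡ e | ,-injectiveʳ e
      ... | ta≡m | refl = contradiction (≤-trans (⊓-glb (low a q (cell⁻⇒cell c) ta≡m) (high a (cell⁻⇒cell c) ta≡m)) (≤-reflexive (sym f⁻q)))
                             (<⇒≱ (proj₁ c))

-- Removing the first letter gives a fit of `remove q f` in the rest of the word. If a rank is at
-- most `remove q f`, then raising it at q stays below f, as f(q-1) and f(q+1) - 1 are at most f(q).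
fit⇒rank : ∀ d f W {t} → Steps f → AllPairs _≺_ W → All (λ x → 1 ≤ proj₂ x) W → IsFit d f W t → ∀ j → rankL W d j ≤ f j
fit⇒rank d f [] s _ _ fit j with d ⊓ j ≤? f j
... | yes p = p
... | no ¬p with cross fit (d ⊓ j) j (≰⇒> ¬p , m⊓n≤m d j , m⊓n≤n d j)
...   | ()
fit⇒rank d f ((m , q) ∷ W) s (x≺ ∷ o) (1≤q ∷ as) fit j = if-cases (_≤ f j) j q
  (λ { refl → ⊔-lub (≤-trans (ih (q ∸ 1)) (≤-trans (≤-reflexive (remove-≢ (q∸1≢q q 1≤q))) (steps-pred s q)))
         (≤-trans (∸-monoˡ-≤ 1 (≤-trans (ih (suc q)) (≤-trans (≤-reflexive (remove-≢ 1+n≢n)) (step≤ s q)))) ≤-refl) })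
  (λ j≢q → ≤-trans (ih j) (≤-reflexive (remove-≢ j≢q)))
  where
  ih : ∀ j → rankL W d j ≤ remove q f j
  ih = fit⇒rank d (remove q f) W (steps-remove q f 1≤q s) o as (fit-remove d f s m q 1≤q W x≺ fit)
  remove-≢ : ∀ {j} → j ≢ q → remove q f j ≡ f j
  remove-≢ = ≢⇒if
  q∸1≢q : ∀ q → 1 ≤ q → q ∸ 1 ≢ q
  q∸1≢q (suc q) _ = <⇒≢ ≤-refl

fit-⊔ : ∀ {d f W W′ t t′} → IsFit d f W′ t′ → IsFit d f W t →
  (∀ a q → Cell d f a q → (t′ a q , q) ∈ W′ → (t a q , q) ∈ W → (t′ a q ⊔ t a q , q) ∈ W) →
  IsFit d f W (λ a q → t′ a q ⊔ t a q)
fit-⊔ fit′ fit both = record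
  { cross  = λ a q c → both a q c (cross fit′ a q c) (cross fit a q c)
  ; weak   = λ a q c c′ → ⊔-mono-≤ (weak fit′ a q c c′) (weak fit a q c c′)
  ; strict = λ a q c c′ → ⊔-mono-< (strict fit′ a q c c′) (strict fit a q c c′)
  }

-- The first letter has the least row in the word, so as x it can exceed no y; whenever x is the
-- strict maximum it comes from a later letter.
⊔-avoids-first : ∀ {m q W x y q′} → All ((m , q) ≺_) W → (x , q′) ∈ (m , q) ∷ W → (y , q′) ∈ W → (x ⊔ y , q′) ∈ W
⊔-avoids-first {W = W} {x} {y} {q′} x≺W x∈ y∈ with x ≤? y
... | yes x≤y = subst (λ z → (z , q′) ∈ W) (sym (m≤n⇒m⊔n≡n x≤y)) y∈
... | no  x≰y = subst (λ z → (z , q′) ∈ W) (sym (m≥n⇒m⊔n≡m (<⇒≤ (≰⇒> x≰y)))) (later x∈)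
  where
  later : (x , q′) ∈ _ ∷ W → (x , q′) ∈ W
  later (there x∈W) = x∈W
  later (here e)    = contradiction (≺-row (All.lookup x≺W y∈)) (<⇒≱ (subst (y <_) (,-injectiveˡ e) (≰⇒> x≰y)))

-- Only finitely many columns need a test, since ranks in row d are at most d.
rank≤? : ∀ N d (f : ℕ → ℕ) W → (∀ j → N ≤ j → d ≤ f j) → Dec (∀ j → rankL W d j ≤ f j)
rank≤? N d f W big with allUpTo? (λ j → rankL W d j ≤? f j) N
... | no ¬p = no λ p → ¬p (λ {j} _ → p j)
... | yes p = yes λ j → lem j (j <? N)
  where
  lem : ∀ j → Dec (j < N) → rankL W d j ≤ f j
  lem j (yes j<N) = p j<N
  lem j (no  j≮N) = ≤-trans (rankL-≤ d W j) (big j (≮⇒≥ j≮N))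

-- The maximal fit avoids the first letter of the word whenever some fit does.
rank⇒maxFit : ∀ N d f W → (∀ j → N ≤ j → d ≤ f j) → Steps f → AllPairs _≺_ W → All (λ x → 1 ≤ proj₂ x) W →
  (∀ j → rankL W d j ≤ f j) → MaxFit d f W
rank⇒maxFit N d f [] big s o as r = (λ _ _ → 0) , record { cross = λ a q c → ⊥-elim (¬cell a q c)
                                          ; weak = λ a q c _ → ⊥-elim (¬cell a q c)
                                          ; strict = λ a q c _ → ⊥-elim (¬cell a q c) } ,
                                          λ _ _ a q c → ⊥-elim (¬cell a q c)
  where
  ¬cell : ∀ a q → ¬ Cell d f a q
  ¬cell a q (f< , a≤d , a≤q) = <⇒≱ f< (≤-trans (⊓-glb a≤d a≤q) (r q))
rank⇒maxFit N d f ((m , q) ∷ W) big s (x≺ ∷ o) (1≤q ∷ as) r with rank≤? N d f W big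
-- The rest of the word suffices. Joining an arbitrary fit with the fit `t` yields one that avoids
-- the first letter and is still at least as large.
... | yes r′ with rank⇒maxFit N d f W big s o as r′
...   | t , fit , max = t , fit-weaken there fit , λ t′ fit′ a q′ c →
        ≤-trans (m≤m⊔n (t′ a q′) (t a q′)) (max _ (fit-⊔ fit′ fit (λ _ _ _ → ⊔-avoids-first x≺)) a q′ c)
rank⇒maxFit N d f ((m , q) ∷ W) big s (x≺ ∷ o) (1≤q ∷ as) r | no ¬r
  with rank⇒maxFit N d (remove q f) W (λ j N≤j → ≤-trans (big j N≤j) (f≤remove q f 1≤q s j)) (steps-remove q f 1≤q s) o as r⁻
  where
  rW = rankL-steps d W as
  r-≢ : ∀ j → j ≢ q → rankL W d j ≤ f j
  r-≢ j j≢q = ≤-trans (≤-reflexive (sym (≢⇒if j≢q))) (r j)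
  lo : ∀ q → 1 ≤ q → rankL W d q ≤ suc (rankL W d (q ∸ 1)) × q ∸ 1 ≢ q
  lo (suc q) _ = step≤ rW q , <⇒≢ ≤-refl
  -- Prepending the letter changes the rank only in column q, so `r` bounds the rank of `W` in the
  -- columns next to q, and the steps `rW` carry these bounds over to column q.
  r⁻ : ∀ j → rankL W d j ≤ remove q f j
  r⁻ j = if-cases (rankL W d j ≤_) j q
    (λ { refl → ⊓-glb (≤-trans (proj₁ (lo q 1≤q)) (s≤s (r-≢ (q ∸ 1) (proj₂ (lo q 1≤q)))))
                        (≤-trans (mono≤ rW q) (r-≢ (suc q) 1+n≢n)) }) (r-≢ j)
... | t , fit , max = extend d f s m q 1≤q t , fit-extend d f s m q 1≤q W x≺ fit , max′
  where
  max′ : ∀ t′ → IsFit d f ((m , q) ∷ W) t′ → ∀ a q′ → Cell d f a q′ → t′ a q′ ≤ extend d f s m q 1≤q t a q′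
  max′ t′ fit′ a q′ c with cell-view d f s m q 1≤q c
  ... | inj₂ c⁻ = subst (t′ a q′ ≤_) (sym (extend-cell⁻ d f s m q 1≤q t c⁻))
          (max t′ (fit-remove d f s m q 1≤q W x≺ fit′) a q′ c⁻)
  ... | inj₁ rem@(refl , a≡ , a≤) = subst (t′ a q ≤_) (sym (extend-removed d f s m q 1≤q t rem)) (used (cross fit′ a q c))
    where
    used : (t′ a q , q) ∈ (m , q) ∷ W → t′ a q ≤ m
    used (here e) = ≤-reflexive (,-injectiveˡ e)
    -- If the corner were filled by a later letter, all of `t′` would fit in `W`, and the rank of
    -- `W` would be below f.
    used (there v∈) = contradiction (fit⇒rank d f W s o as (record { cross = cross′ ; weak = weak fit′ ; strict = strict fit′ })) ¬r
      where
      cross′ : ∀ b q″ → Cell d f b q″ → (t′ b q″ , q″) ∈ W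
      cross′ b q″ c′ with cell-view d f s m q 1≤q c′
      ... | inj₂ c⁻ = cross (fit-remove d f s m q 1≤q W x≺ fit′) b q″ c⁻
      ... | inj₁ (refl , b≡ , _) = subst (λ z → (t′ z q , q) ∈ W) (trans a≡ (sym b≡)) v∈

-- Corner sums of [λ,d]_g, and the order relation read off from row d.

unique-⊆-length : ∀ {A : Set} {xs ys : List A} → Unique xs → (∀ {z} → z ∈ xs → z ∈ ys) → length xs ≤ length ys
unique-⊆-length [] _ = z≤n
unique-⊆-length {xs = x ∷ xs} (x∉ ∷ u) sub with ∈-∃++ (sub (here refl))
... | as , bs , refl = ≤-trans (s≤s (unique-⊆-length u sub′)) (≤-reflexive (trans
    (cong suc (length-++ as)) (trans (sym (+-suc (length as) (length bs))) (sym (length-++ as)))))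
  where
  sub′ : ∀ {z} → z ∈ xs → z ∈ as ++ bs
  sub′ z∈ with ∈-++⁻ as (sub (there z∈))
  ... | inj₁ z∈as = ∈-++⁺ˡ z∈as
  ... | inj₂ (here refl) = contradiction refl (All.lookup x∉ z∈)
  ... | inj₂ (there z∈bs) = ∈-++⁺ʳ as z∈bs

steps-≤ : ∀ {f i j} → Steps f → i ≤ j → f i ≤ f j
steps-≤ {f} {i} s i≤j = go (≤⇒≤′ i≤j)
  where
  go : ∀ {j} → i ≤′ j → f i ≤ f j
  go ≤′-refl     = ≤-refl
  go (≤′-step p) = ≤-trans (go p) (mono≤ s _)

steps-+ : ∀ {f} → Steps f → ∀ i k → f (i + k) ≤ f i + k
steps-+ {f} s i zero    = ≤-reflexive (trans (cong f (+-identityʳ i)) (sym (+-identityʳ (f i))))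
steps-+ {f} s i (suc k) = ≤-trans (≤-reflexive (cong f (+-suc i k)))
  (≤-trans (step≤ s (i + k)) (≤-trans (s≤s (steps-+ s i k)) (≤-reflexive (sym (+-suc (f i) k)))))

corner-steps : ∀ w j → Steps (λ i → corner w i j)
corner-steps w j = record { mono≤ = mono w ; step≤ = step w }
  where
  mono : ∀ w i → corner w i j ≤ corner w (suc i) j
  mono w       zero    = z≤n
  mono []      (suc i) = z≤n
  mono (x ∷ w) (suc i) rewrite corner-∷ x w i j | corner-∷ x w (suc i) j = +-monoʳ-≤ (bit x j) (mono w i)
  step : ∀ w i → corner w (suc i) j ≤ suc (corner w i j)
  step []      i       = z≤n
  step (x ∷ w) zero    rewrite corner-∷ x w 0 j = ≤-trans (≤-reflexive (+-identityʳ _)) (bit≤1 x j)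
  step (x ∷ w) (suc i) rewrite corner-∷ x w i j | corner-∷ x w (suc i) j =
    ≤-trans (+-monoʳ-≤ (bit x j) (step w i)) (≤-reflexive (+-suc (bit x j) _))

corner-≤-row : ∀ w i j → corner w i j ≤ i
corner-≤-row w i j = ≤-trans (length-filter (λ y → y ≤? j) (take i w)) (≤-trans (≤-reflexive (length-take i w)) (m⊓n≤m i (length w)))

cnt-take-≤ : ∀ w i j → cnt (take i w) j ≤ cnt w j
cnt-take-≤ w       zero    j = z≤n
cnt-take-≤ []      (suc i) j = z≤n
cnt-take-≤ (x ∷ w) (suc i) j rewrite cnt-∷ x (take i w) j | cnt-∷ x w j = +-monoʳ-≤ (bit x j) (cnt-take-≤ w i j)

cnt-range1 : ∀ n j → cnt (range1 n) j ≡ n ⊓ j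
cnt-range1 n j = trans (cong (λ w → cnt w j) (sym (take-all n (range1 n) (≤-reflexive (length-range1 n))))) (corner-range1 n n j ≤-refl)

corner-≤-col : ∀ {n w} → IsPerm n w → ∀ i j → corner w i j ≤ j
corner-≤-col {n} {w} p i j = ≤-trans (cnt-take-≤ w i j) (≤-trans (≤-reflexive (trans (cnt-↭ j p) (cnt-range1 n j))) (m⊓n≤n n j))

module Increasing (g : ℕ → ℕ) (g-inc : ∀ k → g k < g (suc k)) where

  private
    g-≤ : ∀ {g : ℕ → ℕ} → (∀ k → g k < g (suc k)) → ∀ k → g 0 ≤ g k
    g-≤ inc zero    = ≤-refl
    g-≤ inc (suc k) = ≤-trans (g-≤ inc k) (<⇒≤ (inc k))

    ≤-cnt′ : ∀ g → (∀ k → g k < g (suc k)) → ∀ d k j → k < d → g k ≤ j → k < cnt (applyUpTo g d) j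
    ≤-cnt′ g inc (suc d) k j k<d gk≤j rewrite cnt-∷ (g 0) (applyUpTo (g ∘ suc) d) j
      | bit-≤ (≤-trans (g-≤ inc k) gk≤j) with k | k<d
    ... | zero  | _       = s≤s z≤n
    ... | suc k | s≤s k<d = s≤s (≤-cnt′ (g ∘ suc) (inc ∘ suc) d k j k<d gk≤j)

    cnt-≤′ : ∀ g → (∀ k → g k < g (suc k)) → ∀ d k j → j < g k → cnt (applyUpTo g d) j ≤ k
    cnt-≤′ g inc zero    k       j _    = z≤n
    cnt-≤′ g inc (suc d) zero    j j<g0 rewrite cnt-∷ (g 0) (applyUpTo (g ∘ suc) d) j | bit-> j<g0 =
      cnt-≤′ (g ∘ suc) (inc ∘ suc) d zero j (<-trans j<g0 (inc 0))
    cnt-≤′ g inc (suc d) (suc k) j j<gk rewrite cnt-∷ (g 0) (applyUpTo (g ∘ suc) d) j =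
      +-mono-≤ (bit≤1 (g 0) j) (cnt-≤′ (g ∘ suc) (inc ∘ suc) d k j j<gk)

  ≤-cnt : ∀ d k j → k < d → cnt (applyUpTo g d) j ≤ k → j < g k
  ≤-cnt d k j k<d c≤k with j <? g k
  ... | yes p = p
  ... | no ¬p = contradiction (≤-cnt′ g g-inc d k j k<d (≮⇒≥ ¬p)) (≤⇒≯ c≤k)

  cnt-≤ : ∀ d k j → j < g k → cnt (applyUpTo g d) j ≤ k
  cnt-≤ = cnt-≤′ g g-inc

  cnt-≤d : ∀ d j → cnt (applyUpTo g d) j ≤ d
  cnt-≤d d j = ≤-trans (length-filter (λ y → y ≤? j) (applyUpTo g d)) (≤-reflexive (length-applyUpTo g d))

  cnt-steps : ∀ d → Steps (cnt (applyUpTo g d))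
  cnt-steps d = record { mono≤ = mono ; step≤ = step }
    where
    mono : ∀ j → cnt (applyUpTo g d) j ≤ cnt (applyUpTo g d) (suc j)
    mono j with cnt (applyUpTo g d) (suc j) <? d
    ... | no ≮d  = ≤-trans (cnt-≤d d j) (≮⇒≥ ≮d)
    ... | yes <d = cnt-≤ d _ j (<-trans (n<1+n j) (≤-cnt d _ (suc j) <d ≤-refl))
    step : ∀ j → cnt (applyUpTo g d) (suc j) ≤ suc (cnt (applyUpTo g d) j)
    step j with cnt (applyUpTo g d) j <? d
    ... | no ≮d  = ≤-trans (cnt-≤d d (suc j)) (m≤n⇒m≤1+n (≮⇒≥ ≮d))
    ... | yes <d = cnt-≤ d _ (suc j) (≤-trans (s≤s (≤-cnt d _ j <d ≤-refl)) (g-inc _))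

  -- In an increasing sequence the terms that are at most j come first.
  cnt-prefix : ∀ d i j → i ⊓ cnt (applyUpTo g d) j ≤ cnt (applyUpTo g i) j
  cnt-prefix d i j with cnt (applyUpTo g i) j <? i
  ... | no ≮i  = ≤-trans (m⊓n≤m i _) (≮⇒≥ ≮i)
  ... | yes <i = ≤-trans (m⊓n≤n i _) (cnt-≤ d _ j (≤-cnt i _ j <i ≤-refl))

cnt-take-sorted : ∀ {w} → AllPairs _≤_ w → ∀ k j → k ⊓ cnt w j ≤ cnt (take k w) j
cnt-take-sorted {[]}    _         k       j = ≤-trans (≤-reflexive (⊓-zeroʳ k)) z≤n
cnt-take-sorted {x ∷ w} _         zero    j = z≤n
cnt-take-sorted {x ∷ w} (x≤ ∷ s) (suc k) j rewrite cnt-∷ x w j | cnt-∷ x (take k w) j with x ≤? j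
... | yes x≤j rewrite bit-≤ x≤j = s≤s (cnt-take-sorted s k j)
... | no  x≰j rewrite bit-> (≰⇒> x≰j) | cong length (filter-none (λ y → y ≤? j) (All.map (λ x≤y → <⇒≱ (<-≤-trans (≰⇒> x≰j) x≤y)) x≤)) = z≤n

cnt-split : ∀ {R : ℕ → Set} (R? : ∀ x → Dec (R x)) w j →
  cnt w j ≡ cnt (filter R? w) j + cnt (filter (λ x → ¬? (R? x)) w) j
cnt-split R? []      j = refl
cnt-split R? (x ∷ w) j rewrite cnt-∷ x w j with R? x
... | yes _ rewrite cnt-∷ x (filter R? w) j | cnt-split R? w j = sym (+-assoc (bit x j) _ _)
... | no  _ rewrite cnt-∷ x (filter (λ x → ¬? (R? x)) w) j | cnt-split R? w j =
  x∙yz≈y∙xz (bit x j) (cnt (filter R? w) j) (cnt (filter (λ x → ¬? (R? x)) w) j)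

nthD-antitone : ∀ {λs} → Linked (λ a b → b ≤ a) λs → ∀ i → nthD 0 λs (suc i) ≤ nthD 0 λs i
nthD-antitone []         i       = z≤n
nthD-antitone [-]        i       = z≤n
nthD-antitone (p ∷ ps)   zero    = p
nthD-antitone (p ∷ ps)   (suc i) = nthD-antitone ps i

nthD-≤ : ∀ {λs i j} → Linked (λ a b → b ≤ a) λs → i ≤ j → nthD 0 λs j ≤ nthD 0 λs i
nthD-≤ {λs} {i} l i≤j = go (≤⇒≤′ i≤j)
  where
  go : ∀ {j} → i ≤′ j → nthD 0 λs j ≤ nthD 0 λs i
  go ≤′-refl     = ≤-refl
  go (≤′-step p) = ≤-trans (nthD-antitone l _) (go p)

part-+1 : ∀ λs i → part λs (i + 1) ≡ nthD 0 λs i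
part-+1 λs i = cong (part λs) (+-comm i 1)

firstValues : List ℕ → ℕ → List ℕ
firstValues λs d = map (λ k → part λs (d ∸ k + 1) + k) (range1 d)

-- The corner sums in row d of [λ,d]_g; its first d values are value 0 < value 1 < ⋯ .
shape : List ℕ → ℕ → ℕ → ℕ
shape λs d = cnt (firstValues λs d)

Admissible : ℕ → List ℕ × ℕ → Set
Admissible n p = IsPartition (proj₁ p) × 1 ≤ proj₂ p × length (proj₁ p) ≤ proj₂ p × part (proj₁ p) 1 + proj₂ p ≤ n

Shape : List ℕ → ℕ → ℕ → ℕ → Set
Shape λs d = Cell d (shape λs d)

FitShape : List ℕ → ℕ → Word → (ℕ → ℕ → ℕ) → Set
FitShape λs d = IsFit d (shape λs d)

module Grass (n : ℕ) (λs : List ℕ) (d : ℕ) (adm : Admissible n (λs , d)) where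

  private
    linked : Linked (λ a b → b ≤ a) λs
    linked = proj₂ (proj₁ adm)

  rowLength : ℕ → ℕ
  rowLength k = part λs (d ∸ suc k + 1)

  value : ℕ → ℕ
  value k = rowLength k + suc k

  rowLength-mono : ∀ k → rowLength k ≤ rowLength (suc k)
  rowLength-mono k = subst₂ _≤_ (sym (part-+1 λs (d ∸ suc k))) (sym (part-+1 λs (d ∸ suc (suc k))))
    (nthD-≤ linked (∸-monoʳ-≤ d (n≤1+n (suc k))))

  value-inc : ∀ k → value k < value (suc k)
  value-inc k = +-mono-≤-< (rowLength-mono k) (n<1+n (suc k))

  open Increasing value value-inc

  d≤n : d ≤ n
  d≤n = ≤-trans (m≤n+m d _) (proj₂ (proj₂ (proj₂ adm)))

  first≡ : firstValues λs d ≡ applyUpTo value d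
  first≡ = map-range1 (λ k → part λs (d ∸ k + 1) + k) d

  shape≡ : ∀ j → shape λs d j ≡ cnt (applyUpTo value d) j
  shape≡ j = cong (λ w → cnt w j) first≡

  shape-steps : Steps (shape λs d)
  shape-steps = subst (λ w → Steps (cnt w)) (sym first≡) (cnt-steps d)

  value-≤ : ∀ k → k < d → value k ≤ n
  value-≤ k k<d = ≤-trans (+-mono-≤ (≤-trans (≤-reflexive (part-+1 λs (d ∸ suc k))) (nthD-≤ linked z≤n)) k<d) (proj₂ (proj₂ (proj₂ adm)))

  shape-big : ∀ j → n ≤ j → d ≤ shape λs d j
  shape-big j n≤j with shape λs d j <? d
  ... | no  ≮d = ≮⇒≥ ≮d
  ... | yes <d = contradiction (≤-cnt d _ j <d (≤-reflexive (sym (shape≡ j)))) (≤⇒≯ (≤-trans (value-≤ _ <d) n≤j))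

  -- Row k + 1 and column c + 1 meet on the antidiagonal k + c + 1, which is less than `value k`
  -- because c < `rowLength k`; hence at most k of the first values are counted there.
  cell⁺ : ∀ k c → k < d → c < rowLength k → Shape λs d (suc k) (suc (k + c))
  cell⁺ k c k<d c< = s≤s (≤-trans (≤-reflexive (shape≡ _)) (cnt-≤ d k (suc (k + c))
      (≤-trans (≤-reflexive (cong suc (trans (cong suc (+-comm k c)) (sym (+-suc c k))))) (+-monoˡ-≤ (suc k) c<)))) ,
    k<d , s≤s (m≤m+n k c)

  cell⁻ : ∀ a q → Shape λs d a q → ∃ λ k → ∃ λ c → a ≡ suc k × q ≡ suc (k + c) × k < d × c < rowLength k
  cell⁻ (suc k) (suc q) (s≤s f≤ , k<d , s≤s k≤q) = k , q ∸ k , refl , cong suc (sym (m+[n∸m]≡n k≤q)) , k<d ,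
    +-cancelʳ-≤ (suc k) (suc (q ∸ k)) (rowLength k) (≤-trans
      (≤-reflexive (cong suc (trans (+-suc (q ∸ k) k) (cong suc (m∸n+n≡m k≤q)))))
      (≤-cnt d k (suc q) k<d (≤-trans (≤-reflexive (sym (shape≡ (suc q)))) f≤)))
  cell⁻ (suc k) zero (_ , _ , ())

  rest : List ℕ
  rest = filter (λ x → ¬? (x ∈? firstValues λs d)) (range1 n)

  length-first : length (firstValues λs d) ≡ d
  length-first = trans (cong length first≡) (length-applyUpTo value d)

  corner-grass-low : ∀ i j → i ≤ d → corner (grass λs d n) i j ≡ cnt (applyUpTo value i) j
  corner-grass-low i j i≤d = cong (λ w → cnt w j) (trans (cong (λ v → take i (v ++ rest)) first≡) (go i d value i≤d))
    where
    go : ∀ i d (g : ℕ → ℕ) → i ≤ d → take i (applyUpTo g d ++ rest) ≡ applyUpTo g i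
    go zero    d       g _       = refl
    go (suc i) (suc d) g (s≤s l) = cong (g 0 ∷_) (go i d (g ∘ suc) l)

  corner-grass-high : ∀ k j → corner (grass λs d n) (d + k) j ≡ shape λs d j + cnt (take k rest) j
  corner-grass-high k j = trans (cong (λ w → cnt w j) (subst (λ z → take (z + k) (firstValues λs d ++ rest) ≡ firstValues λs d ++ take k rest)
      length-first (go (firstValues λs d)))) (cnt-++ (firstValues λs d) (take k rest) j)
    where
    go : ∀ (w : List ℕ) → take (length w + k) (w ++ rest) ≡ w ++ take k rest
    go []      = refl
    go (x ∷ w) = cong (x ∷_) (go w)

  corner-grass-row : ∀ j → corner (grass λs d n) d j ≡ shape λs d j
  corner-grass-row j = trans (corner-grass-low d j ≤-refl) (sym (shape≡ j))

  j≤first+rest : ∀ j → j ≤ n → j ≤ shape λs d j + cnt rest j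
  j≤first+rest j j≤n = ≤-trans (≤-reflexive (sym (trans (cnt-range1 n j) (m≥n⇒m⊓n≡n j≤n))))
    (≤-trans (≤-reflexive (cnt-split (_∈? firstValues λs d) (range1 n) j)) (+-monoˡ-≤ (cnt rest j)
      (unique-⊆-length (Unique.filter⁺ _ (Unique.filter⁺ _ (range1-unique n)))
        (λ z∈ → let (z∈′ , z≤j) = ∈-filter⁻ (λ y → y ≤? j) z∈ ; (_ , z∈″) = ∈-filter⁻ (_∈? firstValues λs d) {xs = range1 n} z∈′ in
          ∈-filter⁺ (λ y → y ≤? j) z∈″ z≤j))))

  -- Both halves of the one-line notation of [λ,d]_g increase, so its corner sums are determined by row d.
  grass-≤ : ∀ {w} → IsPerm n w → (∀ j → corner w d j ≤ shape λs d j) →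
    ∀ i j → j ≤ n → corner w i j ≤ corner (grass λs d n) i j
  grass-≤ {w} p r i j j≤n with ≤-total i d
  ... | inj₁ i≤d = ≤-trans (⊓-glb (corner-≤-row w i j) (≤-trans (steps-≤ (corner-steps w j) i≤d) (≤-trans (r j) (≤-reflexive (shape≡ j)))))
      (≤-trans (cnt-prefix d i j) (≤-reflexive (sym (corner-grass-low i j i≤d))))
  ... | inj₂ d≤i = subst (λ z → corner w z j ≤ corner (grass λs d n) z j) (m+[n∸m]≡n d≤i) (high (i ∸ d))
    where
    -- Beyond row d the corner sum is at most `shape` + k, by unit steps, and at most j, hence at
    -- most `shape` plus the smaller of k and the count of the remaining values. The sorted tail of
    -- [λ,d]_g attains this.
    high : ∀ k → corner w (d + k) j ≤ corner (grass λs d n) (d + k) j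
    high k = ≤-trans (⊓-glb (≤-trans (steps-+ (corner-steps w j) d k) (+-monoˡ-≤ k (r j)))
                            (≤-trans (corner-≤-col p (d + k) j) (j≤first+rest j j≤n)))
      (≤-trans (≤-reflexive (sym (+-distribˡ-⊓ (shape λs d j) k (cnt rest j))))
      (≤-trans (+-monoʳ-≤ (shape λs d j) (cnt-take-sorted (AllPairs.filter⁺ _ (range1-sorted n)) k j))
        (≤-reflexive (sym (corner-grass-high k j)))))

Dominates : List ℕ → List ℕ × ℕ → Set
Dominates w (λs , d) = ∀ j → corner w d j ≤ shape λs d j

dominates⇒GeA : ∀ {n w} D → IsPerm n w → All (Admissible n) D → All (Dominates w) D → GeA n D w
dominates⇒GeA {n} {w} []             p _        _        i j _ i≤n _ j≤n = ⊓-glb (corner-≤-row w i j) (corner-≤-col p i j)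
dominates⇒GeA {n} {w} ((λs , d) ∷ D) p (a ∷ as) (r ∷ rs) i j 1≤i i≤n 1≤j j≤n =
  ⊓-glb (Grass.grass-≤ n λs d a p r i j j≤n) (dominates⇒GeA D p as rs i j 1≤i i≤n 1≤j j≤n)

corner-col0 : ∀ {n w} → IsPerm n w → ∀ i → corner w i 0 ≡ 0
corner-col0 p i = n≤0⇒n≡0 (corner-≤-col p i 0)

GeA⇒dominates : ∀ {n w} D → IsPerm n w → All (Admissible n) D → GeA n D w → All (Dominates w) D
GeA⇒dominates {n} {w} D p as ge = All.tabulate λ x∈ j → lem x∈ j
  where
  rA-≤ : ∀ D′ {x} → x ∈ D′ → ∀ i j → rA n D′ i j ≤ corner (grass (proj₁ x) (proj₂ x) n) i j
  rA-≤ ((λs , d) ∷ D′) (here refl) i j = m⊓n≤m _ (rA n D′ i j)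
  rA-≤ ((λs , d) ∷ D′) (there x∈)    i j = ≤-trans (m⊓n≤n _ (rA n D′ i j)) (rA-≤ D′ x∈ i j)
  lem : ∀ {λs d} → (λs , d) ∈ D → ∀ j → corner w d j ≤ shape λs d j
  -- `GeA` only speaks of columns 1 to n. Column 0 is zero, and beyond column n the shape has
  -- reached its full height d.
  lem {λs} {d} x∈ j with j ≤? n | j ≟ 0
  ... | _ | yes refl = ≤-trans (≤-reflexive (corner-col0 p d)) z≤n
  ... | no j≰n | no _ = ≤-trans (corner-≤-row w d j) (Grass.shape-big n λs d (All.lookup as x∈) j (<⇒≤ (≰⇒> j≰n)))
  ... | yes j≤n | no j≢0 = ≤-trans (ge d j (proj₁ (proj₂ (All.lookup as x∈))) (Grass.d≤n n λs d (All.lookup as x∈)) (n≢0⇒n>0 j≢0) j≤n)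
      (≤-trans (rA-≤ D x∈ d j) (≤-reflexive (Grass.corner-grass-row n λs d (All.lookup as x∈) j)))

reverse-AllPairs : ∀ {A : Set} {R : A → A → Set} {xs : List A} → AllPairs R xs → AllPairs (λ x y → R y x) (reverse xs)
reverse-AllPairs []                      = []
reverse-AllPairs {R = R} {x ∷ xs} (r ∷ rs) = subst (AllPairs (λ x y → R y x)) (sym (unfold-reverse x xs))
  (AllPairs.++⁺ (reverse-AllPairs rs) ([] ∷ []) (All.tabulate (λ z∈ → All.lookup r (Any.reverse⁻ z∈) ∷ [])))

module Pipes (n : ℕ) {P : Word} (P∈ : P ∈ subs (staircase n)) where

  crosses : All (Cross n) P
  crosses = All-resp-⊆ (subs⇒⊆ P∈) (staircase-cross n)

  private
    ordered : AllPairs _≺_ (reverse P)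
    ordered = reverse-AllPairs (AllPairs-resp-⊆ (subs⇒⊆ P∈) (rows-ordered n n))

    positive : All (λ x → 1 ≤ proj₂ x) (reverse P)
    positive = All.tabulate (λ z∈ → 1≤cross (All.lookup crosses (Any.reverse⁻ z∈)))

    corner-rankL : ∀ d j → d ≤ n → corner (dem n P) d j ≡ rankL (reverse P) d j
    corner-rankL d j d≤n = trans (corner-dem n P crosses d j d≤n)
      (trans (cong (λ P → rankR P d j) (sym (reverse-involutive P))) (sym (rankL≗rankR (reverse P) positive d j)))

  -- The word is reversed because `rankL` starts from the first row of the pipe dream, whereas P
  -- starts from the last.
  fit⇒dominates : ∀ {λs d t} → Admissible n (λs , d) → FitShape λs d P t → Dominates (dem n P) (λs , d)
  fit⇒dominates {λs} {d} adm fit j = ≤-trans (≤-reflexive (corner-rankL d j (Grass.d≤n n λs d adm)))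
    (fit⇒rank d (shape λs d) (reverse P) (Grass.shape-steps n λs d adm) ordered positive (fit-weaken Any.reverse⁺ fit) j)

  dominates⇒maxFit : ∀ {λs d} → Admissible n (λs , d) → Dominates (dem n P) (λs , d) → MaxFit d (shape λs d) P
  dominates⇒maxFit {λs} {d} adm dom with rank⇒maxFit n d (shape λs d) (reverse P) (Grass.shape-big n λs d adm)
      (Grass.shape-steps n λs d adm) ordered positive
      (λ j → ≤-trans (≤-reflexive (sym (corner-rankL d j (Grass.d≤n n λs d adm)))) (dom j))
  ... | t , fit , max = t , fit-weaken Any.reverse⁻ fit , λ t′ fit′ → max t′ (fit-weaken Any.reverse⁺ fit′)

-- Bruhat comparable permutations with the wrong inequality of lengths are equal.

bit-injective : ∀ {x y N} → x ≤ N → y ≤ N → (∀ j → j ≤ N → bit x j ≡ bit y j) → x ≡ y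
bit-injective {x} {y} x≤N y≤N p = ≤-antisym (lem x y (p y y≤N)) (lem y x (sym (p x x≤N)))
  where
  lem : ∀ x y → bit x y ≡ bit y y → x ≤ y
  lem x y e with x ≤? y
  ... | yes p = p
  ... | no ¬p = contradiction (trans (sym (bit-> (≰⇒> ¬p))) (trans e (bit-≤ {y} ≤-refl))) λ ()

corner-injective : ∀ {N} v w → length v ≡ length w → All (_≤ N) v → All (_≤ N) w →
  (∀ i j → i ≤ length v → j ≤ N → corner v i j ≡ corner w i j) → v ≡ w
corner-injective []      []      _ _ _ _ = refl
corner-injective {N} (x ∷ v) (y ∷ w) l (x≤ ∷ v≤) (y≤ ∷ w≤) p with bit-injective x≤ y≤ heads
  where
  heads : ∀ j → j ≤ N → bit x j ≡ bit y j
  heads j j≤ = trans (trans (sym (+-identityʳ _)) (sym (corner-∷ x v 0 j)))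
    (trans (p 1 j (s≤s z≤n) j≤) (trans (corner-∷ y w 0 j) (+-identityʳ _)))
... | refl = cong (x ∷_) (corner-injective v w (suc-injective l) v≤ w≤ (λ i j i≤ j≤ →
    +-cancelˡ-≡ (bit x j) _ _ (trans (sym (corner-∷ x v i j)) (trans (p (suc i) j (s≤s i≤) j≤) (corner-∷ x w i j)))))

perm-≤ : ∀ {n w} → IsPerm n w → All (_≤ n) w
perm-≤ {n} p = All-resp-↭ (↭-sym p) (All.map⁺ (All.applyUpTo⁺₁ id n id))

-- Induct along a reduced word of w, replacing (w , v) by (w s_q , min (v , v s_q)).
bruhat-rigid : ∀ n P w v → All (Cross n) P → red n P w ≡ true → IsPerm n w → IsPerm n v →
  (∀ i j → i ≤ n → j ≤ n → corner w i j ≤ corner v i j) → inv w ≤ inv v → v ≡ w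
bruhat-rigid n [] w v _ r pw pv c _ = corner-injective v w (trans (perm-length pv) (sym (perm-length pw))) (perm-≤ pv) (perm-≤ pw)
  λ i j i≤ j≤ → ≤-antisym
    (≤-trans (⊓-glb (corner-≤-row v i j) (corner-≤-col pv i j)) (≤-reflexive
      (sym (trans (cong (λ z → corner z i j) (red-id n w r)) (corner-range1 n i j (≤-trans i≤ (≤-reflexive (perm-length pv))))))))
    (c i j (≤-trans i≤ (≤-reflexive (perm-length pv))) j≤)
bruhat-rigid n ((m , q) ∷ P) w v (cr ∷ cs) r pw pv c l with ∧-true⁻¹ {desc q w} r
... | dw , r′ = fin (desc q v) refl
  where
  w′ : List ℕ
  w′ = swapAt q w
  w′≡ : dn q w ≡ w′
  w′≡ = desc⇒dn q w dw
  -- Monotonicity of `dn q`, from its corner sum formula.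
  c′ : ∀ i j → i ≤ n → j ≤ n → corner w′ i j ≤ corner (dn q v) i j
  c′ i j i≤ j≤ = subst (λ z → corner z i j ≤ corner (dn q v) i j) w′≡ (lem (i ≟ q))
    where
    lem : Dec (i ≡ q) → corner (dn q w) i j ≤ corner (dn q v) i j
    lem (no i≢q) = ≤-trans (≤-reflexive (corner-dn-≢ q w i j i≢q))
      (≤-trans (c i j i≤ j≤) (≤-reflexive (sym (corner-dn-≢ q v i j i≢q))))
    lem (yes refl) = ≤-trans (≤-reflexive (corner-dn q w (1≤cross cr) (<length w pw cr) j))
      (≤-trans (⊓-mono-≤ (s≤s (c (q ∸ 1) j (≤-trans (m∸n≤m q 1) i≤) j≤)) (c (suc q) j (proj₂ (proj₂ cr)) j≤))
        (≤-reflexive (sym (corner-dn q v (1≤cross cr) (<length v pv cr) j))))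
  ih : inv w′ ≤ inv (dn q v) → dn q v ≡ w′
  ih = bruhat-rigid n P w′ (dn q v) cs r′ (↭-trans (swapAt-↭ q w) pw) (↭-trans (dn-↭ q v) pv) c′
  fin : ∀ b → desc q v ≡ b → v ≡ w
  fin true dv = trans (sym (swapAt-involutive q v))
    (trans (cong (swapAt q) (trans (sym (desc⇒dn q v dv)) (ih (subst (λ z → inv w′ ≤ inv z) (sym (desc⇒dn q v dv))
      (≤-pred (subst₂ _≤_ (inv-desc q w dw) (inv-desc q v dv) l)))))) (swapAt-involutive q w))
  -- Without a descent at q, v is unchanged by `dn`, and the induction would give v = w s_q, which
  -- has too few inversions.
  fin false dv = contradiction (trans (sym (cong inv (asc⇒dn q v dv))) (cong inv (ih w′≤))) (>⇒≢ w′<)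
    where
    w′< : inv w′ < inv v
    w′< = ≤-trans (≤-reflexive (sym (inv-desc q w dw))) l
    w′≤ : inv w′ ≤ inv (dn q v)
    w′≤ = subst (λ z → inv w′ ≤ inv z) (sym (asc⇒dn q v dv)) (<⇒≤ w′<)

-- Fillings and prism tableaux

nth?-< : ∀ {A : Set} (xs : List A) i → i < length xs → ∃ λ x → nth? xs i ≡ just x
nth?-< (x ∷ xs) zero    _       = x , refl
nth?-< (x ∷ xs) (suc i) (s≤s l) = nth?-< xs i l

nth?-just : ∀ {A : Set} (xs : List A) i {x} → nth? xs i ≡ just x → i < length xs
nth?-just (x ∷ xs) zero    _ = s≤s z≤n
nth?-just (x ∷ xs) (suc i) p = s≤s (nth?-just xs i p)

nth?-nthD : ∀ {A : Set} z (xs : List A) i {x} → nth? xs i ≡ just x → nthD z xs i ≡ x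
nth?-nthD z (x ∷ xs) zero    refl = refl
nth?-nthD z (x ∷ xs) (suc i) p      = nth?-nthD z xs i p

nth?-applyUpTo : ∀ {A : Set} (f : ℕ → A) n i → i < n → nth? (applyUpTo f n) i ≡ just (f i)
nth?-applyUpTo f (suc n) zero    _       = refl
nth?-applyUpTo f (suc n) (suc i) (s≤s l) = nth?-applyUpTo (f ∘ suc) n i l

nth?-ext : ∀ {A : Set} (xs ys : List A) → length xs ≡ length ys → (∀ i {x} → nth? xs i ≡ just x → nth? ys i ≡ just x) → xs ≡ ys
nth?-ext []       []       _ _ = refl
nth?-ext (x ∷ xs) (y ∷ ys) l p with p 0 refl
... | refl = cong (x ∷_) (nth?-ext xs ys (suc-injective l) (λ i → p (suc i)))

nth?-modifyAt-≡ : ∀ {A : Set} i (f : A → A) xs {x} → nth? xs i ≡ just x → nth? (modifyAt i f xs) i ≡ just (f x)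
nth?-modifyAt-≡ zero    f (x ∷ xs) refl = refl
nth?-modifyAt-≡ (suc i) f (x ∷ xs) p      = nth?-modifyAt-≡ i f xs p

nth?-modifyAt-≢ : ∀ {A : Set} i j (f : A → A) xs → j ≢ i → nth? (modifyAt i f xs) j ≡ nth? xs j
nth?-modifyAt-≢ zero    j       f []       _   = refl
nth?-modifyAt-≢ (suc i) j       f []       _   = refl
nth?-modifyAt-≢ zero    zero    f (x ∷ xs) 0≢0 = contradiction refl 0≢0
nth?-modifyAt-≢ zero    (suc j) f (x ∷ xs) _   = refl
nth?-modifyAt-≢ (suc i) zero    f (x ∷ xs) _   = refl
nth?-modifyAt-≢ (suc i) (suc j) f (x ∷ xs) j≢i = nth?-modifyAt-≢ i j f xs (j≢i ∘ cong suc)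

length-modifyAt : ∀ {A : Set} i (f : A → A) xs → length (modifyAt i f xs) ≡ length xs
length-modifyAt zero    f []       = refl
length-modifyAt (suc i) f []       = refl
length-modifyAt zero    f (x ∷ xs) = refl
length-modifyAt (suc i) f (x ∷ xs) = cong suc (length-modifyAt i f xs)

ent-just : ∀ F k c {row v} → nth? F k ≡ just row → nth? row c ≡ just v → ent F (suc k) (suc c) ≡ just v
ent-just F k c p q rewrite p = q

ent-view : ∀ F a b {v} → ent F a b ≡ just v →
  ∃ λ k → ∃ λ c → ∃ λ row → a ≡ suc k × b ≡ suc c × nth? F k ≡ just row × nth? row c ≡ just v
ent-view F (suc k) (suc c) p with nth? F k in eq
... | just row = k , c , row , refl , refl , eq , p

entC-just : ∀ T i {F a b v} → nth? T i ≡ just F → ent F a b ≡ just v → entC T (suc i) a b ≡ just v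
entC-just T i p q rewrite p = q

entC-view : ∀ T c a b {v} → entC T c a b ≡ just v → ∃ λ i → ∃ λ F → c ≡ suc i × nth? T i ≡ just F × ent F a b ≡ just v
entC-view T (suc i) a b p with nth? T i in eq
... | just F = i , F , refl , eq , p

∈-indexedFrom⁺ : ∀ {A : Set} k (xs : List A) j {x} → nth? xs j ≡ just x → (k + j , x) ∈ indexedFrom k xs
∈-indexedFrom⁺ k (x ∷ xs) zero    refl rewrite +-identityʳ k = here refl
∈-indexedFrom⁺ k (x ∷ xs) (suc j) p rewrite +-suc k j = there (∈-indexedFrom⁺ (suc k) xs j p)

∈-indexedFrom⁻ : ∀ {A : Set} k (xs : List A) {i x} → (i , x) ∈ indexedFrom k xs → ∃ λ j → i ≡ k + j × nth? xs j ≡ just x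
∈-indexedFrom⁻ k (x ∷ xs) (here refl) = 0 , sym (+-identityʳ k) , refl
∈-indexedFrom⁻ k (x ∷ xs) (there p) with ∈-indexedFrom⁻ (suc k) xs p
... | j , refl , q = suc j , sym (+-suc k j) , q

rowCells : ℕ → ℕ × List ℕ → List (ℕ × ℕ × ℕ × ℕ)
rowCells c (a , row) = map (λ (b , v) → (c , a , b , v)) (indexed row)

colorCells : ℕ × Filling → List (ℕ × ℕ × ℕ × ℕ)
colorCells (c , F) = concatMap (rowCells c) (indexed F)

∈-cells⁺ : ∀ T {c a b v} → entC T c a b ≡ just v → (c , a , b , v) ∈ cells T
∈-cells⁺ T {c} {a} {b} p with entC-view T c a b p
... | i , F , refl , pT , q with ent-view F a b q
...   | k , c′ , row , refl , refl , pF , r =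
  ∈-concatMap⁺ colorCells (lose (∈-indexedFrom⁺ 1 T i pT)
    (∈-concatMap⁺ (rowCells c) (lose (∈-indexedFrom⁺ 1 F k pF) (∈-map⁺ _ (∈-indexedFrom⁺ 1 row c′ r)))))

∈-cells⁻ : ∀ T {c a b v} → (c , a , b , v) ∈ cells T → entC T c a b ≡ just v
∈-cells⁻ T z∈ with find (∈-concatMap⁻ colorCells {xs = indexed T} z∈)
... | (c , F) , F∈ , z∈F with find (∈-concatMap⁻ (rowCells c) {xs = indexed F} z∈F)
...   | (a , row) , row∈ , z∈row with ∈-map⁻ _ z∈row
...     | (b , v) , v∈ , refl with ∈-indexedFrom⁻ 1 T F∈ | ∈-indexedFrom⁻ 1 F row∈ | ∈-indexedFrom⁻ 1 row v∈
...       | i , refl , p | k , refl , q | c′ , refl , r = entC-just T i p (ent-just F k c′ q r)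

crossesOf : PrismTab → Word
crossesOf T = map (λ (c , a , b , v) → (v , a + b ∸ 1)) (cells T)

∈-crosses⁺ : ∀ T c a b {v} → entC T c a b ≡ just v → (v , a + b ∸ 1) ∈ crossesOf T
∈-crosses⁺ T c a b p = ∈-map⁺ _ (∈-cells⁺ T {c} {a} {b} p)

∈-crosses⁻ : ∀ T {v q} → (v , q) ∈ crossesOf T → ∃ λ c → ∃ λ a → ∃ λ b → entC T c a b ≡ just v × q ≡ a + b ∸ 1
∈-crosses⁻ T z∈ with ∈-map⁻ _ z∈
... | (c , a , b , v) , z∈′ , refl = c , a , b , ∈-cells⁻ T z∈′ , refl

-- An entry in antidiagonal coordinates. For a valid filling the default 0 occurs only outside the
-- shape.
val : Filling → ℕ → ℕ → ℕ
val F a q = fromMaybe 0 (ent F a (suc q ∸ a))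

val-ent : ∀ F k c {v} → ent F (suc k) (suc c) ≡ just v → val F (suc k) (suc (k + c)) ≡ v
val-ent F k c p = cong (fromMaybe 0) (trans (cong (ent F (suc k)) (trans (cong (_∸ k) (sym (+-suc k c))) (m+n∸m≡n k (suc c)))) p)

module Tableau (n : ℕ) (λs : List ℕ) (d : ℕ) (adm : Admissible n (λs , d)) where
  open Grass n λs d adm public

  module Valid {F : Filling} (valid : ValidFilling (λs , d) F) where

    private
      rowOf : ∀ k {row} → nth? F k ≡ just row → length row ≡ rowLength k
      rowOf k {row} p = trans (cong length (sym (nth?-nthD [] F k p)))
        (proj₁ (proj₂ valid) (suc k) (s≤s z≤n) (≤-trans (nth?-just F k p) (≤-reflexive (proj₁ valid))))

    entry : ∀ k c → k < d → c < rowLength k → ∃ λ v → ent F (suc k) (suc c) ≡ just v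
    entry k c k<d c< with nth?-< F k (subst (k <_) (sym (proj₁ valid)) k<d)
    ... | row , p with nth?-< row c (subst (c <_) (sym (rowOf k p)) c<)
    ...   | v , q = v , ent-just F k c p q

    entry⁻ : ∀ a b {v} → ent F a b ≡ just v → ∃ λ k → ∃ λ c → a ≡ suc k × b ≡ suc c × k < d × c < rowLength k
    entry⁻ a b p with ent-view F a b p
    ... | k , c , row , a≡ , b≡ , q , r = k , c , a≡ , b≡ , subst (k <_) (proj₁ valid) (nth?-just F k q) ,
      subst (c <_) (rowOf k q) (nth?-just row c r)

    bounds : ∀ a b {v} → ent F a b ≡ just v → 1 ≤ v × v ≤ d
    bounds a b = proj₁ (proj₂ (proj₂ valid)) a b _

    row-decr : ∀ a b {v v′} → ent F a b ≡ just v → ent F a (suc b) ≡ just v′ → v′ ≤ v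
    row-decr a b = proj₁ (proj₂ (proj₂ (proj₂ valid))) a b _ _

    col-incr : ∀ a b {v v′} → ent F a b ≡ just v → ent F (suc a) b ≡ just v′ → v < v′
    col-incr a b = proj₂ (proj₂ (proj₂ (proj₂ valid))) a b _ _

    -- Rows get no shorter downwards, so the column continues to row d, where entries are at most d,
    -- and strictness loses at least one per row on the way back up. Here g counts the rows below.
    -- The bound keeps the crossing of an entry inside the staircase.
    entry-≤ : ∀ g k c {v} → suc k + g ≡ d → ent F (suc k) (suc c) ≡ just v → v ≤ suc k
    entry-≤ zero    k c e p = ≤-trans (proj₂ (bounds (suc k) (suc c) p)) (≤-reflexive (trans (sym e) (+-identityʳ (suc k))))
    entry-≤ (suc g) k c e p with entry⁻ (suc k) (suc c) p
    ... | _ , _ , refl , refl , k<d , c< with entry (suc k) c (m+n≤o⇒m≤o (2 + k) (≤-reflexive e′)) (≤-trans c< (rowLength-mono k))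
      where
      e′ : suc (suc k) + g ≡ d
      e′ = trans (cong suc (sym (+-suc k g))) e
    ...   | v′ , p′ = ≤-pred (≤-trans (col-incr (suc k) (suc c) p p′) (entry-≤ g (suc k) c (trans (cong suc (sym (+-suc k g))) e) p′))

    entry-cross : ∀ a b {v} → ent F a b ≡ just v → Cross n (v , a + b ∸ 1)
    entry-cross a b p with entry⁻ a b p
    ... | k , c , refl , refl , k<d , c< = proj₁ (bounds (suc k) (suc c) p) ,
      ≤-trans (entry-≤ (d ∸ suc k) k c (m+[n∸m]≡n k<d) p) (≤-trans (s≤s (m≤m+n k c)) (≤-reflexive (sym (+-suc k c)))) ,
      ≤-trans (≤-reflexive (cong suc (+-comm k (suc c)))) (≤-trans (≤-reflexive (sym (+-suc (suc c) k)))
        (≤-trans (+-monoˡ-≤ (suc k) c<) (value-≤ k k<d)))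

    isFit : ∀ {W} → (∀ a b {v} → ent F a b ≡ just v → (v , a + b ∸ 1) ∈ W) → FitShape λs d W (val F)
    isFit {W} sub = record { cross = cross′ ; weak = weak′ ; strict = strict′ }
      where
      cross′ : ∀ a q → Shape λs d a q → (val F a q , q) ∈ W
      cross′ a q cell with cell⁻ a q cell
      ... | k , c , refl , refl , k<d , c< with entry k c k<d c<
      ...   | v , p = subst₂ (λ v q → (v , q) ∈ W) (sym (val-ent F k c p)) (+-suc k c) (sub (suc k) (suc c) p)
      weak′ : ∀ a q → Shape λs d a q → Shape λs d a (suc q) → val F a (suc q) ≤ val F a q
      weak′ a q cell cell′ with cell⁻ a q cell
      ... | k , c , refl , refl , k<d , c< with cell⁻ a (suc q) cell′
      ...   | k , c′ , refl , e , _ , c′< with +-cancelˡ-≡ k c′ (suc c) (trans (sym (suc-injective e)) (sym (+-suc k c)))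
      ...     | refl with entry k c k<d c< | entry k (suc c) k<d c′<
      ...       | v , p | v′ , p′ = subst₂ _≤_
                  (sym (trans (cong (λ z → val F (suc k) (suc z)) (sym (+-suc k c))) (val-ent F k (suc c) p′)))
                  (sym (val-ent F k c p)) (row-decr (suc k) (suc c) p p′)
      strict′ : ∀ a q → Shape λs d a q → Shape λs d (suc a) (suc q) → val F a q < val F (suc a) (suc q)
      strict′ a q cell cell′ with cell⁻ a q cell
      ... | k , c , refl , refl , k<d , c< with cell⁻ (suc a) (suc q) cell′
      ...   | _ , c′ , refl , e , k′<d , c′< with +-cancelˡ-≡ (suc k) c′ c (sym (suc-injective e))
      ...     | refl with entry k c k<d c< | entry (suc k) c k′<d c′<
      ...       | v , p | v′ , p′ = subst₂ _<_ (sym (val-ent F k c p)) (sym (val-ent F (suc k) c p′)) (col-incr (suc k) (suc c) p p′)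

  build : (ℕ → ℕ → ℕ) → Filling
  build t = applyUpTo (λ k → applyUpTo (λ c → t (suc k) (suc (k + c))) (rowLength k)) d

  build-ent : ∀ t k c → k < d → c < rowLength k → ent (build t) (suc k) (suc c) ≡ just (t (suc k) (suc (k + c)))
  build-ent t k c k<d c< = ent-just (build t) k c (nth?-applyUpTo _ d k k<d) (nth?-applyUpTo _ (rowLength k) c c<)

  build-ent⁻ : ∀ t a b {v} → ent (build t) a b ≡ just v →
    ∃ λ k → ∃ λ c → a ≡ suc k × b ≡ suc c × k < d × c < rowLength k × v ≡ t (suc k) (suc (k + c))
  build-ent⁻ t a b p with ent-view (build t) a b p
  ... | k , c , row , refl , refl , q , r with subst (k <_) (length-applyUpTo _ d) (nth?-just (build t) k q)
  ...   | k<d with just-injective (trans (sym q) (nth?-applyUpTo _ d k k<d))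

  ...     | refl with subst (c <_) (length-applyUpTo _ (rowLength k)) (nth?-just row c r)
  ...       | c< = k , c , refl , refl , k<d , c< , just-injective (trans (sym r) (nth?-applyUpTo _ (rowLength k) c c<))

  -- In the first column the antidiagonal index is the row index, which bounds a crossing of the
  -- staircase; along a row the values only decrease.
  fit-≤ : ∀ {W t} → All (Cross n) W → FitShape λs d W t → ∀ k c → k < d → c < rowLength k → t (suc k) (suc (k + c)) ≤ suc k
  fit-≤ {t = t} cs fit k zero    k<d c< = ≤-trans (proj₁ (proj₂ (All.lookup cs (cross fit (suc k) (suc (k + 0)) (cell⁺ k 0 k<d c<)))))
    (≤-reflexive (cong suc (+-identityʳ k)))
  fit-≤ {t = t} cs fit k (suc c) k<d c< = ≤-trans (≤-trans (≤-reflexive (cong (λ z → t (suc k) (suc z)) (+-suc k c)))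
    (weak fit (suc k) (suc (k + c)) (cell⁺ k c k<d (<⇒≤ c<)) (subst (λ z → Shape λs d (suc k) (suc z)) (+-suc k c) (cell⁺ k (suc c) k<d c<))))
    (fit-≤ cs fit k c k<d (<⇒≤ c<))

  fit-valid : ∀ {W t F} → All (Cross n) W → FitShape λs d W t → length F ≡ d →
    (∀ a → 1 ≤ a → a ≤ d → length (nthD [] F (a ∸ 1)) ≡ part λs (d ∸ a + 1)) →
    (∀ a b {v} → ent F a b ≡ just v →
      ∃ λ k → ∃ λ c → a ≡ suc k × b ≡ suc c × k < d × c < rowLength k × v ≡ t (suc k) (suc (k + c))) →
    ValidFilling (λs , d) F
  fit-valid {W} {t} {F} cs fit len rowLens view = len , rowLens , bounds , rows′ , cols
    where
    bounds : ∀ a b v → ent F a b ≡ just v → 1 ≤ v × v ≤ d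
    bounds a b v p with view a b p
    ... | k , c , refl , refl , k<d , c< , refl =
      proj₁ (All.lookup cs (cross fit _ _ (cell⁺ k c k<d c<))) , ≤-trans (fit-≤ cs fit k c k<d c<) k<d
    rows′ : ∀ a b v v′ → ent F a b ≡ just v → ent F a (suc b) ≡ just v′ → v′ ≤ v
    rows′ a b v v′ p p′ with view a b p | view a (suc b) p′
    ... | k , c , refl , refl , k<d , c< , refl | _ , _ , refl , refl , _ , c′< , refl =
      subst (λ z → t (suc k) (suc z) ≤ t (suc k) (suc (k + c))) (sym (+-suc k c))
        (weak fit _ _ (cell⁺ k c k<d c<) (subst (λ z → Shape λs d (suc k) (suc z)) (+-suc k c) (cell⁺ k (suc c) k<d c′<)))
    cols : ∀ a b v v′ → ent F a b ≡ just v → ent F (suc a) b ≡ just v′ → v < v′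
    cols a b v v′ p p′ with view a b p | view (suc a) b p′
    ... | k , c , refl , refl , k<d , c< , refl | _ , _ , refl , refl , k′<d , c′< , refl =
      strict fit _ _ (cell⁺ k c k<d c<) (cell⁺ (suc k) c k′<d c′<)

  build-valid : ∀ {W t} → All (Cross n) W → FitShape λs d W t → ValidFilling (λs , d) (build t)
  build-valid {W} {t} cs fit = fit-valid cs fit (length-applyUpTo _ d) rowLens (build-ent⁻ t)
    where
    rowLens : ∀ a → 1 ≤ a → a ≤ d → length (nthD [] (build t) (a ∸ 1)) ≡ part λs (d ∸ a + 1)
    rowLens (suc k) _ k<d = trans (cong length (nth?-nthD [] (build t) k (nth?-applyUpTo _ d k k<d))) (length-applyUpTo _ (rowLength k))

  filling-ext : ∀ {F F′} → ValidFilling (λs , d) F → ValidFilling (λs , d) F′ →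
    (∀ k c → k < d → c < rowLength k → ∀ {v} → ent F (suc k) (suc c) ≡ just v → ent F′ (suc k) (suc c) ≡ just v) → F ≡ F′
  filling-ext {F} {F′} V V′ p = nth?-ext F F′ (trans (proj₁ V) (sym (proj₁ V′))) rowEq
    where
    rowLen : ∀ {F} (V : ValidFilling (λs , d) F) k {row} → nth? F k ≡ just row → k < d × length row ≡ rowLength k
    rowLen {F} V k q = k<d , trans (cong length (sym (nth?-nthD [] F k q))) (proj₁ (proj₂ V) (suc k) (s≤s z≤n) k<d)
      where
      k<d : k < d
      k<d = subst (k <_) (proj₁ V) (nth?-just F k q)
    rowEq : ∀ k {row} → nth? F k ≡ just row → nth? F′ k ≡ just row
    rowEq k {row} q with nth?-< F′ k (subst (k <_) (sym (proj₁ V′)) (proj₁ (rowLen V k q)))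
    ... | row′ , q′ = trans q′ (cong just (sym (nth?-ext row row′ (trans (proj₂ (rowLen V k q)) (sym (proj₂ (rowLen V′ k q′)))) λ c r →
        let c< = subst (c <_) (proj₂ (rowLen V k q)) (nth?-just row c r) in
        back c (p k c (proj₁ (rowLen V k q)) c< (ent-just F k c q r)))))
      where
      back : ∀ c {v} → ent F′ (suc k) (suc c) ≡ just v → nth? row′ c ≡ just v
      back c e rewrite q′ = e

pointwise-nth?ʳ : ∀ {A B : Set} {R : A → B → Set} {xs ys} → Pointwise R xs ys → ∀ i {y} → nth? ys i ≡ just y →
  ∃ λ x → nth? xs i ≡ just x × R x y
pointwise-nth?ʳ (r ∷ rs) zero    refl = _ , refl , r
pointwise-nth?ʳ (r ∷ rs) (suc i) p      = pointwise-nth?ʳ rs i p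

pointwise-modifyAt : ∀ {A B : Set} {R : A → B → Set} {xs ys} → Pointwise R xs ys → ∀ i f {x y} →
  nth? xs i ≡ just x → nth? ys i ≡ just y → R x (f y) → Pointwise R xs (modifyAt i f ys)
pointwise-modifyAt (r ∷ rs) zero    f refl refl r′ = r′ ∷ rs
pointwise-modifyAt (r ∷ rs) (suc i) f p      q      r′ = r ∷ pointwise-modifyAt rs i f p q r′

pointwise-tabulate : ∀ {A B : Set} {R R′ : A → B → Set} {xs ys} → Pointwise R xs ys →
  (∀ i {x y} → nth? xs i ≡ just x → nth? ys i ≡ just y → R x y → R′ x y) → Pointwise R′ xs ys
pointwise-tabulate []       f = []
pointwise-tabulate (r ∷ rs) f = f 0 refl refl r ∷ pointwise-tabulate rs (λ i → f (suc i))

all-nth? : ∀ {A : Set} {R : A → Set} {xs} → All R xs → ∀ i {x} → nth? xs i ≡ just x → R x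
all-nth? (r ∷ rs) zero    refl = r
all-nth? (r ∷ rs) (suc i) p      = all-nth? rs i p

pointwise⇒all : ∀ {A B : Set} {R : A → B → Set} {Q : A → Set} {xs ys} → Pointwise R xs ys →
  (∀ i {x y} → nth? xs i ≡ just x → nth? ys i ≡ just y → R x y → Q x) → All Q xs
pointwise⇒all []       f = []
pointwise⇒all (r ∷ rs) f = f 0 refl refl r ∷ pointwise⇒all rs (λ i → f (suc i))

support : ℕ → PrismTab → Word
support n T = filter (_∈×? crossesOf T) (staircase n)

support-subs : ∀ n T → support n T ∈ subs (staircase n)
support-subs n T = filter∈subs (_∈×? crossesOf T) (staircase n)

support-unique : ∀ n T → Unique (support n T)
support-unique n T = Unique.filter⁺ (_∈×? crossesOf T) (staircase-unique n)

∈-support⁻ : ∀ n T {z} → z ∈ support n T → z ∈ crossesOf T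
∈-support⁻ n T z∈ = proj₂ (∈-filter⁻ (_∈×? crossesOf T) {xs = staircase n} z∈)

sum-bump : ∀ f g n k → k < n → g k ≡ suc (f k) → (∀ j → j ≢ k → g j ≡ f j) → sum (applyUpTo g n) ≡ suc (sum (applyUpTo f n))
sum-bump f g (suc n) zero    _       e h = cong₂ _+_ e (cong sum (applyUpTo-cong n (λ j → h (suc j) λ ())))
  where
  applyUpTo-cong : ∀ n {f g : ℕ → ℕ} → (∀ j → f j ≡ g j) → applyUpTo f n ≡ applyUpTo g n
  applyUpTo-cong zero    p = refl
  applyUpTo-cong (suc n) p = cong₂ _∷_ (p 0) (applyUpTo-cong n (λ j → p (suc j)))
sum-bump f g (suc n) (suc k) (s≤s l) e h = trans (cong₂ _+_ (h 0 λ ())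
  (sum-bump (f ∘ suc) (g ∘ suc) n k l e (λ j j≢k → h (suc j) (j≢k ∘ suc-injective)))) (+-suc (f 0) _)

sum-weight : ∀ n P → All (Cross n) P → sum (weight n P) ≡ length P
sum-weight n [] [] = zeros (range1 n)
  where
  zeros : ∀ (xs : List ℕ) → sum (map (λ _ → 0) xs) ≡ 0
  zeros []       = refl
  zeros (x ∷ xs) = zeros xs
sum-weight n ((suc m , q) ∷ P) ((_ , m≤q , q<n) ∷ cs) = trans (cong sum (map-range1 _ n))
  (trans (sum-bump (λ k → rowCount (suc k) P) _ n m (≤-trans m≤q (<⇒≤ q<n)) (rowCount-≡ (suc m) q P)
    (λ j j≢m → rowCount-≢ (suc m) (suc j) q P (j≢m ∘ sym ∘ suc-injective)))
  (cong suc (trans (cong sum (sym (map-range1 _ n))) (sum-weight n P cs))))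

-- Both lists are turned into lists of pairs, one by adding the tag m, the other by the shift from q
-- to q + 1. They are free of duplicates and contain each other.
antidiagonals : ∀ L m P → Unique P → (∀ {s} → s ∈ L → ∃ λ q → s ≡ suc q × (m , q) ∈ P) →
  (∀ {q} → (m , q) ∈ P → suc q ∈ L) → length (deduplicate _≟_ L) ≡ rowCount m P
antidiagonals L m P u f g = ≤-antisym
  (subst₂ _≤_ (length-map tag (deduplicate _≟_ L)) (length-map shift inRow) (unique-⊆-length uA A⊆B))
  (subst₂ _≤_ (length-map shift inRow) (length-map tag (deduplicate _≟_ L)) (unique-⊆-length uB B⊆A))
  where
  tag : ℕ → ℕ × ℕ
  tag s = (m , s)
  shift : ℕ × ℕ → ℕ × ℕ
  shift (m′ , q) = (m′ , suc q)
  inRow : Word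
  inRow = filter (λ x → proj₁ x ≟ m) P
  uA : Unique (map tag (deduplicate _≟_ L))
  uA = Unique.map⁺ (λ { refl → refl }) (deduplicate-! L)
  uB : Unique (map shift inRow)
  uB = Unique.map⁺ (λ { refl → refl }) (Unique.filter⁺ _ u)
  A⊆B : ∀ {z} → z ∈ map tag (deduplicate _≟_ L) → z ∈ map shift inRow
  A⊆B z∈ with ∈-map⁻ tag z∈
  ... | s , s∈ , refl with f (∈-deduplicate⁻ _≟_ L s∈)
  ...   | q , refl , q∈ = ∈-map⁺ shift (∈-filter⁺ (λ x → proj₁ x ≟ m) q∈ refl)
  B⊆A : ∀ {z} → z ∈ map shift inRow → z ∈ map tag (deduplicate _≟_ L)
  B⊆A z∈ with ∈-map⁻ shift z∈
  ... | (m′ , q) , x∈ , refl with ∈-filter⁻ (λ x → proj₁ x ≟ m) {xs = P} x∈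
  ...   | q∈ , refl = ∈-map⁺ tag (∈-deduplicate⁺ _≟_ (g q∈))

-- Supports of prism tableaux, and the greatest tableau carried by a word.

module PrismTableau (n : ℕ) (D : Data) (adm : All (Admissible n) D) where

  module _ {T : PrismTab} (pt : IsPT D T) where

    color : ∀ i {F} → nth? T i ≡ just F → ∃ λ λs → ∃ λ d → Admissible n (λs , d) × nth? D i ≡ just (λs , d) × ValidFilling (λs , d) F
    color i p with pointwise-nth?ʳ pt i p
    ... | (λs , d) , q , valid = λs , d , all-nth? adm i q , q , valid

    entC-cross : ∀ c a b {v} → entC T c a b ≡ just v → Cross n (v , a + b ∸ 1) × suc (a + b ∸ 1) ≡ a + b
    entC-cross c a b p with entC-view T c a b p
    ... | i , F , refl , q , r with color i q
    ...   | λs , d , ad , _ , valid with Tableau.Valid.entry⁻ n λs d ad valid a b r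
    ...     | k , _ , refl , _ = Tableau.Valid.entry-cross n λs d ad valid a b r , refl

    ∈-support⁺ : ∀ {z} → z ∈ crossesOf T → z ∈ support n T
    ∈-support⁺ {v , q} z∈ with ∈-crosses⁻ T z∈
    ... | c , a , b , p , refl = ∈-filter⁺ (_∈×? crossesOf T) (staircase-∈ n v q (proj₁ (entC-cross c a b p))) z∈

    wtExp≡weight : wtExp n T ≡ weight n (support n T)
    wtExp≡weight = map-cong-local (All.universal {P = λ m → _ ≡ rowCount m (support n T)} count (range1 n))
      where
      recast : ∀ {L : List ℕ} {s s′} → s ≡ s′ → s′ ∈ L → s ∈ L
      recast refl s∈ = s∈
      count : ∀ m → _
      count m = antidiagonals _ m (support n T) (support-unique n T)
        (λ s∈ → let (x , x∈ , s≡) = ∈-map⁻ _ s∈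
                    (x∈′ , v≡m) = ∈-filter⁻ _ {xs = cells T} x∈
                    (c , a , b , v) = x
                    p = ∈-cells⁻ T {c} {a} {b} {v} x∈′ in
          a + b ∸ 1 , trans s≡ (sym (proj₂ (entC-cross c a b p))) ,
          subst (λ z → (z , a + b ∸ 1) ∈ support n T) v≡m (∈-support⁺ (∈-crosses⁺ T c a b p)))
        (λ {q} q∈ → let (c , a , b , p , q≡) = ∈-crosses⁻ T (∈-support⁻ n T q∈) in
          recast (trans (cong suc q≡) (proj₂ (entC-cross c a b p)))
            (∈-map⁺ _ (∈-filter⁺ _ (∈-cells⁺ T {c} {a} {b} p) refl)))

    totalDeg≡length : totalDeg n T ≡ length (support n T)
    totalDeg≡length = trans (cong sum wtExp≡weight)
      (sum-weight n (support n T) (Pipes.crosses n (support-subs n T)))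

    color-fit : ∀ {W} → (∀ {z} → z ∈ crossesOf T → z ∈ W) → ∀ i {λs d F} → Admissible n (λs , d) →
      nth? T i ≡ just F → ValidFilling (λs , d) F → FitShape λs d W (val F)
    color-fit sub i {λs} {d} {F} ad q valid = Tableau.Valid.isFit n λs d ad valid
      (λ a b p → sub (∈-crosses⁺ T (suc i) a b (entC-just T i {F} {a} {b} q p)))

    support-dominates : All (Dominates (dem n (support n T))) D
    support-dominates = pointwise⇒all pt λ i {x} p q valid →
      Pipes.fit⇒dominates n (support-subs n T) (all-nth? adm i p)
        (color-fit ∈-support⁺ i (all-nth? adm i p) q valid)

    support-GeA : GeA n D (dem n (support n T))
    support-GeA = dominates⇒GeA D (dem-perm n (support n T)) adm support-dominates

  -- Maximality is required against fits, not fillings, so that a join of fits can be compared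
  -- without building a tableau from it.
  MaxColor : Word → List ℕ × ℕ → Filling → Set
  MaxColor P (λs , d) F = ValidFilling (λs , d) F
    × (∀ a b {v} → ent F a b ≡ just v → (v , a + b ∸ 1) ∈ P)
    × (∀ t → FitShape λs d P t → ∀ a q → Shape λs d a q → t a q ≤ val F a q)

  MaxTableau : Word → PrismTab → Set
  MaxTableau P = Pointwise (MaxColor P) D

  max-exists : ∀ {P} → P ∈ subs (staircase n) → All (Dominates (dem n P)) D → ∃ (MaxTableau P)
  max-exists {P} P∈ dom = go D adm dom
    where
    go : ∀ D → All (Admissible n) D → All (Dominates (dem n P)) D → ∃ (Pointwise (MaxColor P) D)
    go [] [] [] = [] , []
    go ((λs , d) ∷ D) (ad ∷ as) (r ∷ rs) with go D as rs | Pipes.dominates⇒maxFit n P∈ ad r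
    ... | T , pts | t , fit , max = build t ∷ T , (build-valid (Pipes.crosses n P∈) fit , inP , maximal) ∷ pts
      where
      open Tableau n λs d ad
      inP : ∀ a b {v} → ent (build t) a b ≡ just v → (v , a + b ∸ 1) ∈ P
      inP a b p with build-ent⁻ t a b p
      ... | k , c , refl , refl , k<d , c< , refl =
        subst (λ z → (t (suc k) (suc (k + c)) , z) ∈ P) (sym (+-suc k c)) (cross fit _ _ (cell⁺ k c k<d c<))
      maximal : ∀ t′ → FitShape λs d P t′ → ∀ a q → Shape λs d a q → t′ a q ≤ val (build t) a q
      maximal t′ fit′ a q cell with cell⁻ a q cell
      ... | k , c , refl , refl , k<d , c< =
        subst (t′ (suc k) (suc (k + c)) ≤_) (sym (val-ent (build t) k c (build-ent t k c k<d c<))) (max t′ fit′ _ _ cell)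

  max-IsPT : ∀ {P T} → MaxTableau P T → IsPT D T
  max-IsPT mt = pointwise-tabulate mt (λ _ _ _ → proj₁)

  max-crosses : ∀ {P T} → MaxTableau P T → ∀ {z} → z ∈ crossesOf T → z ∈ P
  max-crosses {P} {T} mt z∈ with ∈-crosses⁻ T z∈
  ... | c , a , b , p , refl with entC-view T c a b p
  ...   | i , F , refl , q , r with pointwise-nth?ʳ mt i q
  ...     | _ , _ , (_ , inP , _) = inP a b r

  max-unique : ∀ {P T T′} → MaxTableau P T → MaxTableau P T′ → T ≡ T′
  max-unique {P} = go adm
    where
    go : ∀ {D T T′} → All (Admissible n) D → Pointwise (MaxColor P) D T → Pointwise (MaxColor P) D T′ → T ≡ T′
    go [] [] [] = refl
    go {(λs , d) ∷ D} {F ∷ T} {F′ ∷ T′} (ad ∷ as) ((V , inP , mx) ∷ ms) ((V′ , inP′ , mx′) ∷ ms′) =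
      cong₂ _∷_ (filling-ext V V′ same) (go as ms ms′)
      where
      open Tableau n λs d ad
      same : ∀ k c → k < d → c < rowLength k → ∀ {v} → ent F (suc k) (suc c) ≡ just v → ent F′ (suc k) (suc c) ≡ just v
      same k c k<d c< {v} p with Valid.entry V′ k c k<d c<
      ... | v′ , p′ = trans p′ (cong just (≤-antisym
        (subst₂ _≤_ (val-ent F′ k c p′) (val-ent F k c p) (mx (val F′) (Valid.isFit V′ inP′) _ _ (cell⁺ k c k<d c<)))
        (subst₂ _≤_ (val-ent F k c p) (val-ent F′ k c p′) (mx′ (val F) (Valid.isFit V inP) _ _ (cell⁺ k c k<d c<)))))

-- Changing one entry: unstable triples and maximality.

nth?-modifyAt⁻ : ∀ {A : Set} i j (f : A → A) xs {y} → nth? (modifyAt i f xs) j ≡ just y →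
  (j ≡ i × ∃ λ x → nth? xs i ≡ just x × y ≡ f x) ⊎ (j ≢ i × nth? xs j ≡ just y)
nth?-modifyAt⁻ i j f xs p with j ≟ i
... | no j≢i = inj₂ (j≢i , trans (sym (nth?-modifyAt-≢ i j f xs j≢i)) p)
... | yes refl with nth?-< xs i (subst (i <_) (length-modifyAt i f xs) (nth?-just (modifyAt i f xs) i p))
...   | x , q = inj₁ (refl , x , q , just-injective (trans (sym p) (nth?-modifyAt-≡ i f xs q)))

setCell : ℕ → ℕ → ℕ → Filling → Filling
setCell k c v = modifyAt k (modifyAt c (λ _ → v))

ent-setCell-≡ : ∀ k c v F {u} → ent F (suc k) (suc c) ≡ just u → ent (setCell k c v F) (suc k) (suc c) ≡ just v
ent-setCell-≡ k c v F p with ent-view F (suc k) (suc c) p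
... | _ , _ , row , refl , refl , q , r = ent-just (setCell k c v F) k c (nth?-modifyAt-≡ k _ F q) (nth?-modifyAt-≡ c _ row r)

ent-setCell⁻ : ∀ k c v F a b {u} → ent (setCell k c v F) a b ≡ just u →
  (a ≡ suc k × b ≡ suc c × u ≡ v) ⊎ (ent F a b ≡ just u × ¬ (a ≡ suc k × b ≡ suc c))
ent-setCell⁻ k c v F a b p with ent-view (setCell k c v F) a b p
... | k′ , c′ , row′ , refl , refl , q , r with nth?-modifyAt⁻ k k′ _ F q
...   | inj₂ (k′≢k , q′) = inj₂ (ent-just F k′ c′ q′ r , λ (e , _) → k′≢k (suc-injective e))
...   | inj₁ (refl , row , q′ , refl) with nth?-modifyAt⁻ c c′ _ row r
...     | inj₁ (refl , _ , _ , refl) = inj₁ (refl , refl , refl)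
...     | inj₂ (c′≢c , r′) = inj₂ (ent-just F k c′ q′ r′ , λ (_ , e) → c′≢c (suc-injective e))

entC-update⁻ : ∀ T i k c v c′ a b {u} → entC (update T (suc i) (suc k) (suc c) v) c′ a b ≡ just u →
  (c′ ≡ suc i × a ≡ suc k × b ≡ suc c × u ≡ v) ⊎ (entC T c′ a b ≡ just u × ¬ (c′ ≡ suc i × a ≡ suc k × b ≡ suc c))
entC-update⁻ T i k c v c′ a b p with entC-view (update T (suc i) (suc k) (suc c) v) c′ a b p
... | i′ , F′ , refl , q , r with nth?-modifyAt⁻ i i′ (setCell k c v) T q
...   | inj₂ (i′≢i , q′) = inj₂ (entC-just T i′ {F′} {a} {b} q′ r , λ (e , _) → i′≢i (suc-injective e))
...   | inj₁ (refl , F , q′ , refl) with ent-setCell⁻ k c v F a b r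
...     | inj₁ (a≡ , b≡ , u≡) = inj₁ (refl , a≡ , b≡ , u≡)
...     | inj₂ (r′ , ≢) = inj₂ (entC-just T i {F} {a} {b} q′ r′ , λ (_ , e) → ≢ e)

length-nthD-modifyAt : ∀ i (f : List ℕ → List ℕ) → (∀ xs → length (f xs) ≡ length xs) → ∀ F j →
  length (nthD [] (modifyAt i f F) j) ≡ length (nthD [] F j)
length-nthD-modifyAt zero    f e []      j       = refl
length-nthD-modifyAt (suc i) f e []      j       = refl
length-nthD-modifyAt zero    f e (x ∷ F) zero    = e x
length-nthD-modifyAt zero    f e (x ∷ F) (suc j) = refl
length-nthD-modifyAt (suc i) f e (x ∷ F) zero    = refl
length-nthD-modifyAt (suc i) f e (x ∷ F) (suc j) = length-nthD-modifyAt i f e F j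

⊔-∈ : ∀ {W : Word} x y {q} → (x , q) ∈ W → (y , q) ∈ W → (x ⊔ y , q) ∈ W
⊔-∈ {W} x y p p′ with ⊔-sel x y
... | inj₁ e = subst (λ z → (z , _) ∈ W) (sym e) p
... | inj₂ e = subst (λ z → (z , _) ∈ W) (sym e) p′

-- The cell (a + 1 , q + 1) lies below (a , q) and to the right of (a + 1 , q), so its value
-- separates the two. Consequently a color uses a value at most once on each antidiagonal.
antidiagonal-strict : ∀ {d f W t} → Steps f → IsFit d f W t → ∀ a q g → Cell d f a q → Cell d f (suc a + g) q →
  t a q < t (suc a + g) q
antidiagonal-strict {d} {f} {W} {t} s fit a q zero    c c′ = subst (λ z → t a q < t (suc z) q) (sym (+-identityʳ a)) (next (subst (λ z → Cell d f (suc z) q) (+-identityʳ a) c′))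
  where
  next : Cell d f (suc a) q → t a q < t (suc a) q
  next c₁@(f< , a≤d , a≤q) = <-≤-trans (strict fit a q c c₂) (weak fit (suc a) q c₁ c₂)
    where
    c₂ : Cell d f (suc a) (suc q)
    c₂ = ≤-trans (s≤s (step≤ s q)) (s≤s (proj₁ c)) , a≤d , m≤n⇒m≤1+n a≤q
antidiagonal-strict {d} {f} {W} {t} s fit a q (suc g) c c′@(_ , a′≤d , a′≤q) = <-trans
  (antidiagonal-strict s fit a q g c c₁)
  (subst (λ y → t (suc a + g) q < t y q) e
    (antidiagonal-strict s fit (suc a + g) q zero c₁ (subst (λ z → Cell d f z q) (sym e) c′)) )
  where
  e : suc (suc a + g) + 0 ≡ suc a + suc g
  e = trans (+-identityʳ _) (cong suc (sym (+-suc a g)))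
  c₁ : Cell d f (suc a + g) q
  c₁ = ≤-trans (proj₁ c) (m≤n⇒m≤1+n (m≤m+n a g)) , ≤-trans (+-monoʳ-≤ (suc a) (n≤1+n g)) a′≤d , ≤-trans (+-monoʳ-≤ (suc a) (n≤1+n g)) a′≤q

antidiagonal-injective : ∀ {d f W t} → Steps f → IsFit d f W t → ∀ a a′ q → Cell d f a q → Cell d f a′ q →
  t a q ≡ t a′ q → a ≡ a′
antidiagonal-injective {d} {f} {W} {t} s fit a a′ q c c′ e with <-cmp a a′
... | tri≈ _ a≡a′ _ = a≡a′
... | tri< a<a′ _ _ = contradiction e (<⇒≢ (subst (λ z → t a q < t z q) (m+[n∸m]≡n a<a′)
        (antidiagonal-strict s fit a q (a′ ∸ suc a) c (subst (λ z → Cell d f z q) (sym (m+[n∸m]≡n a<a′)) c′))))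
... | tri> _ _ a′<a = contradiction (sym e) (<⇒≢ (subst (λ z → t a′ q < t z q) (m+[n∸m]≡n a′<a)
        (antidiagonal-strict s fit a′ q (a ∸ suc a′) c′ (subst (λ z → Cell d f z q) (sym (m+[n∸m]≡n a′<a)) c))))

module Stability (n : ℕ) (D : Data) (adm : All (Admissible n) D) where
  open PrismTableau n D adm

  -- The value l′ already occurs on the antidiagonal, so the modified color still fits in P, which
  -- contradicts the maximality of the entry l.
  max-stable : ∀ {P T} → MaxTableau P T → ¬ HasUnstable D T
  max-stable {P} {T} mt (c , a , b , d′ , a′ , b′ , e , a″ , b″ , l , l′ , p , _ , _ , _ , p″ , s , l<l′ , pt′)
    with entC-view T c a b p
  ... | i , F , refl , qT , pF with pointwise-nth?ʳ mt i qT
  ...   | (λs , d) , qD , (V , inP , mx) with Tableau.Valid.entry⁻ n λs d (all-nth? adm i qD) V a b pF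
  ...     | k , c , refl , refl , k<d , c< with color pt′ i (nth?-modifyAt-≡ i (setCell k c l′) T qT)
  ...       | _ , _ , ad , qD′ , V′ with just-injective (trans (sym qD) qD′)
  ...         | refl = contradiction
      (subst₂ _≤_ (val-ent (setCell k c l′ F) k c (ent-setCell-≡ k c l′ F pF)) (val-ent F k c pF)
        (mx (val (setCell k c l′ F)) (Tableau.Valid.isFit n λs d ad V′ inP′) _ _ (Grass.cell⁺ n λs d ad k c k<d c<)))
      (<⇒≱ l<l′)
    where
    inP′ : ∀ a b {v} → ent (setCell k c l′ F) a b ≡ just v → (v , a + b ∸ 1) ∈ P
    inP′ a b r with ent-setCell⁻ k c l′ F a b r
    ... | inj₂ (r′ , _) = inP a b r′
    ... | inj₁ (refl , refl , refl) =
      subst (λ z → (l′ , z) ∈ P) (cong (_∸ 1) s) (max-crosses mt (∈-crosses⁺ T e a″ b″ p″))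

  module Improve {T : PrismTab} (prism : InPrism n D T) (i : ℕ) {λs d F} (qD : nth? D i ≡ just (λs , d)) (qT : nth? T i ≡ just F)
    (V : ValidFilling (λs , d) F) {s : ℕ → ℕ → ℕ} (fit-s : FitShape λs d (support n T) s)
    (val≤s : ∀ a q → val F a q ≤ s a q) where

    open Tableau n λs d (all-nth? adm i qD)

    private
      pt : IsPT D T
      pt = proj₁ (proj₁ prism)

      P : Word
      P = support n T

      fit : FitShape λs d P (val F)
      fit = color-fit pt (∈-support⁺ pt) i (all-nth? adm i qD) qT V

    -- If T agrees with s to the left of and below a cell, its entry l there can be raised to that of s.
    -- Then l still occurs on the antidiagonal in another color, since T is minimal, so T is unstable.
    settled : ∀ k c → k < d → c < rowLength k →
      (∀ q → suc q ≡ suc (k + c) → Shape λs d (suc k) q → s (suc k) q ≤ val F (suc k) q) →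
      (Shape λs d (2 + k) (2 + (k + c)) → s (2 + k) (2 + (k + c)) ≤ val F (2 + k) (2 + (k + c))) →
      s (suc k) (suc (k + c)) ≤ val F (suc k) (suc (k + c))
    settled k c k<d c< left below with s (suc k) (suc (k + c)) ≤? val F (suc k) (suc (k + c))
    ... | yes p = p
    ... | no ¬p with Valid.entry V k c k<d c<
    ...   | l , ent-l = ⊥-elim (conclude (any? other? (cells T)))
      where
      a₀ q₀ l′ : ℕ
      a₀ = suc k
      q₀ = suc (k + c)
      l′ = s a₀ q₀

      cell₀ : Shape λs d a₀ q₀
      cell₀ = cell⁺ k c k<d c<

      val≡l : val F a₀ q₀ ≡ l
      val≡l = val-ent F k c ent-l

      l<l′ : l < l′
      l<l′ = subst (_< l′) val≡l (≰⇒> ¬p)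

      T′ : PrismTab
      T′ = update T (suc i) a₀ (suc c) l′

      -- The fit of T with a single cell raised. An increase can only violate the comparisons with
      -- the left neighbour and with the cell below, which `left` and `below` settle.
      s′ : ℕ → ℕ → ℕ
      s′ a q = if does (a ≟ a₀) then (if does (q ≟ q₀) then l′ else val F a q) else val F a q

      At : ℕ → ℕ → Set
      At a q = a ≡ a₀ × q ≡ q₀

      at? : ∀ a q → Dec (At a q)
      at? a q = (a ≟ a₀) ×-dec (q ≟ q₀)

      s′-at : ∀ {a q} → At a q → s′ a q ≡ l′
      s′-at (refl , refl) = trans (≡⇒if {i = a₀} refl) (≡⇒if {i = q₀} refl)

      s′-off : ∀ {a q} → ¬ At a q → s′ a q ≡ val F a q
      s′-off {a} {q} ¬at with a ≟ a₀
      ... | no a≢ = ≢⇒if a≢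
      ... | yes refl = trans (≡⇒if {i = a₀} refl) (≢⇒if (λ q≡ → ¬at (refl , q≡)))

      fit′ : FitShape λs d P s′
      fit′ = record { cross = cross′ ; weak = weak′ ; strict = strict′ }
        where
        cross′ : ∀ a q → Shape λs d a q → (s′ a q , q) ∈ P
        cross′ a q cell with at? a q
        ... | yes at@(refl , refl) = subst (λ z → (z , q₀) ∈ P) (sym (s′-at at)) (cross fit-s a₀ q₀ cell₀)
        ... | no ¬at = subst (λ z → (z , q) ∈ P) (sym (s′-off ¬at)) (cross fit a q cell)
        val≤s′ : ∀ a q → val F a q ≤ s′ a q
        val≤s′ a q with at? a q
        ... | yes at@(refl , refl) = ≤-trans (val≤s a₀ q₀) (≤-reflexive (sym (s′-at at)))
        ... | no ¬at = ≤-reflexive (sym (s′-off ¬at))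
        weak′ : ∀ a q → Shape λs d a q → Shape λs d a (suc q) → s′ a (suc q) ≤ s′ a q
        weak′ a q cell cell′ with at? a (suc q)
        ... | no ¬at = ≤-trans (≤-reflexive (s′-off ¬at)) (≤-trans (weak fit a q cell cell′) (val≤s′ a q))
        ... | yes at@(refl , e) = ≤-trans (≤-reflexive (s′-at at)) (≤-trans
            (subst (λ z → s a₀ z ≤ s a₀ q) e (weak fit-s a₀ q cell cell′)) (≤-trans (left q e cell) (val≤s′ a₀ q)))
        strict′ : ∀ a q → Shape λs d a q → Shape λs d (suc a) (suc q) → s′ a q < s′ (suc a) (suc q)
        strict′ a q cell cell′ with at? a q
        ... | no ¬at = ≤-<-trans (≤-reflexive (s′-off ¬at)) (<-≤-trans (strict fit a q cell cell′) (val≤s′ (suc a) (suc q)))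
        ... | yes at@(refl , refl) = ≤-<-trans (≤-reflexive (s′-at at)) (<-≤-trans (strict fit-s a₀ q₀ cell cell′)
            (≤-trans (below cell′) (val≤s′ (suc a₀) (suc q₀))))

      V′ : ValidFilling (λs , d) (setCell k c l′ F)
      V′ = fit-valid (Pipes.crosses n (support-subs n T)) fit′ (trans (length-modifyAt k _ F) (proj₁ V))
        (λ a 1≤a a≤d → trans (length-nthD-modifyAt k _ (length-modifyAt c _) F (a ∸ 1)) (proj₁ (proj₂ V) a 1≤a a≤d)) view
        where
        view : ∀ a b {v} → ent (setCell k c l′ F) a b ≡ just v →
          ∃ λ k′ → ∃ λ c′ → a ≡ suc k′ × b ≡ suc c′ × k′ < d × c′ < rowLength k′ × v ≡ s′ (suc k′) (suc (k′ + c′))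
        view a b r with ent-setCell⁻ k c l′ F a b r
        ... | inj₁ (refl , refl , refl) = k , c , refl , refl , k<d , c< , sym (s′-at (refl , refl))
        ... | inj₂ (r′ , ≢) with Valid.entry⁻ V a b r′
        ...   | k′ , c′ , refl , refl , k′<d , c′< = k′ , c′ , refl , refl , k′<d , c′< ,
          trans (sym (val-ent F k′ c′ r′)) (sym (s′-off {suc k′} {suc (k′ + c′)} λ { (refl , e) → ≢ (refl , cong suc (+-cancelˡ-≡ k c′ c (suc-injective e))) }))

      pt′ : IsPT D T′
      pt′ = pointwise-modifyAt pt i (setCell k c l′) qD qT V′

      Other : ℕ × ℕ × ℕ × ℕ → Set
      Other (c′ , a , b , v) = c′ ≢ suc i × v ≡ l × a + b ≡ a₀ + suc c

      other? : ∀ x → Dec (Other x)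
      other? (c′ , a , b , v) = ¬? (c′ ≟ suc i) ×-dec ((v ≟ l) ×-dec (a + b ≟ a₀ + suc c))

      q₀≡ : q₀ ≡ a₀ + suc c ∸ 1
      q₀≡ = sym (+-suc k c)

      l′∈ : (l′ , q₀) ∈ P
      l′∈ = cross fit-s a₀ q₀ cell₀

      conclude : Dec (Any Other (cells T)) → ⊥
      conclude (yes o) with find o
      ... | (c′ , a , b , v) , x∈ , c′≢ , refl , ab≡ with ∈-crosses⁻ T (∈-support⁻ n T l′∈)
      ...   | e , a″ , b″ , p″ , q₀≡′ = proj₂ prism (suc i , a₀ , suc c , c′ , a , b , e , a″ , b″ , l , l′ ,
              entC-just T i {F} {a₀} {suc c} qT ent-l , ∈-cells⁻ T {c′} {a} {b} x∈ , c′≢ ∘ sym , ab≡ , p″ ,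
              trans (sym (proj₂ (entC-cross pt e a″ b″ p″))) (trans (cong suc (sym q₀≡′)) (cong suc q₀≡)) , l<l′ , pt′)
      conclude (no ¬o) = <⇒≱ smaller (subst₂ _≤_ (totalDeg≡length pt) (totalDeg≡length pt′) (proj₂ (proj₁ prism) T′ pt′))
        where
        -- By `¬o` no other color has l on this antidiagonal, and by `antidiagonal-injective` no
        -- other cell of the same color has it; so the support of T′ is that of T without this
        -- crossing, or less.
        lost : ¬ ((l , q₀) ∈ crossesOf T′)
        lost z∈ with ∈-crosses⁻ T′ z∈
        ... | c′ , a , b , p , q≡ with entC-update⁻ T i k c l′ c′ a b p
        ...   | inj₁ (_ , _ , _ , l≡l′) = <⇒≢ l<l′ l≡l′
        ...   | inj₂ (p′ , ≢) with c′ ≟ suc i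
        ...     | no c′≢ = ¬o (lose (∈-cells⁺ T {c′} {a} {b} p′) (c′≢ , refl ,
                  trans (sym (proj₂ (entC-cross pt c′ a b p′))) (trans (cong suc (sym q≡)) (cong suc q₀≡))))
        ...     | yes refl with entC-view T c′ a b p′
        ...       | _ , _ , refl , qT′ , r with just-injective (trans (sym qT) qT′)
        ...         | refl with Valid.entry⁻ V a b r
        ...           | k′ , c″ , refl , refl , k′<d , c″< with trans q≡ (+-suc k′ c″)
        ...             | q₀≡k′ with suc-injective (antidiagonal-injective shape-steps fit a₀ (suc k′) q₀ cell₀
                            (subst (Shape λs d (suc k′)) (sym q₀≡k′) (cell⁺ k′ c″ k′<d c″<))
                            (trans val≡l (sym (trans (cong (val F (suc k′)) q₀≡k′) (val-ent F k′ c″ r)))))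
        ...               | refl = ≢ (refl , refl , cong suc (sym (+-cancelˡ-≡ k c c″ (suc-injective q₀≡k′))))
        sub : ∀ {z} → z ∈ support n T′ → z ∈ P
        sub {v , q} z∈ with ∈-crosses⁻ T′ (∈-support⁻ n T′ z∈)
        ... | c′ , a , b , p , refl with entC-update⁻ T i k c l′ c′ a b p
        ...   | inj₁ (refl , refl , refl , refl) = subst (λ z → (l′ , z) ∈ P) q₀≡ l′∈
        ...   | inj₂ (p′ , _) = ∈-support⁺ pt (∈-crosses⁺ T c′ a b p′)
        smaller : length (support n T′) < length P
        smaller = unique-⊆-length {xs = (l , q₀) ∷ support n T′}
          (All.tabulate (λ z∈ e → lost (subst (_∈ crossesOf T′) (sym e) (∈-support⁻ n T′ z∈))) ∷ support-unique n T′)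
          λ { (here refl) → subst (λ z → (z , q₀) ∈ P) val≡l (cross fit a₀ q₀ cell₀) ; (there z∈) → sub z∈ }

    -- Cells are settled from the bottom row upwards and from left to right, so that the two
    -- neighbours limiting an increase come first. The number g counts the rows below.
    bounded : ∀ g k c → suc k + g ≡ d → c < rowLength k → s (suc k) (suc (k + c)) ≤ val F (suc k) (suc (k + c))
    bounded-left : ∀ g k c → suc k + g ≡ d → c < rowLength k →
      ∀ q → suc q ≡ suc (k + c) → Shape λs d (suc k) q → s (suc k) q ≤ val F (suc k) q
    bounded g k c e c< = settled k c (m+n≤o⇒m≤o (suc k) (≤-reflexive e)) c< (bounded-left g k c e c<) (below g e)
      where
      below : ∀ g → suc k + g ≡ d → Shape λs d (2 + k) (2 + (k + c)) → s (2 + k) (2 + (k + c)) ≤ val F (2 + k) (2 + (k + c))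
      below zero    e (_ , k≤d , _) = contradiction (≤-trans k≤d (≤-reflexive (trans (sym e) (+-identityʳ (suc k))))) (<⇒≱ ≤-refl)
      below (suc g) e cell = bounded g (suc k) c (trans (cong suc (sym (+-suc k g))) e) (≤-trans c< (rowLength-mono k))
    bounded-left g k zero    e c< q q≡ (_ , _ , k≤q) = contradiction (≤-trans k≤q (≤-reflexive (trans (suc-injective q≡) (+-identityʳ k)))) (<⇒≱ ≤-refl)
    bounded-left g k (suc c) e c< q q≡ _ = subst (λ z → s (suc k) z ≤ val F (suc k) z) (trans (sym (+-suc k c)) (sym (suc-injective q≡)))
      (bounded g k c e (<⇒≤ c<))

  prism-max : ∀ {T} → InPrism n D T → MaxTableau (support n T) T
  prism-max {T} prism = pointwise-tabulate pt λ i {p} {F} qD qT V → V ,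
      (λ a b r → ∈-support⁺ pt (∈-crosses⁺ T (suc i) a b (entC-just T i {F} {a} {b} qT r))) , maximal i qD qT V
    where
    pt : IsPT D T
    pt = proj₁ (proj₁ prism)
    maximal : ∀ i {λs d F} → nth? D i ≡ just (λs , d) → nth? T i ≡ just F → ValidFilling (λs , d) F →
      ∀ t → FitShape λs d (support n T) t → ∀ a q → Shape λs d a q → t a q ≤ val F a q
    maximal i {λs} {d} {F} qD qT V t fit-t a q cell with Grass.cell⁻ n λs d (all-nth? adm i qD) a q cell
    ... | k , c , refl , refl , k<d , c< = ≤-trans (m≤n⊔m (val F (suc k) (suc (k + c))) _)
      -- Joining `t` with T itself gives a fit that lies above T everywhere, as `Improve` demands.
      (Improve.bounded prism i qD qT V (fit-⊔ (color-fit pt (∈-support⁺ pt) i (all-nth? adm i qD) qT V) fit-t (λ a q _ → ⊔-∈ (val F a q) (t a q)))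
        (λ a q → m≤m⊔n (val F a q) (t a q)) (d ∸ suc k) k c (m+[n∸m]≡n k<d) c<)

-- The bijection between Prism and the reduced pipe dreams of MinPerm.

subs-ext : ∀ {A : Set} {Q : List A} → Unique Q → ∀ {P P′} → P ∈ subs Q → P′ ∈ subs Q →
  (∀ {z} → z ∈ P → z ∈ P′) → (∀ {z} → z ∈ P′ → z ∈ P) → P ≡ P′
subs-ext [] (here refl) (here refl) _ _ = refl
subs-ext {Q = x ∷ Q} (x∉ ∷ u) P∈ P′∈ f g with ∈-++⁻ (subs Q) P∈ | ∈-++⁻ (subs Q) P′∈
... | inj₁ p | inj₁ p′ = subs-ext u p p′ f g
... | inj₁ p | inj₂ p′ with ∈-map⁻ (x ∷_) p′
...   | _ , _ , refl = contradiction refl (All.lookup x∉ (Any-resp-⊆ (subs⇒⊆ p) (g (here refl))))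
subs-ext {Q = x ∷ Q} (x∉ ∷ u) P∈ P′∈ f g | inj₂ p | inj₁ p′ with ∈-map⁻ (x ∷_) p
...   | _ , _ , refl = contradiction refl (All.lookup x∉ (Any-resp-⊆ (subs⇒⊆ p′) (f (here refl))))
subs-ext {Q = x ∷ Q} (x∉ ∷ u) P∈ P′∈ f g | inj₂ p | inj₂ p′ with ∈-map⁻ (x ∷_) p | ∈-map⁻ (x ∷_) p′
...   | R , R∈ , refl | R′ , R′∈ , refl = cong (x ∷_) (subs-ext u R∈ R′∈ (λ z∈ → tail R∈ z∈ (f (there z∈))) (λ z∈ → tail R′∈ z∈ (g (there z∈))))
  where
  tail : ∀ {R R′ z} → R ∈ subs Q → z ∈ R → z ∈ x ∷ R′ → z ∈ R′
  tail R∈ z∈ (here refl) = contradiction refl (All.lookup x∉ (Any-resp-⊆ (subs⇒⊆ R∈) z∈))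
  tail R∈ z∈ (there z∈′)   = z∈′

map-unique : ∀ {A B : Set} (f : A → B) {xs} → (∀ {x y} → x ∈ xs → y ∈ xs → f x ≡ f y → x ≡ y) → Unique xs → Unique (map f xs)
map-unique f inj [] = []
map-unique f inj (x∉ ∷ u) = All.map⁺ (All.tabulate (λ y∈ e → All.lookup x∉ y∈ (inj (here refl) (there y∈) e))) ∷
  map-unique f (λ x∈ y∈ → inj (there x∈) (there y∈)) u

concat-monomials : ∀ n (Ts : List PrismTab) → (∀ T → T ∈ Ts → wtExp n T ≡ weight n (support n T)) →
  sumP (map (wtP n) Ts) ≡ map (monomial n) (map (support n) Ts)
concat-monomials n []       h = refl
concat-monomials n (T ∷ Ts) h = cong₂ _∷_ (cong (+ 1 ,_) (h T (here refl))) (concat-monomials n Ts (λ T T∈ → h T (there T∈)))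

concat-schubert : ∀ n (Ws : List (List ℕ)) → (∀ w → w ∈ Ws → IsPerm n w) →
  sumP (map (schubert n) Ws) ≈P map (monomial n) (concat (map (pipeDreams n) Ws))
concat-schubert n []       h e = refl
concat-schubert n (w ∷ Ws) h e = begin
  coeff (schubert n w ++ sumP (map (schubert n) Ws)) e
    ≡⟨ coeff-++ (schubert n w) _ e ⟩
  coeff (schubert n w) e ℤ.+ coeff (sumP (map (schubert n) Ws)) e
    ≡⟨ cong₂ ℤ._+_ (schubert-pipePoly n w (h w (here refl)) e) (concat-schubert n Ws (λ w w∈ → h w (there w∈)) e) ⟩
  coeff (pipePoly n w) e ℤ.+ coeff (map (monomial n) rest) e
    ≡⟨ coeff-++ (pipePoly n w) (map (monomial n) rest) e ⟨
  coeff (pipePoly n w ++ map (monomial n) rest) e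
    ≡⟨ cong (λ p → coeff p e) (map-++ (monomial n) (pipeDreams n w) rest) ⟨
  coeff (map (monomial n) (pipeDreams n w ++ rest)) e ∎
  where
  open ≡-Reasoning
  rest : List (Word)
  rest = concat (map (pipeDreams n) Ws)

module Correspondence (n : ℕ) (D : Data) (adm : All (Admissible n) D) where
  open PrismTableau n D adm
  open Stability n D adm

  reduced-tableau : ∀ {v P} → GeA n D v → P ∈ subs (staircase n) → red n P v ≡ true → ∃ λ T → MaxTableau P T
  reduced-tableau {v} {P} ge P∈ r with red⇒dem n P v r
  ... | refl = max-exists P∈ (GeA⇒dominates D (dem-perm n P) adm ge)

  support-⊆ : ∀ {P T} → MaxTableau P T → ∀ {z} → z ∈ support n T → z ∈ P
  support-⊆ {T = T} mt z∈ = max-crosses mt (∈-support⁻ n T z∈)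

  length-support : ∀ {v P T} → red n P v ≡ true → MaxTableau P T → length (support n T) ≤ inv v
  length-support {v} {P} {T} r mt = ≤-trans (unique-⊆-length (support-unique n T) (support-⊆ mt)) (≤-reflexive (red⇒length n P v r))

  module _ {T : PrismTab} (prism : InPrism n D T) where

    private
      pt : IsPT D T
      pt = proj₁ (proj₁ prism)

      P : Word
      P = support n T

      P∈ : P ∈ subs (staircase n)
      P∈ = support-subs n T

      w : List ℕ
      w = dem n P

      cs : All (Cross n) P
      cs = Pipes.crosses n P∈

    -- A reduced pipe dream of v carries a tableau, whose degree is at most its number of crossings
    -- `inv v`; the degree of T is minimal.
    prism-≤ : ∀ v → IsPerm n v → GeA n D v → length P ≤ inv v
    prism-≤ v pv ge with red-exists n v pv
    ... | P′ , P′∈ , r with reduced-tableau ge P′∈ r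
    ...   | T′ , mt = ≤-trans (subst₂ _≤_ (totalDeg≡length pt) (totalDeg≡length (max-IsPT mt)) (proj₂ (proj₁ prism) T′ (max-IsPT mt)))
      (length-support r mt)

    prism-red : red n P w ≡ true
    prism-red = dem⇒red n P cs (prism-≤ w (dem-perm n P) (support-GeA pt))

    prism-minPerm : InMinPermA n D w
    prism-minPerm = (dem-perm n P , support-GeA pt , minimal) , (w , dem-perm n P , support-GeA pt , refl) ,
      λ v pv ge → ≤-trans (inv-dem n P cs) (prism-≤ v pv ge)
      where
      minimal : ∀ v → IsPerm n v → GeA n D v → BruhatLe n v w → v ≡ w
      -- A permutation above A has at least `inv w` inversions, so by rigidity none other lies below
      -- w.
      minimal v pv ge le = bruhat-rigid n P w v cs prism-red (dem-perm n P) pv corners (≤-trans (inv-dem n P cs) (prism-≤ v pv ge))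
        where
        corners : ∀ i j → i ≤ n → j ≤ n → corner w i j ≤ corner v i j
        corners zero    j       _  _  = z≤n
        corners (suc i) zero    _  _  = ≤-trans (≤-reflexive (corner-col0 (dem-perm n P) (suc i))) z≤n
        corners (suc i) (suc j) i≤ j≤ = le (suc i) (suc j) (s≤s z≤n) i≤ (s≤s z≤n) j≤

  prism-injective : ∀ {T T′} → InPrism n D T → InPrism n D T′ → support n T ≡ support n T′ → T ≡ T′
  prism-injective {T} {T′} p p′ e = max-unique (prism-max p) (subst (λ P → MaxTableau P T′) (sym e) (prism-max p′))

  -- The greatest tableau carried by P has its support inside P, and both have `inv w` crossings, so
  -- that no crossing of P is missed.
  minPerm-prism : ∀ {w P} → InMinPermA n D w → P ∈ subs (staircase n) → red n P w ≡ true →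
    ∃ λ T → InPrism n D T × support n T ≡ P
  minPerm-prism {w} {P} ((pw , ge , _) , _ , deg) P∈ r with reduced-tableau ge P∈ r
  ... | T , mt = T , ((pt , minimal) , max-stable mt) , subs-ext (staircase-unique n) (support-subs n T) P∈ (support-⊆ mt) ⊇
    where
    pt : IsPT D T
    pt = max-IsPT mt
    inv-≤ : ∀ {T′} → IsPT D T′ → inv w ≤ length (support n T′)
    inv-≤ {T′} pt′ = ≤-trans (deg (dem n (support n T′)) (dem-perm n (support n T′)) (support-GeA pt′))
      (inv-dem n (support n T′) (Pipes.crosses n (support-subs n T′)))
    minimal : ∀ T′ → IsPT D T′ → totalDeg n T ≤ totalDeg n T′
    minimal T′ pt′ = subst₂ _≤_ (sym (totalDeg≡length pt)) (sym (totalDeg≡length pt′)) (≤-trans (length-support r mt) (inv-≤ pt′))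
    ⊇ : ∀ {z} → z ∈ P → z ∈ support n T
    ⊇ {z} z∈ with z ∈×? support n T
    ... | yes p = p
    -- A crossing of P outside the support would leave fewer than `inv w` crossings, but the
    -- Demazure product of the support is above A and w has minimal length.
    ... | no ¬p = contradiction (unique-⊆-length {xs = z ∷ support n T}
        (All.tabulate (λ { y∈ refl → ¬p y∈ }) ∷ support-unique n T) (λ { (here refl) → z∈ ; (there y∈) → support-⊆ mt y∈ }))
      (≤⇒≯ (≤-trans (≤-reflexive (red⇒length n P w r)) (inv-≤ pt)))

  module _ {Ts Ws} (Ts⇔ : ∀ T → (T ∈ Ts) ⇔ InPrism n D T) (Ws⇔ : ∀ w → (w ∈ Ws) ⇔ InMinPermA n D w) where

    open Equivalence

    support-reduced : ∀ T → T ∈ Ts → support n T ∈ concat (map (pipeDreams n) Ws)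
    support-reduced T T∈ = ∈-concat⁺′ (∈-pipeDreams⁺ n w (support-subs n T) (prism-red {T} (to (Ts⇔ T) T∈)))
        (∈-map⁺ (pipeDreams n) (from (Ws⇔ w) (prism-minPerm {T} (to (Ts⇔ T) T∈))))
      where
      w : List ℕ
      w = dem n (support n T)

    reduced-support : ∀ w P → w ∈ Ws → P ∈ pipeDreams n w → P ∈ map (support n) Ts
    reduced-support w P w∈ P∈ = recast (minPerm-prism {w} {P} (to (Ws⇔ w) w∈) (proj₁ (∈-pipeDreams⁻ n w P∈)) (proj₂ (∈-pipeDreams⁻ n w P∈)))
      where
      recast : (∃ λ T → InPrism n D T × support n T ≡ P) → P ∈ map (support n) Ts
      recast (T , prism , refl) = ∈-map⁺ (support n) (from (Ts⇔ T) prism)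

    -- A reduced pipe dream recovers its permutation as its Demazure product.
    reduced-disjoint : ∀ {w w′} → w ≢ w′ → ∀ {P} → ¬ (P ∈ pipeDreams n w × P ∈ pipeDreams n w′)
    reduced-disjoint {w} {w′} w≢w′ {P} (p , p′) =
      w≢w′ (trans (sym (red⇒dem n P w (proj₂ (∈-pipeDreams⁻ n w p)))) (red⇒dem n P w′ (proj₂ (∈-pipeDreams⁻ n w′ p′))))

    supports-unique : Unique Ts → Unique (map (support n) Ts)
    supports-unique = map-unique (support n) (λ {T} {T′} T∈ T′∈ → prism-injective {T} {T′} (to (Ts⇔ T) T∈) (to (Ts⇔ T′) T′∈))

    concat-pipeDreams-unique : Unique Ws → Unique (concat (map (pipeDreams n) Ws))
    concat-pipeDreams-unique uW = Unique.concat⁺ (All.map⁺ (All.tabulate (λ {w} _ → pipeDreams-unique n w)))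
      (AllPairs.map⁺ (AllPairs.map reduced-disjoint uW))

    supports↭reduced : Unique Ts → Unique Ws → map (support n) Ts ↭ concat (map (pipeDreams n) Ws)
    supports↭reduced uT uW = unique-set⇒↭ (supports-unique uT) (concat-pipeDreams-unique uW) toReduced fromReduced
      where
      toReduced : ∀ {P} → P ∈ map (support n) Ts → P ∈ concat (map (pipeDreams n) Ws)
      toReduced P∈ with ∈-map⁻ (support n) P∈
      ... | T , T∈ , refl = support-reduced T T∈
      fromReduced : ∀ {P} → P ∈ concat (map (pipeDreams n) Ws) → P ∈ map (support n) Ts
      fromReduced {P} P∈ with ∈-concat⁻′ (map (pipeDreams n) Ws) P∈
      ... | R , P∈R , R∈ with ∈-map⁻ (pipeDreams n) R∈
      ...   | w , w∈ , refl = reduced-support w P w∈ P∈R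

theorem1p1 : (n : ℕ) (D : Data) → D ≢ []
    → All (λ p → IsPartition (Data.Product.proj₁ p) × 1 ≤ Data.Product.proj₂ p
    × length (Data.Product.proj₁ p) ≤ Data.Product.proj₂ p
    × part (Data.Product.proj₁ p) 1 + Data.Product.proj₂ p ≤ n) D
    → (Ts : List PrismTab) → Unique Ts → (∀ T → (T ∈ Ts) ⇔ InPrism n D T)
    → (Ws : List (List ℕ)) → Unique Ws → (∀ w → (w ∈ Ws) ⇔ InMinPermA n D w)
    → sumP (map (wtP n) Ts) ≈P sumP (map (schubert n) Ws)
theorem1p1 n D _ adm Ts uT Ts⇔ Ws uW Ws⇔ e = begin
  coeff (sumP (map (wtP n) Ts)) e
    ≡⟨ cong (λ p → coeff p e) (concat-monomials n Ts (λ T T∈ → PrismTableau.wtExp≡weight n D adm (proj₁ (proj₁ (to (Ts⇔ T) T∈))))) ⟩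
  coeff (map (monomial n) (map (support n) Ts)) e
    ≡⟨ coeff-↭ e (map⁺ (monomial n) (Correspondence.supports↭reduced n D adm Ts⇔ Ws⇔ uT uW)) ⟩
  coeff (map (monomial n) (concat (map (pipeDreams n) Ws))) e
    ≡⟨ concat-schubert n Ws (λ w w∈ → proj₁ (proj₁ (to (Ws⇔ w) w∈))) e ⟨
  coeff (sumP (map (schubert n) Ws)) e ∎
  where
  open ≡-Reasoning
  open Equivalence
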